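{- Let $F:=(5,\{01,12,23,30,04\})$ be the $4$-cycle plus a pendant edge. Then $$\lambda_F=\frac{5^6}{2^8\cdot 3^5}=\frac{15625}{62208}.$$ Moreover, there is a flag algebra certificate on $N=5$ vertices for the upper bound $\lambda_F\le \frac{5^6}{2^8\cdot 3^5}$ that satisfies the following properties. (A) For the single-vertex type $1$, the zero eigenspace of the matrix $X^1$ has dimension $1$. (B) For the type $\nu:=(3,\{01,02\})$ (the cherry), the zero eigenspace of the matrix $X^\nu$ has dimension $1$. (C) The zero eigenspace of the matrix $X^\sigma$ for the type $\sigma:=(3,\{\})$ (with 3 vertices and no edges) does not contain any non-zero linear combination of $4$-vertex $\sigma$-flags in which the unlabelled vertex sends at most one edge to the roots. (D) The zero eigenspace of the matrix $X^\mu$ for the type $\mu:=(3,\{01\})$ (with 3 vertices and one edge) does not contain any non-zero linear combination of $4$-vertex $\mu$-flags in which the unlabelled vertex sends at most one edge to the roots.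
   Context: Graphs are finite and simple. $[m]:=\{0,\dots,m-1\}$, $ij$ abbreviates the unordered pair $\{i,j\}$, and $(m,E)$ denotes the graph with vertex set $[m]$ and edge set $E$. Inducibility: for a graph $F$ with $\kappa$ vertices and a graph $G$ with $n\ge\kappa$ vertices, $\lambda_F(G)$ is the number of $\kappa$-subsets of $V(G)$ that induce a subgraph isomorphic to $F$, divided by $\binom{n}{\kappa}$. Further, $\lambda_F(n):=\max\{\lambda_F(G): G\text{ is an } n\text{ -vertex graph}\}$ and $\lambda_F:=\lim_{n\to\infty}\lambda_F(n)$ (the limit exists). Flag algebra certificates. $\mathcal{F}^0_N$ is the set of $N$-vertex graphs up to isomorphism (one representative each), and $P(F',G)$ is the number of $v(F')$-subsets of $V(G)$ inducing a copy of $F'$. A type $\tau$ is a graph with vertex set $[q]$. A $\tau$-flag is a pair $(H,h)$ with $H$ a graph and $h:[q]\to V(H)$ an embedding of $\tau$ (injective, preserving edges and non-edges); the vertices of $h([q])$ are the roots (labelled vertices), and isomorphisms of $\tau$-flags must preserve each labelled root. $\mathcal{F}^\tau_s$ is the set of $s$-vertex $\tau$-flags up to isomorphism, in a fixed order. For $\tau$-flags, $P((F',f'),(H,h))$ is the number of $(v(F')-q)$-subsets $X\subseteq V(H)\setminus h([q])$ such that $(H[X\cup h([q])],h)$ is isomorphic to $(F',f')$, and $\mathbf{V}^{\tau,s}_{(H,h)}:=\big(P((F',f'),(H,h))\big)_{(F',f')\in\mathcal{F}^\tau_s}$. A flag algebra certificate on $N\ge v(F)$ vertices for the bound $\lambda_F\le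 u$ consists of a positive semi-definite matrix $X^\tau$, indexed by $\mathcal{F}^\tau_s$ with $s=(N+q)/2$, for each type $\tau$ on $[q]$ with $1\le q\le N-2$ and $q\equiv N\pmod 2$ (where from each class of types isomorphic as unlabelled graphs only one representative is listed and the zero matrix is used for all others; here $1,\nu,\sigma,\mu$ are among the listed representatives), and of real numbers $c_{F'}\ge0$ for $F'\in\mathcal{F}^0_N$, such that for every graph $G$ of order $n\to\infty$ $$\sum_{F'\in\mathcal{F}^0_N}(u-\lambda_F(F'))P(F',G)=\sum_{\substack{1\le q\le N-2\\ q\equiv N \bmod 2}}\ \sum_{f:[q]\hookrightarrow V(G)}\big(\mathbf{V}^{\tau,s}_{(G,f)}\big)^{T}X^\tau\,\mathbf{V}^{\tau,s}_{(G,f)}+\sum_{F'\in\mathcal{F}^0_N}c_{F'} P(F',G)+O(n^{N-1}),$$ where the inner sum is over injections $f$, $s=(N+q)/2$, and $\tau$ is the graph on $[q]$ for which $f$ is an embedding of $\tau$ into $G$. For $N=5$ one has $s=3$ when $q=1$ and $s=4$ when $q=3$. The zero eigenspace of $X^\tau$ is its kernel in $\mathbb{R}^{\mathcal{F}^\tau_s}$; a linear combination of certain $\tau$-flags means a vector in $\mathbb{R}^{\mathcal{F}^\tau_s}$ supported on the coordinates indexed by those flags. -}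

module Defs where

open import Data.Bool using (Bool; true; false)
import Data.Bool.Properties as Bool
open import Data.Fin as Fin using (Fin; #_)
import Data.Fin.Properties as Fin
open import Data.Fin.Subset as Subset using (Subset; _∪_; _⊆_; _∉_; ∁; ⁅_⁆; ⋃)
import Data.Fin.Subset.Properties as Subset
import Data.Integer as ℤ
open import Data.List using (List; []; _∷_; length; map; foldr; filter; mapMaybe; allFin; upTo; cartesianProductWith)
import Data.List.Extrema as Extrema
import Data.List.Membership.DecPropositional as ListMembership
import Data.Maybe as Maybe
open import Data.Nat as ℕ using (ℕ; zero; suc; z≤n; s≤s)
import Data.Nat.Properties as ℕ
open import Data.Nat.Combinatorics using (_C_; nCk+nC[k+1]≡[n+1]C[k+1])
open import Data.Product using (∃; ∃!; _×_; _,_; proj₁; proj₂)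
import Data.Product.Properties as Product
open import Data.Rational as ℚ using (ℚ; 0ℚ; 1ℚ; ½)
import Data.Rational.Properties as ℚ
import Data.Sum as Sum
open import Data.Vec using (Vec; []; _∷_; lookup; tabulate; toList)
import Data.Vec as Vec
import Data.Vec.Properties as Vec
open import Function using (_∘_; mk⇔)
open import Function.Definitions using (Injective)
open import Relation.Binary.PropositionalEquality using (_≡_; _≢_; refl; sym; trans; cong; subst)
open import Relation.Nullary using (Dec; ¬_; does)
open import Relation.Nullary.Decidable using (dec⇒maybe; map′; does-⇔; dec-false; ¬?; _×-dec_; _⊎-dec_; _→-dec_)
open import Relation.Binary.Bundles using (DecTotalOrder)
open import Relation.Unary using (Decidable)

private variable
  κ k n q s : ℕ

-- Real numbers are Cauchy sequences of rationals, compared by the setoid equality _≈_.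

IsCauchy : (ℕ → ℚ) → Set
IsCauchy a = ∀ ε → 0ℚ ℚ.< ε → ∃ λ N → ∀ m n → N ℕ.≤ m → N ℕ.≤ n → ℚ.∣ a m ℚ.- a n ∣ ℚ.≤ ε

record ℝ : Set where
  constructor real
  field
    seq    : ℕ → ℚ
    cauchy : IsCauchy seq

open ℝ

private
  module _ where
    open import Data.Rational.Solver using (module +-*-Solver)
    open +-*-Solver
    open ℚ.≤-Reasoning

    sum-split : ∀ a b c d → (a ℚ.+ b) ℚ.- (c ℚ.+ d) ≡ (a ℚ.- c) ℚ.+ (b ℚ.- d)
    sum-split = solve 4 (λ a b c d → (a :+ b) :- (c :+ d) := (a :- c) :+ (b :- d)) refl

    neg-split : ∀ a b → (ℚ.- a) ℚ.- (ℚ.- b) ≡ ℚ.- (a ℚ.- b)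
    neg-split = solve 2 (λ a b → (:- a) :- (:- b) := :- (a :- b)) refl

    product-split : ∀ a b c d → a ℚ.* b ℚ.- c ℚ.* d ≡ a ℚ.* (b ℚ.- d) ℚ.+ d ℚ.* (a ℚ.- c)
    product-split = solve 4 (λ a b c d → a :* b :- c :* d := a :* (b :- d) :+ d :* (a :- c)) refl

    cancel : ∀ a b → a ≡ (a ℚ.- b) ℚ.+ b
    cancel = solve 2 (λ a b → a := (a :- b) :+ b) refl

    drop : ∀ a b → (a ℚ.+ b) ℚ.- b ≡ a
    drop = solve 2 (λ a b → (a :+ b) :- b := a) refl

    swap-sub : ∀ a b → a ℚ.- b ≡ ℚ.- (b ℚ.- a)
    swap-sub = solve 2 (λ a b → a :- b := :- (b :- a)) refl

    double : ∀ a → a ≡ ½ ℚ.* a ℚ.+ ½ ℚ.* a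
    double = solve 1 (λ a → a := con ½ :* a :+ con ½ :* a) refl

    half-positive : ∀ {ε} → 0ℚ ℚ.< ε → 0ℚ ℚ.< ½ ℚ.* ε
    half-positive {ε} 0<ε = ℚ.positive⁻¹ (½ ℚ.* ε) {{ℚ.pos*pos⇒pos ½ ε {{ℚ.positive 0<ε}}}}

    halves : ∀ {a b} ε → ℚ.∣ a ∣ ℚ.≤ ½ ℚ.* ε → ℚ.∣ b ∣ ℚ.≤ ½ ℚ.* ε → ℚ.∣ a ℚ.+ b ∣ ℚ.≤ ε
    halves {a} {b} ε p r = begin
      ℚ.∣ a ℚ.+ b ∣             ≤⟨ ℚ.∣p+q∣≤∣p∣+∣q∣ a b ⟩
      ℚ.∣ a ∣ ℚ.+ ℚ.∣ b ∣       ≤⟨ ℚ.+-mono-≤ p r ⟩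
      ½ ℚ.* ε ℚ.+ ½ ℚ.* ε       ≡⟨ double ε ⟨
      ε                         ∎

    abs-sub : ∀ a b → ℚ.∣ a ∣ ℚ.- ℚ.∣ b ∣ ℚ.≤ ℚ.∣ a ℚ.- b ∣
    abs-sub a b = begin
      ℚ.∣ a ∣ ℚ.- ℚ.∣ b ∣                       ≡⟨ cong (λ z → ℚ.∣ z ∣ ℚ.- ℚ.∣ b ∣) (cancel a b) ⟩
      ℚ.∣ (a ℚ.- b) ℚ.+ b ∣ ℚ.- ℚ.∣ b ∣         ≤⟨ ℚ.+-monoˡ-≤ (ℚ.- ℚ.∣ b ∣) (ℚ.∣p+q∣≤∣p∣+∣q∣ (a ℚ.- b) b) ⟩
      (ℚ.∣ a ℚ.- b ∣ ℚ.+ ℚ.∣ b ∣) ℚ.- ℚ.∣ b ∣   ≡⟨ drop ℚ.∣ a ℚ.- b ∣ ℚ.∣ b ∣ ⟩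
      ℚ.∣ a ℚ.- b ∣                             ∎

    abs-lipschitz : ∀ a b → ℚ.∣ ℚ.∣ a ∣ ℚ.- ℚ.∣ b ∣ ∣ ℚ.≤ ℚ.∣ a ℚ.- b ∣
    abs-lipschitz a b with ℚ.∣p∣≡p∨∣p∣≡-p (ℚ.∣ a ∣ ℚ.- ℚ.∣ b ∣)
    ... | Sum.inj₁ e = subst (ℚ._≤ ℚ.∣ a ℚ.- b ∣) (sym e) (abs-sub a b)
    ... | Sum.inj₂ e = begin
      ℚ.∣ ℚ.∣ a ∣ ℚ.- ℚ.∣ b ∣ ∣     ≡⟨ e ⟩
      ℚ.- (ℚ.∣ a ∣ ℚ.- ℚ.∣ b ∣)     ≡⟨ swap-sub ℚ.∣ b ∣ ℚ.∣ a ∣ ⟨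
      ℚ.∣ b ∣ ℚ.- ℚ.∣ a ∣           ≤⟨ abs-sub b a ⟩
      ℚ.∣ b ℚ.- a ∣                 ≡⟨ cong ℚ.∣_∣ (swap-sub b a) ⟩
      ℚ.∣ ℚ.- (a ℚ.- b) ∣           ≡⟨ ℚ.∣-p∣≡∣p∣ (a ℚ.- b) ⟩
      ℚ.∣ a ℚ.- b ∣                 ∎

    eventually-bounded : ∀ x → ∃ λ B → ℚ.Positive B × ∃ λ N → ∀ n → N ℕ.≤ n → ℚ.∣ seq x n ∣ ℚ.≤ B
    eventually-bounded x with cauchy x 1ℚ (ℚ.positive⁻¹ 1ℚ)
    ... | N , near = 1ℚ ℚ.+ b , ℚ.pos+nonNeg⇒pos 1ℚ b {{ℚ.∣-∣-nonNeg (seq x N)}} , N , λ n N≤n → begin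
      ℚ.∣ seq x n ∣                                 ≡⟨ cong ℚ.∣_∣ (cancel (seq x n) (seq x N)) ⟩
      ℚ.∣ (seq x n ℚ.- seq x N) ℚ.+ seq x N ∣       ≤⟨ ℚ.∣p+q∣≤∣p∣+∣q∣ (seq x n ℚ.- seq x N) (seq x N) ⟩
      ℚ.∣ seq x n ℚ.- seq x N ∣ ℚ.+ b               ≤⟨ ℚ.+-monoˡ-≤ b (near n N N≤n ℕ.≤-refl) ⟩
      1ℚ ℚ.+ b                                      ∎
      where b = ℚ.∣ seq x N ∣

    eventually-close-multiples : ∀ x B → ℚ.Positive B → ∀ ε → 0ℚ ℚ.< ε →
      ∃ λ N → ∀ b m n → ℚ.∣ b ∣ ℚ.≤ B → N ℕ.≤ m → N ℕ.≤ n → ℚ.∣ b ℚ.* (seq x m ℚ.- seq x n) ∣ ℚ.≤ ε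
    eventually-close-multiples x B B>0 ε 0<ε =
      N , λ b m n b≤B N≤m N≤n → let d = seq x m ℚ.- seq x n in begin
        ℚ.∣ b ℚ.* d ∣           ≡⟨ ℚ.∣p*q∣≡∣p∣*∣q∣ b d ⟩
        ℚ.∣ b ∣ ℚ.* ℚ.∣ d ∣     ≤⟨ ℚ.*-monoʳ-≤-nonNeg ℚ.∣ d ∣ {{ℚ.∣-∣-nonNeg d}} b≤B ⟩
        B ℚ.* ℚ.∣ d ∣           ≤⟨ ℚ.*-monoˡ-≤-nonNeg B {{ℚ.pos⇒nonNeg B}} (near m n N≤m N≤n) ⟩
        B ℚ.* (ℚ.1/ B ℚ.* ε)    ≡⟨ ℚ.*-assoc B (ℚ.1/ B) ε ⟨
        (B ℚ.* ℚ.1/ B) ℚ.* ε    ≡⟨ cong (ℚ._* ε) (ℚ.*-inverseʳ B) ⟩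
        1ℚ ℚ.* ε                ≡⟨ ℚ.*-identityˡ ε ⟩
        ε                       ∎
      where
      instance
        _ = B>0
        _ = ℚ.pos⇒nonZero B
      δ>0 : 0ℚ ℚ.< ℚ.1/ B ℚ.* ε
      δ>0 = ℚ.positive⁻¹ (ℚ.1/ B ℚ.* ε) {{ℚ.pos*pos⇒pos (ℚ.1/ B) {{ℚ.1/pos⇒pos B}} ε {{ℚ.positive 0<ε}}}}
      N = proj₁ (cauchy x (ℚ.1/ B ℚ.* ε) δ>0)
      near = proj₂ (cauchy x (ℚ.1/ B ℚ.* ε) δ>0)

    -- Nothing depends on how these unfold; abstract keeps normal forms small.
    abstract

      const-cauchy : ∀ r → IsCauchy (λ _ → r)
      const-cauchy r ε 0<ε = 0 , λ _ _ _ _ →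
        subst (ℚ._≤ ε) (sym (cong ℚ.∣_∣ (ℚ.+-inverseʳ r))) (ℚ.<⇒≤ 0<ε)

      +-cauchy : ∀ x y → IsCauchy (λ n → seq x n ℚ.+ seq y n)
      +-cauchy x y ε 0<ε =
        let (M , close-x) = cauchy x (½ ℚ.* ε) (half-positive 0<ε)
            (N , close-y) = cauchy y (½ ℚ.* ε) (half-positive 0<ε)
        in M ℕ.⊔ N , λ m n m≥ n≥ →
           subst (λ z → ℚ.∣ z ∣ ℚ.≤ ε) (sym (sum-split (seq x m) (seq y m) (seq x n) (seq y n)))
             (halves ε (close-x m n (ℕ.m⊔n≤o⇒m≤o M N m≥) (ℕ.m⊔n≤o⇒m≤o M N n≥))
                       (close-y m n (ℕ.m⊔n≤o⇒n≤o M N m≥) (ℕ.m⊔n≤o⇒n≤o M N n≥)))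

      neg-cauchy : ∀ x → IsCauchy (λ n → ℚ.- seq x n)
      neg-cauchy x ε 0<ε =
        let (N , close) = cauchy x ε 0<ε
        in N , λ m n m≥ n≥ →
           subst (ℚ._≤ ε)
             (sym (trans (cong ℚ.∣_∣ (neg-split (seq x m) (seq x n))) (ℚ.∣-p∣≡∣p∣ (seq x m ℚ.- seq x n))))
             (close m n m≥ n≥)

      *-cauchy : ∀ x y → IsCauchy (λ n → seq x n ℚ.* seq y n)
      *-cauchy x y ε 0<ε =
        let (A , A>0 , K , x≤A) = eventually-bounded x
            (B , B>0 , L , y≤B) = eventually-bounded y
            (M , close-y) = eventually-close-multiples y A A>0 (½ ℚ.* ε) (half-positive 0<ε)
            (N , close-x) = eventually-close-multiples x B B>0 (½ ℚ.* ε) (half-positive 0<ε)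
            KL = K ℕ.⊔ L
            MN = M ℕ.⊔ N
        in KL ℕ.⊔ MN , λ m n m≥ n≥ →
           let m≥KL = ℕ.m⊔n≤o⇒m≤o KL MN m≥
               n≥KL = ℕ.m⊔n≤o⇒m≤o KL MN n≥
               m≥MN = ℕ.m⊔n≤o⇒n≤o KL MN m≥
               n≥MN = ℕ.m⊔n≤o⇒n≤o KL MN n≥
           in subst (λ z → ℚ.∣ z ∣ ℚ.≤ ε) (sym (product-split (seq x m) (seq y m) (seq x n) (seq y n)))
                (halves ε
                  (close-y (seq x m) m n (x≤A m (ℕ.m⊔n≤o⇒m≤o K L m≥KL)) (ℕ.m⊔n≤o⇒m≤o M N m≥MN) (ℕ.m⊔n≤o⇒m≤o M N n≥MN))
                  (close-x (seq y n) m n (y≤B n (ℕ.m⊔n≤o⇒n≤o K L n≥KL)) (ℕ.m⊔n≤o⇒n≤o M N m≥MN) (ℕ.m⊔n≤o⇒n≤o M N n≥MN)))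

      abs-cauchy : ∀ x → IsCauchy (λ n → ℚ.∣ seq x n ∣)
      abs-cauchy x ε 0<ε =
        let (N , close) = cauchy x ε 0<ε
        in N , λ m n m≥ n≥ → ℚ.≤-trans (abs-lipschitz (seq x m) (seq x n)) (close m n m≥ n≥)

infixl 6 _+_ _-_
infixl 7 _*_
infix  8 -_
infix  4 _≈_ _≤_

fromℚ : ℚ → ℝ
fromℚ r = real (λ _ → r) (const-cauchy r)

fromℕ : ℕ → ℝ
fromℕ n = fromℚ (ℤ.+ n ℚ./ 1)

0ℝ : ℝ
0ℝ = fromℚ 0ℚ

_+_ : ℝ → ℝ → ℝ
x + y = real (λ n → seq x n ℚ.+ seq y n) (+-cauchy x y)

-_ : ℝ → ℝ
- x = real (λ n → ℚ.- seq x n) (neg-cauchy x)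

_-_ : ℝ → ℝ → ℝ
x - y = x + (- y)

_*_ : ℝ → ℝ → ℝ
x * y = real (λ n → seq x n ℚ.* seq y n) (*-cauchy x y)

∣_∣ : ℝ → ℝ
∣ x ∣ = real (λ n → ℚ.∣ seq x n ∣) (abs-cauchy x)

record _≤_ (x y : ℝ) : Set where
  constructor ≤-intro
  field
    ≤-elim : ∀ ε → 0ℚ ℚ.< ε → ∃ λ N → ∀ n → N ℕ.≤ n → seq x n ℚ.≤ seq y n ℚ.+ ε

_≈_ : ℝ → ℝ → Set
x ≈ y = x ≤ y × y ≤ x

sumOver : {A : Set} → List A → (A → ℝ) → ℝ
sumOver xs f = foldr (λ x → f x +_) 0ℝ xs

syntax sumOver xs (λ x → e) = ∑[ x ∈ xs ] e

Vector : ℕ → Set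
Vector k = Fin k → ℝ

Matrix : ℕ → Set
Matrix k = Fin k → Fin k → ℝ

infix 4 _≋_
_≋_ : Vector k → Vector k → Set
v ≋ w = ∀ i → v i ≈ w i

𝟎ᵛ : Vector k
𝟎ᵛ _ = 0ℝ

infixr 7 _·_ _⊡_
_·_ : Vector k → Vector k → ℝ
v · w = ∑[ i ∈ allFin _ ] (v i * w i)

_⊡_ : Matrix k → Vector k → Vector k
(X ⊡ v) i = X i · v

PositiveSemidefinite : Matrix k → Set
PositiveSemidefinite X = (∀ i j → X i j ≈ X j i) × (∀ v → 0ℝ ≤ v · (X ⊡ v))

Kernel : Matrix k → Vector k → Set
Kernel X v = X ⊡ v ≋ 𝟎ᵛ

combination : ∀ {d} → Vector d → (Fin d → Vector k) → Vector k
combination c b i = ∑[ j ∈ allFin _ ] (c j * b j i)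

HasDimension : (Vector k → Set) → ℕ → Set
HasDimension {k} S d = ∃ λ (b : Fin d → Vector k) →
  (∀ j → S (b j)) ×
  (∀ c → combination c b ≋ 𝟎ᵛ → c ≋ 𝟎ᵛ) ×
  (∀ v → S v → ∃ λ c → v ≋ combination c b)

vectors : {A : Set} → List A → ∀ k → List (Vec A k)
vectors xs zero    = [] ∷ []
vectors xs (suc k) = cartesianProductWith _∷_ xs (vectors xs k)

subsets : ∀ n → List (Subset n)
subsets = vectors (true ∷ false ∷ [])

select : {A : Set} {P : A → Set} → Decidable P → List A → List (∃ P)
select P? = mapMaybe λ x → Maybe.map (x ,_) (dec⇒maybe (P? x))

any-vec? : {P : Vec (Fin n) k → Set} → Decidable P → Dec (∃ P)
any-vec? {k = zero}  P? = map′ ([] ,_) (λ { ([] , p) → p }) (P? [])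
any-vec? {k = suc k} P? =
  map′ (λ (x , v , p) → x ∷ v , p) (λ { (x ∷ v , p) → x , v , p })
       (Fin.any? λ x → any-vec? λ v → P? (x ∷ v))

-- Adjacency is stored as a table, and simplicity irrelevantly, so that _≡_ on
-- Graph n is equality of labelled graphs.

Table : ℕ → Set
Table n = Vec (Vec Bool n) n

entry : Table n → Fin n → Fin n → Bool
entry t i j = lookup (lookup t i) j

IsSimple : Table n → Set
IsSimple t = (∀ i j → entry t i j ≡ entry t j i) × (∀ i → entry t i i ≡ false)

isSimple? : Decidable (IsSimple {n})
isSimple? t = Fin.all? (λ i → Fin.all? λ j → entry t i j Bool.≟ entry t j i)
        ×-dec Fin.all? (λ i → entry t i i Bool.≟ false)

record Graph (n : ℕ) : Set where
  constructor graph
  field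
    table   : Table n
    .simple : IsSimple table

  adj : Fin n → Fin n → Bool
  adj = entry table

open Graph using (adj)

module _ (a : Fin n → Fin n → Bool) where

  private
    t : Table n
    t = tabulate λ i → tabulate (a i)

  entry-tabulate : ∀ i j → entry t i j ≡ a i j
  entry-tabulate i j =
    trans (cong (λ row → lookup row j) (Vec.lookup∘tabulate _ i)) (Vec.lookup∘tabulate (a i) j)

  fromAdjacency : (∀ i j → a i j ≡ a j i) → (∀ i → a i i ≡ false) → Graph n
  fromAdjacency a-sym a-irrefl = graph t
    ( (λ i j → trans (entry-tabulate i j) (trans (a-sym i j) (sym (entry-tabulate j i))))
    , (λ i → trans (entry-tabulate i i) (a-irrefl i)))

fromEdges : ∀ n → List (Fin n × Fin n) → Graph n
fromEdges n E = fromAdjacency (λ i j → does (edge? i j))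
  (λ i j → does-⇔ (mk⇔ flip flip) (edge? i j) (edge? j i))
  (λ i → dec-false (edge? i i) λ (i≢i , _) → i≢i refl)
  where
  module E = ListMembership (Product.≡-dec (Fin._≟_ {n}) Fin._≟_)
  Edge : Fin n → Fin n → Set
  Edge i j = i ≢ j × ((i , j) E.∈ E Sum.⊎ (j , i) E.∈ E)
  edge? : ∀ i j → Dec (Edge i j)
  edge? i j = ¬? (i Fin.≟ j) ×-dec ((i , j) E.∈? E ⊎-dec (j , i) E.∈? E)
  flip : ∀ {i j} → Edge i j → Edge j i
  flip (i≢j , e) = i≢j ∘ sym , Sum.swap e

graphs : ∀ n → List (Graph n)
graphs n = map (λ (t , t-simple) → graph t t-simple) (select isSimple? (vectors (vectors (true ∷ false ∷ []) n) n))

-- A map Fin k → Fin n is represented by the vector of its values.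

IsInjective : Vec (Fin n) k → Set
IsInjective φ = Injective _≡_ _≡_ (lookup φ)

isInjective? : Decidable (IsInjective {n} {k})
isInjective? φ = map′ (λ inj {i} {j} → inj i j) (λ inj i j → inj {i} {j})
  (Fin.all? λ i → Fin.all? λ j → (lookup φ i Fin.≟ lookup φ j) →-dec (i Fin.≟ j))

Injection : ℕ → ℕ → Set
Injection q n = ∃ (IsInjective {n} {q})

injections : ∀ q n → List (Injection q n)
injections q n = select isInjective? (vectors (allFin n) q)

image : Vec (Fin n) k → Subset n
image φ = ⋃ (toList (Vec.map ⁅_⁆ φ))

IsEmbedding : Graph k → Graph n → Vec (Fin n) k → Set
IsEmbedding H G φ = IsInjective φ × (∀ i j → adj G (lookup φ i) (lookup φ j) ≡ adj H i j)

isEmbedding? : (H : Graph k) (G : Graph n) → Decidable (IsEmbedding H G)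
isEmbedding? H G φ = isInjective? φ
  ×-dec Fin.all? λ i → Fin.all? λ j → adj G (lookup φ i) (lookup φ j) Bool.≟ adj H i j

record Flag (τ : Graph q) (s : ℕ) : Set where
  constructor flag
  field
    underlying  : Graph s
    roots       : Vec (Fin s) q
    isEmbedding : IsEmbedding τ underlying roots

open Flag using (underlying; roots)

-- H ≅ K [ S ]: for a set S of vertices containing the roots of K, the flag H is
-- isomorphic to the subflag of K induced by S.

_≅_[_] : {τ : Graph q} → Flag τ s → Flag τ n → Subset n → Set
H ≅ K [ S ] = ∃ λ φ →
  IsEmbedding (underlying H) (underlying K) φ × image φ ≡ S × Vec.map (lookup φ) (roots H) ≡ roots K

_≅_[_]? : {τ : Graph q} (H : Flag τ s) (K : Flag τ n) (S : Subset n) → Dec (H ≅ K [ S ])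
H ≅ K [ S ]? = any-vec? λ φ → isEmbedding? (underlying H) (underlying K) φ
  ×-dec Vec.≡-dec Bool._≟_ (image φ) S
  ×-dec Vec.≡-dec Fin._≟_ (Vec.map (lookup φ) (roots H)) (roots K)

_≅_ : {τ : Graph q} → Flag τ s → Flag τ s → Set
H ≅ K = H ≅ K [ Subset.⊤ ]

P : {τ : Graph q} → Flag τ s → Flag τ n → ℕ
P {q = q} {s = s} {n = n} F H = length (filter counted? (subsets n))
  where
  counted? : Decidable λ X →
    X ⊆ ∁ (image (roots H)) × Subset.∣ X ∣ ≡ s ℕ.∸ q × F ≅ H [ X ∪ image (roots H) ]
  counted? X = (X Subset.⊆? ∁ (image (roots H)))
    ×-dec (Subset.∣ X ∣ ℕ.≟ s ℕ.∸ q)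
    ×-dec (F ≅ H [ X ∪ image (roots H) ]?)

-- Unlabelled graphs are flags of the type with no vertices.

𝟎 : Graph 0
𝟎 = fromEdges 0 []

unlabelled : Graph n → Flag 𝟎 n
unlabelled G = flag G [] ((λ { {()} }) , λ ())

inducedType : Graph n → Injection q n → Graph q
inducedType (graph t t-simple) (f , _) = graph (tabulate λ i → tabulate (a i))
  ( (λ i j → trans (entry-tabulate a i j) (trans (proj₁ t-simple _ _) (sym (entry-tabulate a j i))))
  , (λ i → trans (entry-tabulate a i i) (proj₂ t-simple _)))
  where
  a : Fin _ → Fin _ → Bool
  a i j = entry t (lookup f i) (lookup f j)

rooted : (G : Graph n) (f : Injection q n) → Flag (inducedType G f) n
rooted G (f , f-inj) = flag G f
  (f-inj , λ i j → sym (entry-tabulate (λ i j → adj G (lookup f i) (lookup f j)) i j))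

nCk-nonZero : k ℕ.≤ n → ℕ.NonZero (n C k)
nCk-nonZero {n = n} z≤n = _
nCk-nonZero {suc k} {suc n} (s≤s k≤n) =
  subst ℕ.NonZero (nCk+nC[k+1]≡[n+1]C[k+1] n k) (ℕ.>-nonZero (ℕ.<-≤-trans (ℕ.>-nonZero⁻¹ (n C k) {{nCk-nonZero k≤n}}) (ℕ.m≤m+n _ _)))

density : Graph κ → (G : Graph n) → .(κ ℕ.≤ n) → ℚ
density {κ} {n} F G κ≤n = (ℤ.+ P (unlabelled F) (unlabelled G) ℚ./ (n C κ)) {{nCk-nonZero κ≤n}}

-- Densities are non-negative, so the base value 0 does not affect the maximum.
maxDensity : Graph κ → ∀ n → .(κ ℕ.≤ n) → ℚ
maxDensity F n κ≤n = Extrema.max (DecTotalOrder.totalOrder ℚ.≤-decTotalOrder) 0ℚ (map (λ G → density F G κ≤n) (graphs n))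

HasInducibility : Graph κ → ℝ → Set
HasInducibility {κ} F c = ∀ ε → 0ℚ ℚ.< ε → ∃ λ n₀ → ∀ n (κ≤n : κ ℕ.≤ n) → n₀ ℕ.≤ n →
  ∣ fromℚ (maxDensity F n κ≤n) - c ∣ ≤ fromℚ ε

-- 𝓕^τ_s: one flag from each isomorphism class, in some order
record Representatives (τ : Graph q) (s : ℕ) : Set where
  field
    size     : ℕ
    rep      : Fin size → Flag τ s
    distinct : ∀ i j → rep i ≅ rep j → i ≡ j
    complete : ∀ H → ∃ λ i → H ≅ rep i

open Representatives using (size; rep)

Admissible : ℕ → ℕ → Set
Admissible N q = 1 ℕ.≤ q × q ℕ.≤ N ℕ.∸ 2 × q ℕ.% 2 ≡ N ℕ.% 2

admissible? : ∀ N → Decidable (Admissible N)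
admissible? N q = (1 ℕ.≤? q) ×-dec (q ℕ.≤? N ℕ.∸ 2) ×-dec (q ℕ.% 2 ℕ.≟ N ℕ.% 2)

typeSizes : ∀ N → List (∃ (Admissible N))
typeSizes N = select (admissible? N) (upTo N)

counts : {τ : Graph q} (R : Representatives τ s) → Flag τ n → Vector (size R)
counts R H i = fromℕ (P (rep R i) H)

-- Types that are not listed carry the zero matrix; Listed picks exactly one
-- type from each class of types that are isomorphic as unlabelled graphs.
record Multipliers (N : ℕ) : Set₁ where
  field
    𝓕⁰ : Representatives 𝟎 N
    𝓕  : ∀ {q} → .(Admissible N q) → (τ : Graph q) → Representatives τ ((N ℕ.+ q) ℕ./ 2)

    X     : ∀ {q} .(a : Admissible N q) (τ : Graph q) → Matrix (size (𝓕 a τ))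
    X-psd : ∀ {q} .(a : Admissible N q) (τ : Graph q) → PositiveSemidefinite (X a τ)

    Listed        : ∀ {q} → Graph q → Set
    listed-unique : ∀ {q} → .(Admissible N q) → (τ : Graph q) →
                    ∃! _≡_ λ τ′ → Listed τ′ × unlabelled τ ≅ unlabelled τ′
    X-unlisted    : ∀ {q} .(a : Admissible N q) (τ : Graph q) → ¬ Listed τ → ∀ i j → X a τ i j ≈ 0ℝ

    c             : Vector (size 𝓕⁰)
    c-nonNegative : ∀ i → 0ℝ ≤ c i

  copies : Graph n → Vector (size 𝓕⁰)
  copies G = counts 𝓕⁰ (unlabelled G)

  quadraticTerm : .(Admissible N q) → (G : Graph n) → Injection q n → ℝ
  quadraticTerm a G f = V · (X a τ ⊡ V)
    where
    τ = inducedType G f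
    V = counts (𝓕 a τ) (rooted G f)

module _ (F : Graph κ) {N : ℕ} (κ≤N : κ ℕ.≤ N) (u : ℝ) (M : Multipliers N) where

  open Multipliers M

  lhs : Graph n → ℝ
  lhs G = ∑[ i ∈ allFin _ ] ((u - fromℚ (density F (underlying (rep 𝓕⁰ i)) κ≤N)) * copies G i)

  rhs : Graph n → ℝ
  rhs G = (∑[ (q , a) ∈ typeSizes N ] ∑[ f ∈ injections q _ ] quadraticTerm a G f)
        + (∑[ i ∈ allFin _ ] (c i * copies G i))

  -- lhs G = rhs G + O(n^(N-1)), with a constant that does not depend on G
  IsCertificate : Set
  IsCertificate = ∃ λ C → ∃ λ n₀ → ∀ {n} (G : Graph n) → n₀ ℕ.≤ n →
    ∣ lhs G - rhs G ∣ ≤ C * fromℕ (n ℕ.^ (N ℕ.∸ 1))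

SendsAtMostOneEdge : {τ : Graph q} → Flag τ s → Set
SendsAtMostOneEdge H = ∀ v → v ∉ image (roots H) →
  length (filter (λ r → adj (underlying H) v r Bool.≟ true) (toList (roots H))) ℕ.≤ 1

-- v is a linear combination of those flags that satisfy Φ.
CombinationOf : {τ : Graph q} (R : Representatives τ s) → (Flag τ s → Set) → Vector (size R) → Set
CombinationOf R Φ v = ∀ i → ¬ Φ (rep R i) → v i ≈ 0ℝ

C₄-pendant : Graph 5
C₄-pendant = fromEdges 5
  ((# 0 , # 1) ∷ (# 1 , # 2) ∷ (# 2 , # 3) ∷ (# 3 , # 0) ∷ (# 0 , # 4) ∷ [])

point : Graph 1
point = fromEdges 1 []

ν σ μ : Graph 3
ν = fromEdges 3 ((# 0 , # 1) ∷ (# 0 , # 2) ∷ [])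
σ = fromEdges 3 []
μ = fromEdges 3 ((# 0 , # 1) ∷ [])

{-# OPTIONS --safe #-}

-- Upper bound. Up to O(n⁴), every term of the certificate is a sum over all
-- 5-tuples of vertices of a function of the ten adjacencies of the tuple. Such a
-- sum does not change when the function is symmetrized over the 120 permutations
-- of the tuple, so the matrices X may be any positive semi-definite matrices for
-- which the symmetrization of 2 (u - λ) minus the quadratic terms is non-negative
-- at all 1024 adjacency patterns: the symmetrized values themselves serve as the
-- coefficients c. The matrices are given as integer combinations of squares of
-- linear forms that vanish on the kernels forced by the extremal graphs.
--
-- Lower bound. In a random bipartite graph whose two sides are chosen with
-- probability 1/2 and whose edges are chosen with probability 5/6, five given
-- vertices induce the 4-cycle with a pendant edge with probability exactly u, so
-- for every n some n-vertex graph has density at least u.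

module Submission where

-- The kernels are forced as follows. On the random bipartite graphs the left side of the
-- certificate is `o(n⁵)`, while every term on the right is non-negative, so each `X` must
-- annihilate the limiting flag densities seen from every placement of the roots on the two sides.
-- Up to exchanging the sides there is one placement for the single vertex and one for the cherry,
-- so dimension 1 is the least possible in (A) and (B); there are four for `σ` and two for `μ`. Two
-- obstacles shape the text. First, the classes of five-vertex graphs stay abstract: every
-- coefficient is read off a table of 1024 integers that is invariant under adjacent swaps, so any
-- choice of representatives gives the same value. Second, entries of vectors are Cauchy sequences
-- and equality is a limit statement, so a kernel cannot be found by elimination with decidable zero
-- tests. Instead, explicit integer identities derive each needed linear relation from the rows of
-- the matrix, and such identities preserve sequences that tend to zero.

-- Finite sums of rational numbers.

module Sums where

  open import Data.Bool using (Bool; true; false; _∧_)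
  open import Data.Fin as Fin using (Fin; zero; suc)
  import Data.Integer as ℤ
  import Data.Integer.Properties as ℤ
  open import Data.List using (List; []; _∷_; _++_; length; map; filter; allFin; cartesianProductWith)
  import Data.List.Properties as List
  open import Data.Nat as ℕ using (ℕ; zero; suc)
  import Data.Nat.Properties as ℕ
  import Data.Nat.Coprimality as Coprime
  open import Data.Product using (∃; _,_)
  open import Data.Rational
  import Data.Rational.Properties as ℚ
  open import Data.Sum using (inj₁; inj₂)
  open import Data.Rational.Solver using (module +-*-Solver)
  open import Data.Vec using (Vec; []; _∷_)
  open import Function using (_∘_)
  open import Relation.Binary.PropositionalEquality
  open import Relation.Nullary using (does; yes; no)
  open import Relation.Unary using (Decidable)
  open import Defs using (select; vectors)

  private variable
    A B C : Set
    f g : A → ℚ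

  ∑ : List A → (A → ℚ) → ℚ
  ∑ []       f = 0ℚ
  ∑ (x ∷ xs) f = f x + ∑ xs f

  ⟦_⟧ : Bool → ℚ
  ⟦ true ⟧  = 1ℚ
  ⟦ false ⟧ = 0ℚ

  opaque

    -- Opaque, so that the large integers of the certificate stay symbolic: later arithmetic goes
    -- through the homomorphism and order laws below.
    ι : ℤ.ℤ → ℚ
    ι z = z / 1

    ι-def : ∀ z → ι z ≡ z / 1
    ι-def z = refl

    private
      -- The fraction already in lowest terms, on which sums, products and comparisons compute;
      -- `z / 1` would be stuck at its normalisation for a variable `z`.
      int : ℤ.ℤ → ℚ
      int z = mkℚ z 0 (Coprime.sym (Coprime.1-coprimeTo _))

      ι≡int : ∀ z → ι z ≡ int z
      ι≡int z = ℚ.↥p/↧p≡p (int z)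

      int-neg : ∀ a → int (ℤ.- a) ≡ - int a
      int-neg (ℤ.+ zero)    = refl
      int-neg (ℤ.+ suc n)   = refl
      int-neg ℤ.-[1+ n ]    = refl

    ι-+ : ∀ a b → ι (a ℤ.+ b) ≡ ι a + ι b
    ι-+ a b = sym (trans (cong₂ _+_ (ι≡int a) (ι≡int b)) (cong ι (cong₂ ℤ._+_ (ℤ.*-identityʳ a) (ℤ.*-identityʳ b))))

    ι-* : ∀ a b → ι (a ℤ.* b) ≡ ι a * ι b
    ι-* a b = sym (cong₂ _*_ (ι≡int a) (ι≡int b))

    ι-neg : ∀ a → ι (ℤ.- a) ≡ - ι a
    ι-neg a = trans (ι≡int (ℤ.- a)) (trans (int-neg a) (cong -_ (sym (ι≡int a))))

    ι-mono : ∀ {a b} → a ℤ.≤ b → ι a ≤ ι b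
    ι-mono {a} {b} a≤b rewrite ι≡int a | ι≡int b = *≤* (subst₂ ℤ._≤_ (sym (ℤ.*-identityʳ a)) (sym (ℤ.*-identityʳ b)) a≤b)

    ι-mono-< : ∀ {a b} → a ℤ.< b → ι a < ι b
    ι-mono-< {a} {b} a<b rewrite ι≡int a | ι≡int b = *<* (subst₂ ℤ._<_ (sym (ℤ.*-identityʳ a)) (sym (ℤ.*-identityʳ b)) a<b)

  ι-- : ∀ a b → ι (a ℤ.- b) ≡ ι a - ι b
  ι-- a b = trans (ι-+ a (ℤ.- b)) (cong (ι a +_) (ι-neg b))

  ι-0 : ι ℤ.0ℤ ≡ 0ℚ
  ι-0 = ι-def ℤ.0ℤ

  ι-1 : ι ℤ.1ℤ ≡ 1ℚ
  ι-1 = ι-def ℤ.1ℤ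

  ιℕ : ℕ → ℚ
  ιℕ n = ι (ℤ.+ n)

  ιℕ-+ : ∀ a b → ιℕ (a ℕ.+ b) ≡ ιℕ a + ιℕ b
  ιℕ-+ a b = ι-+ (ℤ.+ a) (ℤ.+ b)

  ιℕ-* : ∀ a b → ιℕ (a ℕ.* b) ≡ ιℕ a * ιℕ b
  ιℕ-* a b = trans (cong ι (ℤ.pos-* a b)) (ι-* (ℤ.+ a) (ℤ.+ b))

  ιℕ-mono : ∀ {a b} → a ℕ.≤ b → ιℕ a ≤ ιℕ b
  ιℕ-mono a≤b = ι-mono (ℤ.+≤+ a≤b)

  ιℕ-suc : ∀ n → ιℕ (suc n) ≡ 1ℚ + ιℕ n
  ιℕ-suc n = trans (ιℕ-+ 1 n) (cong (_+ ιℕ n) ι-1)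

  0≤ιℕ : ∀ n → 0ℚ ≤ ιℕ n
  0≤ιℕ n = subst (_≤ ιℕ n) ι-0 (ιℕ-mono {0} {n} ℕ.z≤n)

  0<ιℕ : ∀ n → 0ℚ < ιℕ (suc n)
  0<ιℕ n = subst (_< ιℕ (suc n)) ι-0 (ι-mono-< (ℤ.+<+ ℕ.z<s))

  0≤+ : ∀ {a b} → 0ℚ ≤ a → 0ℚ ≤ b → 0ℚ ≤ a + b
  0≤+ = ℚ.+-mono-≤

  0≤* : ∀ {a b} → 0ℚ ≤ a → 0ℚ ≤ b → 0ℚ ≤ a * b
  0≤* {a} {b} 0≤a 0≤b = ℚ.nonNegative⁻¹ (a * b) {{ℚ.nonNeg*nonNeg⇒nonNeg a {{nonNegative 0≤a}} b {{nonNegative 0≤b}}}}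

  0<* : ∀ {a b} → 0ℚ < a → 0ℚ < b → 0ℚ < a * b
  0<* {a} {b} 0<a 0<b = ℚ.positive⁻¹ (a * b) {{ℚ.pos*pos⇒pos a {{positive 0<a}} b {{positive 0<b}}}}

  *-monoˡ : ∀ {a b} c → 0ℚ ≤ c → a ≤ b → c * a ≤ c * b
  *-monoˡ c 0≤c = ℚ.*-monoˡ-≤-nonNeg c {{nonNegative 0≤c}}

  *-monoʳ : ∀ {a b} c → 0ℚ ≤ c → a ≤ b → a * c ≤ b * c
  *-monoʳ c 0≤c = ℚ.*-monoʳ-≤-nonNeg c {{nonNegative 0≤c}}

  *-mono : ∀ {a b c d} → 0ℚ ≤ a → 0ℚ ≤ d → a ≤ b → c ≤ d → a * c ≤ b * d
  *-mono 0≤a 0≤d a≤b c≤d = ℚ.≤-trans (*-monoˡ _ 0≤a c≤d) (*-monoʳ _ 0≤d a≤b)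

  *-cancelˡ-≡ : ∀ c {a b} → 0ℚ < c → c * a ≡ c * b → a ≡ b
  *-cancelˡ-≡ c {a} {b} 0<c p = ℚ.≤-antisym
    (ℚ.*-cancelˡ-≤-pos c {{positive 0<c}} (ℚ.≤-reflexive p))
    (ℚ.*-cancelˡ-≤-pos c {{positive 0<c}} (ℚ.≤-reflexive (sym p)))

  0≤∣∣ : ∀ a → 0ℚ ≤ ∣ a ∣
  0≤∣∣ = ℚ.0≤∣p∣

  a≤∣a∣ : ∀ a → a ≤ ∣ a ∣
  a≤∣a∣ a with ℚ.≤-total 0ℚ a
  ... | inj₁ 0≤a = ℚ.≤-reflexive (sym (ℚ.0≤p⇒∣p∣≡p 0≤a))
  ... | inj₂ a≤0 = ℚ.≤-trans a≤0 (0≤∣∣ a)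

  0≤square : ∀ a → 0ℚ ≤ a * a
  0≤square a with ℚ.≤-total 0ℚ a
  ... | inj₁ 0≤a = 0≤* 0≤a 0≤a
  ... | inj₂ a≤0 = subst (0ℚ ≤_) (solve 1 (λ a → (:- a) :* (:- a) := a :* a) refl a) (0≤* 0≤-a 0≤-a)
    where
    open +-*-Solver using (solve; con; _:=_; _:+_; _:*_; _:-_; :-_)
    0≤-a : 0ℚ ≤ - a
    0≤-a = ℚ.neg-antimono-≤ a≤0

  0≤⟦⟧ : ∀ b → 0ℚ ≤ ⟦ b ⟧
  0≤⟦⟧ true  = ℚ.nonNegative⁻¹ 1ℚ
  0≤⟦⟧ false = ℚ.≤-refl

  ⟦⟧≤1 : ∀ b → ⟦ b ⟧ ≤ 1ℚ
  ⟦⟧≤1 true  = ℚ.≤-refl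
  ⟦⟧≤1 false = ℚ.nonNegative⁻¹ 1ℚ

  ⟦∧⟧ : ∀ a b → ⟦ a ∧ b ⟧ ≡ ⟦ a ⟧ * ⟦ b ⟧
  ⟦∧⟧ true  b = sym (ℚ.*-identityˡ ⟦ b ⟧)
  ⟦∧⟧ false b = sym (ℚ.*-zeroˡ ⟦ b ⟧)

  ∑-cong : ∀ (xs : List A) → (∀ x → f x ≡ g x) → ∑ xs f ≡ ∑ xs g
  ∑-cong []       e = refl
  ∑-cong (x ∷ xs) e = cong₂ _+_ (e x) (∑-cong xs e)

  ∑-mono : ∀ (xs : List A) → (∀ x → f x ≤ g x) → ∑ xs f ≤ ∑ xs g
  ∑-mono []       e = ℚ.≤-refl
  ∑-mono (x ∷ xs) e = ℚ.+-mono-≤ (e x) (∑-mono xs e)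

  ∑-nonNeg : ∀ (xs : List A) → (∀ x → 0ℚ ≤ f x) → 0ℚ ≤ ∑ xs f
  ∑-nonNeg []       e = ℚ.≤-refl
  ∑-nonNeg (x ∷ xs) e = 0≤+ (e x) (∑-nonNeg xs e)

  ∑-+ : ∀ (xs : List A) f g → ∑ xs (λ x → f x + g x) ≡ ∑ xs f + ∑ xs g
  ∑-+ []       f g = refl
  ∑-+ (x ∷ xs) f g = trans (cong (f x + g x +_) (∑-+ xs f g))
    (solve 4 (λ a b c d → (a :+ b) :+ (c :+ d) := (a :+ c) :+ (b :+ d)) refl (f x) (g x) (∑ xs f) (∑ xs g))
    where open +-*-Solver using (solve; con; _:=_; _:+_; _:*_; _:-_; :-_)

  ∑-*ˡ : ∀ (xs : List A) c f → ∑ xs (λ x → c * f x) ≡ c * ∑ xs f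
  ∑-*ˡ []       c f = sym (ℚ.*-zeroʳ c)
  ∑-*ˡ (x ∷ xs) c f = trans (cong (c * f x +_) (∑-*ˡ xs c f)) (sym (ℚ.*-distribˡ-+ c (f x) (∑ xs f)))

  ∑-*ʳ : ∀ (xs : List A) f c → ∑ xs (λ x → f x * c) ≡ ∑ xs f * c
  ∑-*ʳ xs f c = trans (∑-cong xs (λ x → ℚ.*-comm (f x) c)) (trans (∑-*ˡ xs c f) (ℚ.*-comm c (∑ xs f)))

  ∑-neg : ∀ (xs : List A) f → ∑ xs (λ x → - f x) ≡ - ∑ xs f
  ∑-neg []       f = refl
  ∑-neg (x ∷ xs) f = trans (cong (- f x +_) (∑-neg xs f)) (sym (ℚ.neg-distrib-+ (f x) (∑ xs f)))

  ∑-- : ∀ (xs : List A) f g → ∑ xs (λ x → f x - g x) ≡ ∑ xs f - ∑ xs g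
  ∑-- xs f g = trans (∑-+ xs f (λ x → - g x)) (cong (∑ xs f +_) (∑-neg xs g))

  ∑-0 : ∀ (xs : List A) → ∑ xs (λ _ → 0ℚ) ≡ 0ℚ
  ∑-0 []       = refl
  ∑-0 (x ∷ xs) = trans (ℚ.+-identityˡ _) (∑-0 xs)

  ∑-const : ∀ (xs : List A) c → ∑ xs (λ _ → c) ≡ ιℕ (length xs) * c
  ∑-const []       c = sym (trans (cong (_* c) ι-0) (ℚ.*-zeroˡ c))
  ∑-const (x ∷ xs) c = trans (cong (c +_) (∑-const xs c))
    (trans (solve 2 (λ c l → c :+ l :* c := (con 1ℚ :+ l) :* c) refl c (ιℕ (length xs)))
           (cong (_* c) (sym (ιℕ-suc (length xs)))))
    where open +-*-Solver using (solve; con; _:=_; _:+_; _:*_; _:-_; :-_)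

  ∑-++ : ∀ (xs ys : List A) f → ∑ (xs ++ ys) f ≡ ∑ xs f + ∑ ys f
  ∑-++ []       ys f = sym (ℚ.+-identityˡ _)
  ∑-++ (x ∷ xs) ys f = trans (cong (f x +_) (∑-++ xs ys f)) (sym (ℚ.+-assoc (f x) (∑ xs f) (∑ ys f)))

  ∑-map : ∀ (h : A → B) xs f → ∑ (map h xs) f ≡ ∑ xs (f ∘ h)
  ∑-map h []       f = refl
  ∑-map h (x ∷ xs) f = cong (f (h x) +_) (∑-map h xs f)

  ∑-swap : ∀ (xs : List A) (ys : List B) (f : A → B → ℚ) →
           ∑ xs (λ x → ∑ ys (f x)) ≡ ∑ ys (λ y → ∑ xs (λ x → f x y))
  ∑-swap []       ys f = sym (∑-0 ys)
  ∑-swap (x ∷ xs) ys f = trans (cong (∑ ys (f x) +_) (∑-swap xs ys f)) (sym (∑-+ ys (f x) _))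

  ∑-product : ∀ (h : A → B → C) xs ys f →
              ∑ (cartesianProductWith h xs ys) f ≡ ∑ xs (λ x → ∑ ys (λ y → f (h x y)))
  ∑-product h []       ys f = refl
  ∑-product h (x ∷ xs) ys f = trans (∑-++ (map (h x) ys) _ f) (cong₂ _+_ (∑-map (h x) ys f) (∑-product h xs ys f))

  ∑-allFin : ∀ {n} (f : Fin (suc n) → ℚ) → ∑ (allFin (suc n)) f ≡ f zero + ∑ (allFin n) (f ∘ suc)
  ∑-allFin {n} f = cong (f zero +_) (trans (cong (λ xs → ∑ xs f) (sym (List.map-tabulate {n = n} (λ i → i) suc))) (∑-map suc (allFin n) f))

  ∑-abs : ∀ (xs : List A) f → ∣ ∑ xs f ∣ ≤ ∑ xs (λ x → ∣ f x ∣)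
  ∑-abs []       f = ℚ.≤-refl
  ∑-abs (x ∷ xs) f = ℚ.≤-trans (ℚ.∣p+q∣≤∣p∣+∣q∣ (f x) (∑ xs f)) (ℚ.+-monoʳ-≤ ∣ f x ∣ (∑-abs xs f))

  ∑-indicator : ∀ {n} (i : Fin n) (f : Fin n → ℚ) → ∑ (allFin n) (λ j → ⟦ does (i Fin.≟ j) ⟧ * f j) ≡ f i
  ∑-indicator {suc n} zero f = trans (∑-allFin {n} (λ j → ⟦ does (zero Fin.≟ j) ⟧ * f j))
    (trans (cong₂ _+_ (ℚ.*-identityˡ (f zero))
             (trans (∑-cong (allFin n) (λ j → ℚ.*-zeroˡ (f (suc j)))) (∑-0 (allFin n))))
           (ℚ.+-identityʳ (f zero)))
  ∑-indicator {suc n} (suc i) f = trans (∑-allFin {n} (λ j → ⟦ does (suc i Fin.≟ j) ⟧ * f j))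
    (trans (cong₂ _+_ (ℚ.*-zeroˡ (f zero)) (∑-indicator i (f ∘ suc))) (ℚ.+-identityˡ _))

  length-filter : ∀ {P : A → Set} (P? : Decidable P) xs → ιℕ (length (filter P? xs)) ≡ ∑ xs (λ x → ⟦ does (P? x) ⟧)
  length-filter P? []       = ι-0
  length-filter P? (x ∷ xs) with does (P? x)
  ... | true  = trans (ιℕ-suc _) (cong (1ℚ +_) (length-filter P? xs))
  ... | false = trans (length-filter P? xs) (sym (ℚ.+-identityˡ _))

  ∑-select : ∀ {P : A → Set} (P? : Decidable P) xs (f : ∃ P → ℚ) (h : A → ℚ) →
             (∀ x p → f (x , p) ≡ h x) → ∑ (select P? xs) f ≡ ∑ xs (λ x → ⟦ does (P? x) ⟧ * h x)
  ∑-select P? []       f h e = refl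
  ∑-select P? (x ∷ xs) f h e with P? x
  ... | yes p = cong₂ _+_ (trans (e x p) (sym (ℚ.*-identityˡ (h x)))) (∑-select P? xs f h e)
  ... | no _  = trans (∑-select P? xs f h e) (trans (sym (ℚ.+-identityˡ _)) (cong (_+ ∑ xs (λ x → ⟦ does (P? x) ⟧ * h x)) (sym (ℚ.*-zeroˡ (h x)))))

  ∑-vectors : ∀ (xs : List A) {k} (f : Vec A (suc k) → ℚ) →
              ∑ (vectors xs (suc k)) f ≡ ∑ xs (λ x → ∑ (vectors xs k) (λ v → f (x ∷ v)))
  ∑-vectors xs {k} = ∑-product _∷_ xs (vectors xs k)

  ∑-vectors-1 : ∀ (xs : List A) k → ∑ (vectors xs k) (λ _ → 1ℚ) ≡ ιℕ (length xs ℕ.^ k)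
  ∑-vectors-1 xs zero    = trans (ℚ.+-identityʳ 1ℚ) (sym ι-1)
  ∑-vectors-1 xs (suc k) = trans (∑-vectors xs {k} _)
    (trans (∑-const xs _) (trans (cong (ιℕ (length xs) *_) (∑-vectors-1 xs k)) (sym (ιℕ-* (length xs) (length xs ℕ.^ k)))))

-- Counting subsets by injective tuples.

module Tuples where

  open import Data.Bool using (true; false; _∧_)
  open import Data.Fin as Fin using (Fin; zero; suc)
  import Data.Fin.Properties as Fin
  open import Data.Fin.Subset as Subset using (Subset; _∪_; _∈_; _∉_; _⊆_; ∁; ⁅_⁆; ⊥)
  open import Data.Fin.Subset.Properties as Subset using (_∈?_)
  open import Data.List using (List; []; _∷_; allFin)
  import Data.List.Properties as List
  open import Data.Nat as ℕ using (ℕ; zero; suc; _!)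
  import Data.Nat.Properties as ℕ
  open import Data.Nat.Combinatorics using (_C_; nCk+nC[k+1]≡[n+1]C[k+1])
  open import Data.Product using (∃; _×_; _,_; proj₁)
  open import Data.Sum using (_⊎_; inj₁; inj₂)
  open import Data.Rational using (ℚ; 0ℚ; 1ℚ; _+_; _*_; _-_; -_; _≤_; ∣_∣)
  import Data.Rational.Properties as ℚ
  open import Data.Rational.Solver using (module +-*-Solver)
  open import Data.Vec as Vec using (Vec; []; _∷_; lookup; _++_)
  open import Function using (_∘_; mk⇔; _⇔_)
  open import Relation.Binary.PropositionalEquality
  open import Relation.Nullary using (Dec; does; yes; no; contradiction)
  open import Relation.Nullary.Decidable using (does-⇔; ¬?; _×-dec_; dec-true; dec-false)
  open import Defs using (subsets; vectors; image; IsInjective; isInjective?; Graph; Flag; P; _≅_[_]?)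
  open Flag using (underlying; roots; isEmbedding)
  open Sums

  private variable
    k n m q s : ℕ

  infix 4 _∉?_
  _∉?_ : (v : Fin n) (X : Subset n) → Dec (v ∉ X)
  v ∉? X = ¬? (v ∈? X)

  image-∈⁺ : (φ : Vec (Fin n) k) → ∀ i → lookup φ i ∈ image φ
  image-∈⁺ (x ∷ φ) zero    = Subset.x∈p∪q⁺ (inj₁ (Subset.x∈⁅x⁆ x))
  image-∈⁺ (x ∷ φ) (suc i) = Subset.x∈p∪q⁺ (inj₂ (image-∈⁺ φ i))

  image-∈⁻ : (φ : Vec (Fin n) k) → ∀ {x} → x ∈ image φ → ∃ λ i → lookup φ i ≡ x
  image-∈⁻ []      x∈ = contradiction x∈ Subset.∉⊥
  image-∈⁻ (y ∷ φ) x∈ with Subset.x∈p∪q⁻ ⁅ y ⁆ (image φ) x∈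
  ... | inj₁ x∈y = zero , sym (Subset.x∈⁅y⁆⇒x≡y y x∈y)
  ... | inj₂ x∈φ with image-∈⁻ φ x∈φ
  ...   | i , e = suc i , e

  image-++ : (φ : Vec (Fin n) k) (ψ : Vec (Fin n) m) → image φ ∪ image ψ ≡ image (φ ++ ψ)
  image-++ []      ψ = Subset.∪-identityˡ (image ψ)
  image-++ (x ∷ φ) ψ = trans (Subset.∪-assoc ⁅ x ⁆ (image φ) (image ψ)) (cong (⁅ x ⁆ ∪_) (image-++ φ ψ))

  injective-∷⁻ : ∀ {x : Fin n} {φ : Vec (Fin n) k} → IsInjective (x ∷ φ) → x ∉ image φ × IsInjective φ
  injective-∷⁻ {x = x} {φ} inj =
    (λ x∈ → let (i , e) = image-∈⁻ φ x∈ in contradiction (inj {zero} {suc i} (sym e)) λ ()) ,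
    (λ {i} {j} e → Fin.suc-injective (inj {suc i} {suc j} e))

  injective-∷⁺ : ∀ {x : Fin n} {φ : Vec (Fin n) k} → x ∉ image φ → IsInjective φ → IsInjective (x ∷ φ)
  injective-∷⁺ {φ = φ} x∉ inj {zero}  {zero}  e = refl
  injective-∷⁺ {φ = φ} x∉ inj {zero}  {suc j} e = contradiction (subst (_∈ image φ) (sym e) (image-∈⁺ φ j)) x∉
  injective-∷⁺ {φ = φ} x∉ inj {suc i} {zero}  e = contradiction (subst (_∈ image φ) e (image-∈⁺ φ i)) x∉
  injective-∷⁺ {φ = φ} x∉ inj {suc i} {suc j} e = cong suc (inj e)

  injective-++⁻ : (φ : Vec (Fin n) k) {ψ : Vec (Fin n) m} → IsInjective (φ ++ ψ) → image φ ⊆ ∁ (image ψ) × IsInjective φ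
  injective-++⁻ []      inj = (λ x∈ → contradiction x∈ Subset.∉⊥) , λ {}
  injective-++⁻ (x ∷ φ) {ψ} inj with injective-∷⁻ {x = x} {φ ++ ψ} inj
  ... | x∉ , inj′ with injective-++⁻ φ {ψ} inj′
  ...   | φ⊆ , φ-inj = ⊆∁ , injective-∷⁺ {x = x} {φ} (λ x∈ → x∉ (∈-++ (inj₁ x∈))) φ-inj
    where
    ∈-++ = λ {y} p → subst (y ∈_) (image-++ φ ψ) (Subset.x∈p∪q⁺ {p = image φ} {image ψ} p)
    ⊆∁ : image (x ∷ φ) ⊆ ∁ (image ψ)
    ⊆∁ y∈ with Subset.x∈p∪q⁻ ⁅ x ⁆ (image φ) y∈
    ... | inj₂ y∈φ = φ⊆ y∈φ
    ... | inj₁ y∈x rewrite Subset.x∈⁅y⁆⇒x≡y x y∈x = Subset.x∉p⇒x∈∁p λ x∈ψ → x∉ (∈-++ (inj₂ x∈ψ))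

  injective-++⁺ : (φ : Vec (Fin n) k) {ψ : Vec (Fin n) m} → IsInjective ψ →
                  image φ ⊆ ∁ (image ψ) → IsInjective φ → IsInjective (φ ++ ψ)
  injective-++⁺ []      ψ-inj φ⊆ φ-inj = ψ-inj
  injective-++⁺ (x ∷ φ) {ψ} ψ-inj φ⊆ φ-inj with injective-∷⁻ {x = x} {φ} φ-inj
  ... | x∉ , φ-inj′ = injective-∷⁺ {x = x} {φ ++ ψ} x∉′ (injective-++⁺ φ ψ-inj (λ y∈ → φ⊆ (Subset.x∈p∪q⁺ {p = ⁅ x ⁆} (inj₂ y∈))) φ-inj′)
    where
    x∉′ : x ∉ image (φ ++ ψ)
    x∉′ x∈ with Subset.x∈p∪q⁻ (image φ) (image ψ) (subst (x ∈_) (sym (image-++ φ ψ)) x∈)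
    ... | inj₁ x∈φ = x∉ x∈φ
    ... | inj₂ x∈ψ = Subset.x∈∁p⇒x∉p (φ⊆ (image-∈⁺ (x ∷ φ) zero)) x∈ψ

  private
    injective-∷ : (x : Fin n) (φ : Vec (Fin n) k) → IsInjective (x ∷ φ) ⇔ (x ∉ image φ × IsInjective φ)
    injective-∷ x φ = mk⇔ (injective-∷⁻ {x = x} {φ}) (λ (x∉ , inj) → injective-∷⁺ {x = x} {φ} x∉ inj)

    injective-++ : (φ : Vec (Fin n) k) (ψ : Vec (Fin n) m) → IsInjective ψ →
                   IsInjective (φ ++ ψ) ⇔ (image φ ⊆ ∁ (image ψ) × IsInjective φ)
    injective-++ φ ψ ψ-inj = mk⇔ (injective-++⁻ φ {ψ}) (λ (φ⊆ , inj) → injective-++⁺ φ {ψ} ψ-inj φ⊆ inj)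

    indicator-*-cong : ∀ {A : Set} (a? : Dec A) {x y : ℚ} → (A → x ≡ y) → ⟦ does a? ⟧ * x ≡ ⟦ does a? ⟧ * y
    indicator-*-cong (yes a) e = cong (1ℚ *_) (e a)
    indicator-*-cong (no _) {x} {y} e = trans (ℚ.*-zeroˡ x) (sym (ℚ.*-zeroˡ y))

  opaque

    distinct : Vec (Fin n) k → ℚ
    distinct φ = ⟦ does (isInjective? φ) ⟧

    distinct-def : (φ : Vec (Fin n) k) → distinct φ ≡ ⟦ does (isInjective? φ) ⟧
    distinct-def φ = refl

    distinct-yes : (φ : Vec (Fin n) k) → IsInjective φ → distinct φ ≡ 1ℚ
    distinct-yes φ inj = cong ⟦_⟧ (dec-true (isInjective? φ) inj)

    distinct-cases : (φ : Vec (Fin n) k) → IsInjective φ ⊎ distinct φ ≡ 0ℚ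
    distinct-cases φ with isInjective? φ
    ... | yes inj = inj₁ inj
    ... | no ¬inj = inj₂ (cong ⟦_⟧ (dec-false (isInjective? φ) ¬inj))

    0≤distinct : (φ : Vec (Fin n) k) → 0ℚ ≤ distinct φ
    0≤distinct φ = 0≤⟦⟧ (does (isInjective? φ))

    distinct≤1 : (φ : Vec (Fin n) k) → distinct φ ≤ 1ℚ
    distinct≤1 φ = ⟦⟧≤1 (does (isInjective? φ))

    -- A factor distinct φ makes equality of the other factor necessary only for injective φ.
    distinct-*-cong : (φ : Vec (Fin n) k) {a b : ℚ} → (IsInjective φ → a ≡ b) → distinct φ * a ≡ distinct φ * b
    distinct-*-cong φ e = indicator-*-cong (isInjective? φ) e

    distinct-∷ : (x : Fin n) (φ : Vec (Fin n) k) → distinct (x ∷ φ) ≡ ⟦ does (x ∉? image φ) ⟧ * distinct φ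
    distinct-∷ x φ = trans
      (cong ⟦_⟧ (does-⇔ (injective-∷ x φ) (isInjective? (x ∷ φ)) ((x ∉? image φ) ×-dec isInjective? φ)))
      (⟦∧⟧ (does (x ∉? image φ)) (does (isInjective? φ)))

    distinct-++ : (φ : Vec (Fin n) k) (ψ : Vec (Fin n) m) → IsInjective ψ →
                  distinct (φ ++ ψ) ≡ ⟦ does (image φ Subset.⊆? ∁ (image ψ)) ⟧ * distinct φ
    distinct-++ φ ψ ψ-inj = trans
      (cong ⟦_⟧ (does-⇔ (injective-++ φ ψ ψ-inj) (isInjective? (φ ++ ψ)) ((image φ Subset.⊆? ∁ (image ψ)) ×-dec isInjective? φ)))
      (⟦∧⟧ (does (image φ Subset.⊆? ∁ (image ψ))) (does (isInjective? φ)))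

  ∑-subsets : (f : Subset (suc n) → ℚ) →
              ∑ (subsets (suc n)) f ≡ ∑ (subsets n) (λ X → f (true ∷ X)) + ∑ (subsets n) (λ X → f (false ∷ X))
  ∑-subsets {n} f = trans (∑-vectors (true ∷ false ∷ []) {n} f)
    (cong (∑ (subsets n) (λ X → f (true ∷ X)) +_) (ℚ.+-identityʳ _))

  size-∪ : (v : Fin n) (X : Subset n) → v ∉ X → Subset.∣ ⁅ v ⁆ ∪ X ∣ ≡ suc Subset.∣ X ∣
  size-∪ zero    (true ∷ X)  v∉ = contradiction Vec.here v∉
  size-∪ zero    (false ∷ X) v∉ = cong (suc ∘ Subset.∣_∣) (Subset.∪-identityˡ X)
  size-∪ (suc v) (true ∷ X)  v∉ = cong suc (size-∪ v X (v∉ ∘ Vec.there))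
  size-∪ (suc v) (false ∷ X) v∉ = size-∪ v X (v∉ ∘ Vec.there)

  -- Both sides count pairs (v , Y) with v ∈ Y; on the left, X is Y without v.
  ∑-insert : (g : Subset n → ℚ) →
    ∑ (subsets n) (λ X → ∑ (allFin n) λ v → ⟦ does (v ∉? X) ⟧ * g (⁅ v ⁆ ∪ X)) ≡ ∑ (subsets n) (λ Y → ιℕ Subset.∣ Y ∣ * g Y)
  ∑-insert {zero}  g = cong (_+ 0ℚ) (sym (trans (cong (_* g []) ι-0) (ℚ.*-zeroˡ (g []))))
  ∑-insert {suc n} g = begin
    ∑ (subsets (suc n)) (λ X → ∑ (allFin (suc n)) λ v → h v X)
      ≡⟨ ∑-subsets (λ X → ∑ (allFin (suc n)) λ v → h v X) ⟩
    ∑ (subsets n) (λ X → ∑ (allFin (suc n)) λ v → h v (true ∷ X)) + ∑ (subsets n) (λ X → ∑ (allFin (suc n)) λ v → h v (false ∷ X))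
      ≡⟨ cong₂ _+_ (∑-cong (subsets n) on-true) (trans (∑-cong (subsets n) on-false) (∑-+ (subsets n) _ _)) ⟩
    a + (∑ (subsets n) (λ X → g (true ∷ X)) + b)
      ≡⟨ cong₂ _+_ (∑-insert (λ X → g (true ∷ X))) (cong (∑ (subsets n) (λ X → g (true ∷ X)) +_) (∑-insert (λ X → g (false ∷ X)))) ⟩
    c + (∑ (subsets n) (λ X → g (true ∷ X)) + d)
      ≡⟨ solve 3 (λ x y z → x :+ (y :+ z) := (y :+ x) :+ z) refl c (∑ (subsets n) (λ X → g (true ∷ X))) d ⟩
    (∑ (subsets n) (λ X → g (true ∷ X)) + c) + d
      ≡⟨ cong (_+ d) (sym (∑-+ (subsets n) _ _)) ⟩
    ∑ (subsets n) (λ X → g (true ∷ X) + ιℕ Subset.∣ X ∣ * g (true ∷ X)) + d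
      ≡⟨ cong (_+ d) (∑-cong (subsets n) λ X → trans
           (solve 2 (λ z l → z :+ l :* z := (con 1ℚ :+ l) :* z) refl (g (true ∷ X)) (ιℕ Subset.∣ X ∣))
           (cong (_* g (true ∷ X)) (sym (ιℕ-suc Subset.∣ X ∣)))) ⟩
    ∑ (subsets n) (λ X → ιℕ (suc Subset.∣ X ∣) * g (true ∷ X)) + d
      ≡⟨ ∑-subsets (λ Y → ιℕ Subset.∣ Y ∣ * g Y) ⟨
    ∑ (subsets (suc n)) (λ Y → ιℕ Subset.∣ Y ∣ * g Y) ∎
    where
    open ≡-Reasoning
    open +-*-Solver using (solve; con; _:=_; _:+_; _:*_; _:-_; :-_)
    h : Fin (suc n) → Subset (suc n) → ℚ
    h v X = ⟦ does (v ∉? X) ⟧ * g (⁅ v ⁆ ∪ X)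
    a = ∑ (subsets n) (λ X → ∑ (allFin n) λ v → ⟦ does (v ∉? X) ⟧ * g (true ∷ (⁅ v ⁆ ∪ X)))
    b = ∑ (subsets n) (λ X → ∑ (allFin n) λ v → ⟦ does (v ∉? X) ⟧ * g (false ∷ (⁅ v ⁆ ∪ X)))
    c = ∑ (subsets n) (λ X → ιℕ Subset.∣ X ∣ * g (true ∷ X))
    d = ∑ (subsets n) (λ X → ιℕ Subset.∣ X ∣ * g (false ∷ X))
    on-true : ∀ X → ∑ (allFin (suc n)) (λ v → h v (true ∷ X)) ≡ ∑ (allFin n) (λ v → ⟦ does (v ∉? X) ⟧ * g (true ∷ (⁅ v ⁆ ∪ X)))
    on-true X = trans (∑-allFin (λ v → h v (true ∷ X))) (trans (cong (_+ e) (ℚ.*-zeroˡ (g (true ∷ (⊥ ∪ X))))) (ℚ.+-identityˡ e))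
      where e = ∑ (allFin n) (λ v → ⟦ does (v ∉? X) ⟧ * g (true ∷ (⁅ v ⁆ ∪ X)))
    on-false : ∀ X → ∑ (allFin (suc n)) (λ v → h v (false ∷ X)) ≡ g (true ∷ X) + ∑ (allFin n) (λ v → ⟦ does (v ∉? X) ⟧ * g (false ∷ (⁅ v ⁆ ∪ X)))
    on-false X = trans (∑-allFin (λ v → h v (false ∷ X)))
      (cong (_+ ∑ (allFin n) (λ v → ⟦ does (v ∉? X) ⟧ * g (false ∷ (⁅ v ⁆ ∪ X)))) (trans (ℚ.*-identityˡ (g (true ∷ (⊥ ∪ X)))) (cong (λ Z → g (true ∷ Z)) (Subset.∪-identityˡ X))))

  ∑-sized : ℕ → (Subset n → ℚ) → ℚ
  ∑-sized {n} k g = ∑ (subsets n) λ X → ⟦ does (Subset.∣ X ∣ ℕ.≟ k) ⟧ * g X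

  ∑-sized-0 : (g : Subset n → ℚ) → ∑-sized 0 g ≡ g ⊥
  ∑-sized-0 {zero}  g = trans (ℚ.+-identityʳ _) (ℚ.*-identityˡ _)
  ∑-sized-0 {suc n} g = trans (∑-subsets (λ X → ⟦ does (Subset.∣ X ∣ ℕ.≟ 0) ⟧ * g X))
    (trans (cong₂ _+_ (trans (∑-cong (subsets n) (λ X → ℚ.*-zeroˡ (g (true ∷ X)))) (∑-0 (subsets n))) (∑-sized-0 (λ X → g (false ∷ X))))
           (ℚ.+-identityˡ _))

  -- Each k-set of vertices is the image of k! injective k-tuples.
  ∑-tuples : ∀ k (g : Subset n → ℚ) →
    ιℕ (k !) * ∑-sized k g ≡ ∑ (vectors (allFin n) k) λ t → distinct t * g (image t)
  ∑-tuples zero g = trans (trans (cong₂ _*_ ι-1 (∑-sized-0 g)) (ℚ.*-identityˡ (g ⊥)))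
    (sym (trans (ℚ.+-identityʳ _) (trans (cong (_* g ⊥) (distinct-yes [] λ { {()} })) (ℚ.*-identityˡ (g ⊥)))))
  ∑-tuples {n} (suc k) g = begin
    ιℕ (suc k !) * ∑-sized (suc k) g
      ≡⟨ cong (_* ∑-sized (suc k) g) (ιℕ-* (suc k) (k !)) ⟩
    (ιℕ (suc k) * ιℕ (k !)) * ∑-sized (suc k) g
      ≡⟨ solve 3 (λ a b c → (a :* b) :* c := b :* (a :* c)) refl (ιℕ (suc k)) (ιℕ (k !)) (∑-sized (suc k) g) ⟩
    ιℕ (k !) * (ιℕ (suc k) * ∑-sized (suc k) g)
      ≡⟨ cong (ιℕ (k !) *_) (∑-*ˡ (subsets n) (ιℕ (suc k)) _) ⟨
    ιℕ (k !) * ∑ (subsets n) (λ Y → ιℕ (suc k) * g′ Y)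
      ≡⟨ cong (ιℕ (k !) *_) (∑-cong (subsets n) size) ⟨
    ιℕ (k !) * ∑ (subsets n) (λ Y → ιℕ Subset.∣ Y ∣ * g′ Y)
      ≡⟨ cong (ιℕ (k !) *_) (∑-insert g′) ⟨
    ιℕ (k !) * ∑ (subsets n) (λ X → ∑ (allFin n) λ v → ⟦ does (v ∉? X) ⟧ * g′ (⁅ v ⁆ ∪ X))
      ≡⟨ cong (ιℕ (k !) *_) (∑-cong (subsets n) λ X → trans (∑-cong (allFin n) (shrink X)) (∑-*ˡ (allFin n) ⟦ does (Subset.∣ X ∣ ℕ.≟ k) ⟧ _)) ⟩
    ιℕ (k !) * ∑-sized k h
      ≡⟨ ∑-tuples k h ⟩
    ∑ (vectors (allFin n) k) (λ t → distinct t * h (image t))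
      ≡⟨ ∑-cong (vectors (allFin n) k) (λ t → trans (sym (∑-*ˡ (allFin n) (distinct t) _)) (∑-cong (allFin n) (grow t))) ⟩
    ∑ (vectors (allFin n) k) (λ t → ∑ (allFin n) λ v → distinct (v ∷ t) * g (image (v ∷ t)))
      ≡⟨ ∑-swap (vectors (allFin n) k) (allFin n) _ ⟩
    ∑ (allFin n) (λ v → ∑ (vectors (allFin n) k) λ t → distinct (v ∷ t) * g (image (v ∷ t)))
      ≡⟨ ∑-vectors (allFin n) {k} _ ⟨
    ∑ (vectors (allFin n) (suc k)) (λ t → distinct t * g (image t)) ∎
    where
    open ≡-Reasoning
    open +-*-Solver using (solve; con; _:=_; _:+_; _:*_; _:-_; :-_)
    g′ : Subset n → ℚ
    g′ Y = ⟦ does (Subset.∣ Y ∣ ℕ.≟ suc k) ⟧ * g Y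
    h : Subset n → ℚ
    h X = ∑ (allFin n) λ v → ⟦ does (v ∉? X) ⟧ * g (⁅ v ⁆ ∪ X)
    size : ∀ Y → ιℕ Subset.∣ Y ∣ * g′ Y ≡ ιℕ (suc k) * g′ Y
    size Y = trans (swap (ιℕ Subset.∣ Y ∣) i (g Y)) (trans
      (indicator-*-cong (Subset.∣ Y ∣ ℕ.≟ suc k) (λ e → cong (λ m → ιℕ m * g Y) e))
      (sym (swap (ιℕ (suc k)) i (g Y))))
      where
      i = ⟦ does (Subset.∣ Y ∣ ℕ.≟ suc k) ⟧
      swap = solve 3 (λ a b c → a :* (b :* c) := b :* (a :* c)) refl
    shrink : ∀ X v → ⟦ does (v ∉? X) ⟧ * g′ (⁅ v ⁆ ∪ X) ≡ ⟦ does (Subset.∣ X ∣ ℕ.≟ k) ⟧ * (⟦ does (v ∉? X) ⟧ * g (⁅ v ⁆ ∪ X))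
    shrink X v = trans
      (indicator-*-cong (v ∉? X) (λ v∉ → cong (λ m → ⟦ does (m ℕ.≟ suc k) ⟧ * g (⁅ v ⁆ ∪ X)) (size-∪ v X v∉)))
      (solve 3 (λ a b c → a :* (b :* c) := b :* (a :* c)) refl ⟦ does (v ∉? X) ⟧ ⟦ does (Subset.∣ X ∣ ℕ.≟ k) ⟧ (g (⁅ v ⁆ ∪ X)))
    grow : ∀ t v → distinct t * (⟦ does (v ∉? image t) ⟧ * g (⁅ v ⁆ ∪ image t)) ≡ distinct (v ∷ t) * g (image (v ∷ t))
    grow t v = trans (solve 3 (λ a b c → a :* (b :* c) := (b :* a) :* c) refl (distinct t) ⟦ does (v ∉? image t) ⟧ (g (⁅ v ⁆ ∪ image t)))
                     (cong (_* g (⁅ v ⁆ ∪ image t)) (sym (distinct-∷ v t)))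

  ∑-sized-1 : ∀ k → ∑-sized {n} k (λ _ → 1ℚ) ≡ ιℕ (n C k)
  ∑-sized-1 {n}     zero    = trans (∑-sized-0 {n} (λ _ → 1ℚ)) (sym ι-1)
  ∑-sized-1 {zero}  (suc k) = sym ι-0
  ∑-sized-1 {suc n} (suc k) = begin
    ∑-sized {suc n} (suc k) (λ _ → 1ℚ)
      ≡⟨ ∑-subsets {n} (λ X → ⟦ does (Subset.∣ X ∣ ℕ.≟ suc k) ⟧ * 1ℚ) ⟩
    ∑ (subsets n) (λ X → ⟦ does (suc Subset.∣ X ∣ ℕ.≟ suc k) ⟧ * 1ℚ) + ∑-sized {n} (suc k) (λ _ → 1ℚ)
      ≡⟨⟩
    ∑-sized {n} k (λ _ → 1ℚ) + ∑-sized {n} (suc k) (λ _ → 1ℚ)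
      ≡⟨ cong₂ _+_ (∑-sized-1 {n} k) (∑-sized-1 {n} (suc k)) ⟩
    ιℕ (n C k) + ιℕ (n C suc k)
      ≡⟨ ιℕ-+ (n C k) (n C suc k) ⟨
    ιℕ (n C k ℕ.+ n C suc k)
      ≡⟨ cong ιℕ (nCk+nC[k+1]≡[n+1]C[k+1] n k) ⟩
    ιℕ (suc n C suc k) ∎
    where open ≡-Reasoning

  ∑-distinct : ∀ k → ∑ (vectors (allFin n) k) distinct ≡ ιℕ (k !) * ιℕ (n C k)
  ∑-distinct {n} k = sym (trans (cong (ιℕ (k !) *_) (sym (∑-sized-1 {n} k)))
    (trans (∑-tuples {n} k (λ _ → 1ℚ)) (∑-cong (vectors (allFin n) k) λ t → ℚ.*-identityʳ (distinct t))))

  -- Ordering the unlabelled vertices replaces subsets by tuples placed in front of the roots.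
  -- Injectivity of the joined tuple says at once that the set has `s - q` elements and that it
  -- avoids the roots.
  P-tuples : ∀ {τ : Graph q} (F : Flag τ s) (K : Flag τ n) →
    ιℕ ((s ℕ.∸ q) !) * ιℕ (P F K) ≡
    ∑ (vectors (allFin n) (s ℕ.∸ q)) λ t → distinct (t ++ roots K) * ⟦ does (F ≅ K [ image (t ++ roots K) ]?) ⟧
  P-tuples {q} {s} {n} F K = begin
    ιℕ (r !) * ιℕ (P F K)
      ≡⟨ cong (ιℕ (r !) *_) (trans (length-filter _ (subsets n)) (∑-cong (subsets n) λ X → reorder (does (X Subset.⊆? ∁ R)) (does (Subset.∣ X ∣ ℕ.≟ r)) _)) ⟩
    ιℕ (r !) * ∑-sized r g
      ≡⟨ ∑-tuples r g ⟩
    ∑ (vectors (allFin n) r) (λ t → distinct t * g (image t))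
      ≡⟨ ∑-cong (vectors (allFin n) r) (λ t → join t) ⟩
    ∑ (vectors (allFin n) r) (λ t → distinct (t ++ roots K) * ⟦ does (F ≅ K [ image (t ++ roots K) ]?) ⟧) ∎
    where
    open ≡-Reasoning
    open +-*-Solver using (solve; con; _:=_; _:+_; _:*_; _:-_; :-_)
    r = s ℕ.∸ q
    R = image (roots K)
    g : Subset n → ℚ
    g X = ⟦ does (X Subset.⊆? ∁ R) ⟧ * ⟦ does (F ≅ K [ X ∪ R ]?) ⟧
    reorder : ∀ a b c → ⟦ a ∧ b ∧ c ⟧ ≡ ⟦ b ⟧ * (⟦ a ⟧ * ⟦ c ⟧)
    reorder a b c = trans (⟦∧⟧ a (b ∧ c)) (trans (cong (⟦ a ⟧ *_) (⟦∧⟧ b c))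
      (solve 3 (λ a b c → a :* (b :* c) := b :* (a :* c)) refl ⟦ a ⟧ ⟦ b ⟧ ⟦ c ⟧))
    join : ∀ t → distinct t * g (image t) ≡ distinct (t ++ roots K) * ⟦ does (F ≅ K [ image (t ++ roots K) ]?) ⟧
    join t = trans (solve 3 (λ d a c → d :* (a :* c) := (a :* d) :* c) refl (distinct t) ⟦ does (image t Subset.⊆? ∁ R) ⟧ _)
      (cong₂ _*_ (sym (distinct-++ t (roots K) (proj₁ (isEmbedding K))))
                 (cong (λ S → ⟦ does (F ≅ K [ S ]?) ⟧) (image-++ t (roots K))))

  -- The number `k (k + 1) / 2` of pairs of positions among `k + 1` entries.
  triangle : ℕ → ℕ
  triangle zero    = 0
  triangle (suc k) = triangle k ℕ.+ suc k

  0≤1-distinct : (t : Vec (Fin n) k) → 0ℚ ≤ 1ℚ - distinct t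
  0≤1-distinct t = ℚ.≤-trans (ℚ.≤-reflexive (sym (ℚ.+-inverseʳ (distinct t)))) (ℚ.+-monoˡ-≤ (- distinct t) (distinct≤1 t))

  ∑-image : (t : Vec (Fin n) k) → ∑ (allFin n) (λ v → ⟦ does (v ∈? image t) ⟧) ≤ ιℕ k
  ∑-image {n} [] = ℚ.≤-reflexive (trans (trans (∑-cong (allFin n) λ v → cong ⟦_⟧ (dec-false (v ∈? ⊥) Subset.∉⊥)) (∑-0 (allFin n))) (sym ι-0))
  ∑-image {n} {suc k} (x ∷ t) = begin
    ∑ (allFin n) (λ v → ⟦ does (v ∈? image (x ∷ t)) ⟧)
      ≤⟨ ∑-mono (allFin n) either ⟩
    ∑ (allFin n) (λ v → ⟦ does (x Fin.≟ v) ⟧ * 1ℚ + ⟦ does (v ∈? image t) ⟧)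
      ≡⟨ trans (∑-+ (allFin n) _ _) (cong (_+ _) (∑-indicator x (λ _ → 1ℚ))) ⟩
    1ℚ + ∑ (allFin n) (λ v → ⟦ does (v ∈? image t) ⟧)
      ≤⟨ ℚ.+-monoʳ-≤ 1ℚ (∑-image t) ⟩
    1ℚ + ιℕ k
      ≡⟨ ιℕ-suc k ⟨
    ιℕ (suc k) ∎
    where
    open ℚ.≤-Reasoning
    either : ∀ v → ⟦ does (v ∈? image (x ∷ t)) ⟧ ≤ ⟦ does (x Fin.≟ v) ⟧ * 1ℚ + ⟦ does (v ∈? image t) ⟧
    either v with x Fin.≟ v
    ... | yes _ = ℚ.≤-trans (⟦⟧≤1 (does (v ∈? image (x ∷ t)))) (ℚ.≤-trans (ℚ.≤-reflexive (sym (ℚ.+-identityʳ 1ℚ))) (ℚ.+-monoʳ-≤ 1ℚ (0≤⟦⟧ (does (v ∈? image t)))))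
    ... | no x≢v = ℚ.≤-reflexive (trans (cong ⟦_⟧ (does-⇔ (mk⇔ to (λ p → Subset.x∈p∪q⁺ {p = ⁅ x ⁆} (inj₂ p))) (v ∈? image (x ∷ t)) (v ∈? image t)))
                                        (sym (ℚ.+-identityˡ _)))
      where
      to : v ∈ image (x ∷ t) → v ∈ image t
      to p with Subset.x∈p∪q⁻ ⁅ x ⁆ (image t) p
      ... | inj₁ v∈x = contradiction (sym (Subset.x∈⁅y⁆⇒x≡y x v∈x)) x≢v
      ... | inj₂ v∈t = v∈t

  ∑-1 : ∀ k → ∑ (vectors (allFin n) k) (λ _ → 1ℚ) ≡ ιℕ (n ℕ.^ k)
  ∑-1 {n} k = trans (∑-vectors-1 (allFin n) k) (cong (λ m → ιℕ (m ℕ.^ k)) (List.length-tabulate {n = n} (λ i → i)))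

  -- In the induction step, either `t` already has a repetition and all `n` new entries count, or
  -- the new entry is one of the at most `k + 1` entries of `t`. For 5-tuples this gives `10 n⁴`,
  -- the source of the error term of the certificate.
  ∑-repeated : ∀ k → ∑ (vectors (allFin n) (suc k)) (λ t → 1ℚ - distinct t) ≤ ιℕ (triangle k ℕ.* n ℕ.^ k)
  ∑-repeated {n} zero = ℚ.≤-trans (ℚ.≤-reflexive (trans (trans (∑-vectors (allFin n) {0} _)
      (∑-cong (allFin n) λ v → trans (ℚ.+-identityʳ _) (cong (λ d → 1ℚ - d) (distinct-yes (v ∷ []) λ { {zero} {zero} _ → refl })))) (∑-0 (allFin n))))
    (0≤ιℕ 0)
  ∑-repeated {n} (suc k) = begin
    ∑ (vectors (allFin n) (suc (suc k))) (λ t → 1ℚ - distinct t)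
      ≡⟨ trans (∑-vectors (allFin n) {suc k} _) (∑-swap (allFin n) (vectors (allFin n) (suc k)) _) ⟩
    ∑ (vectors (allFin n) (suc k)) (λ t → ∑ (allFin n) λ v → 1ℚ - distinct (v ∷ t))
      ≤⟨ ∑-mono (vectors (allFin n) (suc k)) step ⟩
    ∑ (vectors (allFin n) (suc k)) (λ t → ιℕ n * (1ℚ - distinct t) + ιℕ (suc k) * 1ℚ)
      ≡⟨ trans (∑-+ (vectors (allFin n) (suc k)) _ _) (cong₂ _+_ (∑-*ˡ (vectors (allFin n) (suc k)) (ιℕ n) _)
          (trans (∑-*ˡ (vectors (allFin n) (suc k)) (ιℕ (suc k)) _) (cong (ιℕ (suc k) *_) (∑-1 {n} (suc k))))) ⟩
    ιℕ n * ∑ (vectors (allFin n) (suc k)) (λ t → 1ℚ - distinct t) + ιℕ (suc k) * ιℕ (n ℕ.^ suc k)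
      ≤⟨ ℚ.+-monoˡ-≤ _ (*-monoˡ (ιℕ n) (0≤ιℕ n) (∑-repeated {n} k)) ⟩
    ιℕ n * ιℕ (triangle k ℕ.* n ℕ.^ k) + ιℕ (suc k) * ιℕ (n ℕ.^ suc k)
      ≡⟨ cong₂ _+_ (sym (ιℕ-* n _)) (sym (ιℕ-* (suc k) _)) ⟩
    ιℕ (n ℕ.* (triangle k ℕ.* n ℕ.^ k)) + ιℕ (suc k ℕ.* n ℕ.^ suc k)
      ≡⟨ ιℕ-+ (n ℕ.* (triangle k ℕ.* n ℕ.^ k)) (suc k ℕ.* n ℕ.^ suc k) ⟨
    ιℕ (n ℕ.* (triangle k ℕ.* n ℕ.^ k) ℕ.+ suc k ℕ.* n ℕ.^ suc k)
      ≡⟨ cong ιℕ (N.solve 4 (λ n t k p → n N.:* (t N.:* p) N.:+ k N.:* (n N.:* p) N.:= (t N.:+ k) N.:* (n N.:* p)) refl n (triangle k) (suc k) (n ℕ.^ k)) ⟩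
    ιℕ (triangle (suc k) ℕ.* n ℕ.^ suc k) ∎
    where
    open ℚ.≤-Reasoning
    import Data.Nat.Solver
    module N = Data.Nat.Solver.+-*-Solver
    step : ∀ t → ∑ (allFin n) (λ v → 1ℚ - distinct (v ∷ t)) ≤ ιℕ n * (1ℚ - distinct t) + ιℕ (suc k) * 1ℚ
    step t = begin
      ∑ (allFin n) (λ v → 1ℚ - distinct (v ∷ t))
        ≤⟨ ∑-mono (allFin n) split ⟩
      ∑ (allFin n) (λ v → (1ℚ - distinct t) + ⟦ does (v ∈? image t) ⟧)
        ≡⟨ trans (∑-+ (allFin n) _ _) (cong (_+ ∑ (allFin n) (λ v → ⟦ does (v ∈? image t) ⟧)) (trans (∑-const (allFin n) _) (cong (λ m → ιℕ m * (1ℚ - distinct t)) (List.length-tabulate {n = n} (λ i → i))))) ⟩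
      ιℕ n * (1ℚ - distinct t) + ∑ (allFin n) (λ v → ⟦ does (v ∈? image t) ⟧)
        ≤⟨ ℚ.+-monoʳ-≤ (ιℕ n * (1ℚ - distinct t)) (∑-image t) ⟩
      ιℕ n * (1ℚ - distinct t) + ιℕ (suc k)
        ≡⟨ cong (ιℕ n * (1ℚ - distinct t) +_) (ℚ.*-identityʳ (ιℕ (suc k))) ⟨
      ιℕ n * (1ℚ - distinct t) + ιℕ (suc k) * 1ℚ ∎
      where
      split : ∀ v → 1ℚ - distinct (v ∷ t) ≤ (1ℚ - distinct t) + ⟦ does (v ∈? image t) ⟧
      split v rewrite distinct-∷ v t with v ∈? image t
      ... | yes _ = ℚ.≤-trans (ℚ.≤-reflexive (trans (cong (λ z → 1ℚ - z) (ℚ.*-zeroˡ (distinct t))) (sym (ℚ.+-identityˡ 1ℚ)))) (ℚ.+-monoˡ-≤ 1ℚ (0≤1-distinct t))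
      ... | no _  = ℚ.≤-reflexive (trans (cong (λ z → 1ℚ - z) (ℚ.*-identityˡ (distinct t))) (sym (ℚ.+-identityʳ _)))

-- Isomorphism of flags, and sums over isomorphism classes.

module Isomorphism where

  open import Data.Fin as Fin using (Fin; zero; suc)
  open import Data.Fin.Subset as Subset using (Subset; _∈_; ⊤)
  open import Data.Fin.Subset.Properties as Subset
  open import Data.List using (allFin)
  open import Data.Nat as ℕ using (ℕ; _!)
  open import Data.Product using (∃; _×_; _,_; proj₁; proj₂)
  open import Data.Rational using (ℚ; _*_)
  open import Data.Rational.Solver using (module +-*-Solver)
  open import Data.Vec as Vec using (Vec; lookup; _++_)
  import Data.Vec.Properties as Vec
  open import Function using (_∘_; mk⇔)
  open import Relation.Binary.PropositionalEquality hiding ([_])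
  open import Relation.Nullary using (does)
  open import Relation.Nullary.Decidable using (does-⇔)
  open import Defs using (vectors; image; IsInjective; Graph; Flag; P; _≅_; _≅_[_]; _≅_[_]?; Representatives)
  open Graph using (adj)
  open Flag using (underlying; roots; isEmbedding)
  open Representatives using (size; rep)
  open Sums
  open Tuples

  private variable
    k n m q s s′ : ℕ
    τ : Graph q

  lookup-extensional : {A : Set} {v w : Vec A k} → (∀ i → lookup v i ≡ lookup w i) → v ≡ w
  lookup-extensional {v = v} {w} e = trans (sym (Vec.tabulate∘lookup v)) (trans (Vec.tabulate-cong e) (Vec.tabulate∘lookup w))

  image-surjective : (φ : Vec (Fin n) k) → (∀ x → ∃ λ i → lookup φ i ≡ x) → image φ ≡ ⊤
  image-surjective φ sur = Subset.⊆-antisym Subset.⊆⊤ λ {x} _ → let (i , e) = sur x in subst (_∈ image φ) e (image-∈⁺ φ i)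

  ≅-refl : (K : Flag τ n) → K ≅ K
  ≅-refl K = Vec.allFin _ ,
    ( (λ {i} {j} e → trans (sym (Vec.lookup-allFin i)) (trans e (Vec.lookup-allFin j)))
    , (λ i j → cong₂ (adj (underlying K)) (Vec.lookup-allFin i) (Vec.lookup-allFin j)) )
    , image-surjective (Vec.allFin _) (λ x → x , Vec.lookup-allFin x)
    , trans (Vec.map-cong Vec.lookup-allFin (roots K)) (Vec.map-id (roots K))

  ≅-trans : (H H′ : Flag τ s) (K : Flag τ n) {S : Subset n} → H ≅ H′ → H′ ≅ K [ S ] → H ≅ K [ S ]
  ≅-trans H H′ K (ψ , (ψ-inj , ψ-adj) , ψ-image , ψ-roots) (φ , (φ-inj , φ-adj) , φ-image , φ-roots) =
    Vec.map (lookup φ) ψ ,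
    ( (λ {i} {j} e → ψ-inj (φ-inj (trans (sym (at i)) (trans e (at j)))))
    , (λ i j → trans (cong₂ (adj (underlying K)) (at i) (at j)) (trans (φ-adj _ _) (ψ-adj i j))) )
    , trans same-image φ-image
    , trans (Vec.map-cong at (roots H)) (trans (Vec.map-∘ (lookup φ) (lookup ψ) (roots H)) (trans (cong (Vec.map (lookup φ)) ψ-roots) φ-roots))
    where
    at : ∀ i → lookup (Vec.map (lookup φ) ψ) i ≡ lookup φ (lookup ψ i)
    at i = Vec.lookup-map i (lookup φ) ψ
    same-image : image (Vec.map (lookup φ) ψ) ≡ image φ
    same-image = Subset.⊆-antisym
      (λ x∈ → let (i , e) = image-∈⁻ (Vec.map (lookup φ) ψ) x∈ in subst (_∈ image φ) (trans (sym (at i)) e) (image-∈⁺ φ (lookup ψ i)))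
      (λ x∈ → let (j , e) = image-∈⁻ φ x∈
                  (i , d) = image-∈⁻ ψ (subst (j ∈_) (sym ψ-image) Subset.∈⊤)
              in subst (_∈ image (Vec.map (lookup φ) ψ)) (trans (at i) (trans (cong (lookup φ) d) e)) (image-∈⁺ (Vec.map (lookup φ) ψ) i))

  -- The two embeddings have the same image, so the first can be followed by the inverse of the
  -- second, found by looking up preimages in `S`. Symmetry of `≅` is the case in which one of the
  -- embeddings is the identity of `K`.
  ≅-join : (H H′ : Flag τ s) (K : Flag τ n) {S : Subset n} → H ≅ K [ S ] → H′ ≅ K [ S ] → H ≅ H′
  ≅-join {s = s} H H′ K (φ , (φ-inj , φ-adj) , φ-image , φ-roots) (φ′ , (φ′-inj , φ′-adj) , φ′-image , φ′-roots) =
    ψ ,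
    ( (λ {i} {j} e → φ-inj (trans (sym (at i)) (trans (cong (lookup φ′) e) (at j))))
    , (λ i j → trans (sym (φ′-adj _ _)) (trans (cong₂ (adj (underlying K)) (at i) (at j)) (φ-adj i j))) )
    , image-surjective ψ (λ j → let (i , e) = image-∈⁻ φ (subst (lookup φ′ j ∈_) (trans φ′-image (sym φ-image)) (image-∈⁺ φ′ j))
                                in i , φ′-inj (trans (at i) e))
    , lookup-extensional (λ r → φ′-inj (trans (cong (lookup φ′) (Vec.lookup-map r (lookup ψ) (roots H)))
        (trans (at _) (trans (sym (Vec.lookup-map r (lookup φ) (roots H)))
          (trans (cong (λ v → lookup v r) (trans φ-roots (sym φ′-roots))) (Vec.lookup-map r (lookup φ′) (roots H′)))))))
    where
    preimage : ∀ i → ∃ λ j → lookup φ′ j ≡ lookup φ i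
    preimage i = image-∈⁻ φ′ (subst (lookup φ i ∈_) (trans φ-image (sym φ′-image)) (image-∈⁺ φ i))
    ψ : Vec (Fin s) s
    ψ = Vec.tabulate (proj₁ ∘ preimage)
    at : ∀ i → lookup φ′ (lookup ψ i) ≡ lookup φ i
    at i = trans (cong (lookup φ′) (Vec.lookup∘tabulate (proj₁ ∘ preimage) i)) (proj₂ (preimage i))

  ≅-sym : (H K : Flag τ s) → H ≅ K → K ≅ H
  ≅-sym H K iso = ≅-join K H K (≅-refl K) iso

  module _ {τ : Graph q} (R : Representatives τ s) (K : Flag τ n) where

    -- By `≅-join` two representatives that match the same induced subflag are isomorphic, hence
    -- equal, so a single term survives.
    class-sum : ∀ {S} i (w : Fin (size R) → ℚ) → rep R i ≅ K [ S ] →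
                ∑ (allFin (size R)) (λ j → ⟦ does (rep R j ≅ K [ S ]?) ⟧ * w j) ≡ w i
    class-sum {S} i w iso = trans
      (∑-cong (allFin (size R)) λ j → cong (λ b → ⟦ b ⟧ * w j)
        (does-⇔ (mk⇔ (λ iso′ → Representatives.distinct R i j (≅-join (rep R i) (rep R j) K iso iso′)) (λ { refl → iso })) (rep R j ≅ K [ S ]?) (i Fin.≟ j)))
      (∑-indicator i w)

    -- The bridge from flag counts to sums over tuples. It needs only some matching representative
    -- for each injective tuple, so the list of representatives itself is never enumerated.
    ∑-classes : (w : Fin (size R) → ℚ) (c : Vec (Fin n) (s ℕ.∸ q) → ℚ) →
      (∀ t → IsInjective (t ++ roots K) → ∃ λ i → rep R i ≅ K [ image (t ++ roots K) ] × w i ≡ c t) →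
      ιℕ ((s ℕ.∸ q) !) * ∑ (allFin (size R)) (λ i → w i * ιℕ (P (rep R i) K)) ≡
      ∑ (vectors (allFin n) (s ℕ.∸ q)) λ t → distinct (t ++ roots K) * c t
    ∑-classes w c classify = begin
      f * ∑ (allFin (size R)) (λ i → w i * ιℕ (P (rep R i) K))
        ≡⟨ ∑-*ˡ (allFin (size R)) f _ ⟨
      ∑ (allFin (size R)) (λ i → f * (w i * ιℕ (P (rep R i) K)))
        ≡⟨ ∑-cong (allFin (size R)) (λ i → trans (swap f (w i) (ιℕ (P (rep R i) K)))
             (trans (cong (w i *_) (P-tuples (rep R i) K)) (sym (∑-*ˡ T (w i) _)))) ⟩
      ∑ (allFin (size R)) (λ i → ∑ T λ t → w i * (distinct (t ++ roots K) * b i t))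
        ≡⟨ ∑-swap (allFin (size R)) T _ ⟩
      ∑ T (λ t → ∑ (allFin (size R)) λ i → w i * (distinct (t ++ roots K) * b i t))
        ≡⟨ ∑-cong T (λ t → trans (∑-cong (allFin (size R)) λ i → rotate (w i) (distinct (t ++ roots K)) (b i t))
             (∑-*ˡ (allFin (size R)) (distinct (t ++ roots K)) _)) ⟩
      ∑ T (λ t → distinct (t ++ roots K) * ∑ (allFin (size R)) λ i → b i t * w i)
        ≡⟨ ∑-cong T (λ t → distinct-*-cong (t ++ roots K) λ inj →
             let (i , iso , e) = classify t inj in trans (class-sum i w iso) e) ⟩
      ∑ T (λ t → distinct (t ++ roots K) * c t) ∎
      where
      open ≡-Reasoning
      open +-*-Solver using (solve; _:=_; _:*_)
      f = ιℕ ((s ℕ.∸ q) !)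
      T = vectors (allFin n) (s ℕ.∸ q)
      b : Fin (size R) → Vec (Fin n) (s ℕ.∸ q) → ℚ
      b i t = ⟦ does (rep R i ≅ K [ image (t ++ roots K) ]?) ⟧
      swap : ∀ a b c → a * (b * c) ≡ b * (a * c)
      swap = solve 3 (λ a b c → a :* (b :* c) := b :* (a :* c)) refl
      rotate : ∀ a b c → a * (b * c) ≡ b * (c * a)
      rotate = solve 3 (λ a b c → a :* (b :* c) := b :* (c :* a)) refl

-- Functions of the ten adjacencies of a 5-tuple, and the data of the certificate.

module Tables where

  open import Data.Bool using (Bool; true; false; _∧_; _∨_; not; if_then_else_)
  open import Data.Fin as Fin using (Fin; zero; suc; #_)
  open import Data.Integer as ℤ using (ℤ; +_)
  open import Data.List using (List; []; _∷_)
  open import Data.Nat as ℕ using (ℕ; zero; suc)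
  open import Data.Product using (_×_; _,_; ∃; proj₁; proj₂)
  open import Data.Vec using (Vec; []; _∷_; lookup)
  open import Function using (_∘_)
  open import Relation.Binary.PropositionalEquality
  open import Relation.Nullary using (does; yes; no; contradiction)
  import Data.Bool.Properties as Bool
  open import Data.Maybe as Maybe using (Maybe; just; nothing; maybe′)
  import Data.Maybe.Properties as Maybe
  open import Relation.Nullary.Decidable using (from-yes)
  import Data.Fin.Properties as Fin
  open import Defs using (IsInjective; image)
  open import Data.Fin.Subset using (_∈_; _∉_; ⁅_⁆)
  import Data.Fin.Subset.Properties as Subset
  open import Data.Sum using (inj₁; inj₂)
  open Tuples

  private variable
    k n : ℕ
    A : Set

  -- A binary tree of values, so that evaluation shares the entries of a table.
  data Table (A : Set) : ℕ → Set where
    leaf : A → Table A zero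
    node : Table A k → Table A k → Table A (suc k)

  tabulate : (Vec Bool k → A) → Table A k
  tabulate {zero}  f = leaf (f [])
  tabulate {suc k} f = node (tabulate (f ∘ (true ∷_))) (tabulate (f ∘ (false ∷_)))

  _!_ : Table A k → Vec Bool k → A
  leaf x   ! []          = x
  node t _ ! (true ∷ b)  = t ! b
  node _ t ! (false ∷ b) = t ! b

  !-tabulate : (f : Vec Bool k → A) → ∀ b → tabulate f ! b ≡ f b
  !-tabulate f []          = refl
  !-tabulate f (true ∷ b)  = !-tabulate (f ∘ (true ∷_)) b
  !-tabulate f (false ∷ b) = !-tabulate (f ∘ (false ∷_)) b

  zipTable : (A → A → A) → Table A k → Table A k → Table A k
  zipTable f (leaf x)    (leaf y)    = leaf (f x y)
  zipTable f (node s s′) (node t t′) = node (zipTable f s t) (zipTable f s′ t′)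

  !-zipTable : ∀ f (s t : Table A k) b → zipTable f s t ! b ≡ f (s ! b) (t ! b)
  !-zipTable f (leaf x)    (leaf y)    []          = refl
  !-zipTable f (node s s′) (node t t′) (true ∷ b)  = !-zipTable f s t b
  !-zipTable f (node s s′) (node t t′) (false ∷ b) = !-zipTable f s′ t′ b

  -- The adjacencies of five vertices, for the pairs 01, 02, 03, 04, 12, 13, 14, 23, 24, 34.

  bits : (A → A → Bool) → Vec A 5 → Vec Bool 10
  bits a (u ∷ v ∷ w ∷ x ∷ y ∷ []) =
    a u v ∷ a u w ∷ a u x ∷ a u y ∷ a v w ∷ a v x ∷ a v y ∷ a w x ∷ a w y ∷ a x y ∷ []

  position : Vec (Vec (Maybe (Fin 10)) 5) 5
  position =
      (nothing ∷ just (# 0) ∷ just (# 1) ∷ just (# 2) ∷ just (# 3) ∷ [])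
    ∷ (just (# 0) ∷ nothing ∷ just (# 4) ∷ just (# 5) ∷ just (# 6) ∷ [])
    ∷ (just (# 1) ∷ just (# 4) ∷ nothing ∷ just (# 7) ∷ just (# 8) ∷ [])
    ∷ (just (# 2) ∷ just (# 5) ∷ just (# 7) ∷ nothing ∷ just (# 9) ∷ [])
    ∷ (just (# 3) ∷ just (# 6) ∷ just (# 8) ∷ just (# 9) ∷ nothing ∷ [])
    ∷ []

  fromBits : Vec Bool 10 → Fin 5 → Fin 5 → Bool
  fromBits b u v = maybe′ (lookup b) false (lookup (lookup position u) v)

  fromBits-sym : ∀ b u v → fromBits b u v ≡ fromBits b v u
  fromBits-sym b u v = cong (maybe′ (lookup b) false) (position-sym u v)
    where
    position-sym : ∀ u v → lookup (lookup position u) v ≡ lookup (lookup position v) u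
    position-sym = from-yes (Fin.all? λ u → Fin.all? λ v → Maybe.≡-dec Fin._≟_ (lookup (lookup position u) v) (lookup (lookup position v) u))

  act : Vec (Fin 5) 5 → Vec Bool 10 → Vec Bool 10
  act φ b = bits (fromBits b) φ

  -- The permutation of the ten pairs that is induced by exchanging the vertices `p` and `p + 1`.
  swapBits : Fin 4 → Vec Bool 10 → Vec Bool 10
  swapBits zero                   (a ∷ b ∷ c ∷ d ∷ e ∷ f ∷ g ∷ h ∷ i ∷ j ∷ []) = a ∷ e ∷ f ∷ g ∷ b ∷ c ∷ d ∷ h ∷ i ∷ j ∷ []
  swapBits (suc zero)             (a ∷ b ∷ c ∷ d ∷ e ∷ f ∷ g ∷ h ∷ i ∷ j ∷ []) = b ∷ a ∷ c ∷ d ∷ e ∷ h ∷ i ∷ f ∷ g ∷ j ∷ []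
  swapBits (suc (suc zero))       (a ∷ b ∷ c ∷ d ∷ e ∷ f ∷ g ∷ h ∷ i ∷ j ∷ []) = a ∷ c ∷ b ∷ d ∷ f ∷ e ∷ g ∷ h ∷ j ∷ i ∷ []
  swapBits (suc (suc (suc zero))) (a ∷ b ∷ c ∷ d ∷ e ∷ f ∷ g ∷ h ∷ i ∷ j ∷ []) = a ∷ b ∷ d ∷ c ∷ e ∷ g ∷ f ∷ i ∷ h ∷ j ∷ []

  swapAt : Fin k → Vec A (suc k) → Vec A (suc k)
  swapAt zero    (x ∷ y ∷ t) = y ∷ x ∷ t
  swapAt (suc p) (x ∷ t)     = x ∷ swapAt p t

  bits-swapAt : ∀ (a : A → A → Bool) → (∀ x y → a x y ≡ a y x) → ∀ p t → bits a (swapAt p t) ≡ swapBits p (bits a t)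
  bits-swapAt a a-sym zero                   (t ∷ u ∷ v ∷ w ∷ x ∷ []) rewrite a-sym u t = refl
  bits-swapAt a a-sym (suc zero)             (t ∷ u ∷ v ∷ w ∷ x ∷ []) rewrite a-sym v u = refl
  bits-swapAt a a-sym (suc (suc zero))       (t ∷ u ∷ v ∷ w ∷ x ∷ []) rewrite a-sym w v = refl
  bits-swapAt a a-sym (suc (suc (suc zero))) (t ∷ u ∷ v ∷ w ∷ x ∷ []) rewrite a-sym x w = refl

  -- Adds the translates of `T` under all prefixes of the word of swaps, including the empty one.
  -- Four such sums, with 2, 3, 4 and 5 terms, replace a sum of 120 tables.
  orbitSum : List (Fin 4) → Table ℤ 10 → Table ℤ 10
  orbitSum []       T = T
  orbitSum (p ∷ ps) T = zipTable ℤ._+_ T (orbitSum ps (tabulate (λ b → T ! swapBits p b)))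

  -- The sum over all 120 permutations of the vertices: at the k-th step, the swaps
  -- yield coset representatives of one symmetric group in the next.
  symmetrize : Table ℤ 10 → Table ℤ 10
  symmetrize T =
    orbitSum (# 3 ∷ # 2 ∷ # 1 ∷ # 0 ∷ []) (orbitSum (# 2 ∷ # 1 ∷ # 0 ∷ []) (orbitSum (# 1 ∷ # 0 ∷ []) (orbitSum (# 0 ∷ []) T)))

  -- Certificate data

  infix 8 −_
  −_ : ℕ → ℤ
  − n = ℤ.- (+ n)

  -- A common denominator of the certificate: the matrices are the integer Gram matrices divided by
  -- it. It is a multiple of 31104, so that `2 * denominator * u` is an integer as well.
  denominator : ℕ
  denominator = 85810053701934309217862246400000000

  -- A pair `(d , l)` stands for `d` times the square of the linear form `l` in the flag
  -- coordinates, which are numbered by `index₁`. The forms are orthogonal to `kernel₁`.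
  terms₁ : List (ℕ × Vec ℤ 6)
  terms₁ =
    (66796007284727444587500000 , − 295 ∷ + 3900 ∷ − 1911 ∷ + 0 ∷ + 429 ∷ + 388 ∷ []) ∷
    (6387596325042241968750000 , − 1550 ∷ + 0 ∷ + 3900 ∷ − 4251 ∷ + 7800 ∷ − 8229 ∷ []) ∷
    (203773543840633871107723125 , − 200 ∷ + 0 ∷ + 0 ∷ + 1300 ∷ − 2288 ∷ + 425 ∷ []) ∷
    (4424431126514004191566722 , − 2500 ∷ + 0 ∷ + 0 ∷ + 0 ∷ + 3900 ∷ + 1207 ∷ []) ∷
    (97477984529374965460963200000000 , + 0 ∷ + 0 ∷ + 0 ∷ + 0 ∷ + 0 ∷ + 1 ∷ []) ∷
    []

  termsν : List (ℕ × Vec ℤ 8)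
  termsν =
    (7360576051764082387370000000 , + 845 ∷ + 700 ∷ + 700 ∷ − 231 ∷ − 238 ∷ − 47 ∷ − 47 ∷ + 24 ∷ []) ∷
    (3477047172323522046879370000 , − 190 ∷ + 0 ∷ + 0 ∷ + 700 ∷ − 539 ∷ + 36 ∷ + 36 ∷ + 145 ∷ []) ∷
    (1721774383107583169556093708 , − 1500 ∷ + 0 ∷ + 0 ∷ + 0 ∷ + 350 ∷ − 213 ∷ − 213 ∷ + 371 ∷ []) ∷
    (18685361775517854335100000000 , + 0 ∷ + 0 ∷ + 0 ∷ + 0 ∷ + 0 ∷ + 100 ∷ + 100 ∷ − 21 ∷ []) ∷
    (323700476927735734360934400000000 , + 0 ∷ + 0 ∷ + 0 ∷ + 0 ∷ + 0 ∷ + 0 ∷ + 0 ∷ + 1 ∷ []) ∷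
    (464009830965521404885747102950 , + 0 ∷ − 100 ∷ + 100 ∷ + 0 ∷ + 0 ∷ − 1 ∷ + 1 ∷ + 0 ∷ []) ∷
    (1114559596694362812629126400000000 , + 0 ∷ + 0 ∷ + 0 ∷ + 0 ∷ + 0 ∷ − 1 ∷ + 1 ∷ + 0 ∷ []) ∷
    []

  -- Three pairwise non-adjacent roots can lie on one side or be split in three ways, so the forms
  -- vanish on four density vectors, such as `(217, 5, 5, 25, 5, 25, 25, 125)` for a common side and
  -- `(7, 5, 5, 25, 30, 0, 0, 0)` when the root 0 is alone.
  termsσ : List (ℕ × Vec ℤ 8)
  termsσ =
    (1767356651763116320725000000 , + 300 ∷ − 665 ∷ − 665 ∷ + 980 ∷ − 665 ∷ + 980 ∷ + 980 ∷ − 1029 ∷ []) ∷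
    (157682377852471344600000000 , − 200 ∷ + 35 ∷ + 35 ∷ + 0 ∷ + 35 ∷ + 0 ∷ + 0 ∷ + 343 ∷ []) ∷
    (51887692335364143857294718750000 , + 0 ∷ + 0 ∷ − 1 ∷ − 1 ∷ + 1 ∷ + 1 ∷ + 0 ∷ + 0 ∷ []) ∷
    (51887692335364143857294718750000 , + 0 ∷ + 1 ∷ + 0 ∷ + 1 ∷ − 1 ∷ + 0 ∷ − 1 ∷ + 0 ∷ []) ∷
    (51887692335364143857294718750000 , + 0 ∷ − 1 ∷ + 1 ∷ + 0 ∷ + 0 ∷ − 1 ∷ + 1 ∷ + 0 ∷ []) ∷
    []

  -- The isolated root lies on the side of either end of the edge, so the forms vanish on
  -- `(7, 5, 30, 0, 5, 25, 0, 0)` and `(7, 5, 5, 25, 30, 0, 0, 0)`.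
  termsμ : List (ℕ × Vec ℤ 8)
  termsμ =
    (5386264097418098424928125000 , − 690 ∷ + 700 ∷ + 453 ∷ − 581 ∷ + 453 ∷ − 581 ∷ − 100 ∷ + 359 ∷ []) ∷
    (49917602657448055828830577500 , − 50 ∷ + 0 ∷ + 100 ∷ − 126 ∷ + 100 ∷ − 126 ∷ + 45 ∷ + 13 ∷ []) ∷
    (167376707025342430136018589 , − 2500 ∷ + 0 ∷ + 0 ∷ + 700 ∷ + 0 ∷ + 700 ∷ + 2052 ∷ + 1783 ∷ []) ∷
    (1892188534229656135200000000 , + 0 ∷ + 0 ∷ + 0 ∷ + 0 ∷ + 0 ∷ + 0 ∷ + 100 ∷ − 61 ∷ []) ∷
    (257489015737971606878016000000000 , + 0 ∷ + 0 ∷ + 0 ∷ + 0 ∷ + 0 ∷ + 0 ∷ + 0 ∷ + 1 ∷ []) ∷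
    (1197359845330091127674209049375000 , + 0 ∷ + 0 ∷ − 1 ∷ − 1 ∷ + 1 ∷ + 1 ∷ + 0 ∷ + 0 ∷ []) ∷
    []

  opaque

    gram : List (ℕ × Vec ℤ k) → Fin k → Fin k → ℤ
    gram []             i j = + 0
    gram ((d , l) ∷ ts) i j = + d ℤ.* (lookup l i ℤ.* lookup l j) ℤ.+ gram ts i j

    gram-[] : (i j : Fin k) → gram [] i j ≡ + 0
    gram-[] i j = refl

    gram-∷ : ∀ d (l : Vec ℤ k) ts i j → gram ((d , l) ∷ ts) i j ≡ + d ℤ.* (lookup l i ℤ.* lookup l j) ℤ.+ gram ts i j
    gram-∷ d l ts i j = refl

  -- a and b are the adjacencies of the two unlabelled vertices to the root, c their mutual adjacency
  index₁ : Bool → Bool → Bool → Fin 6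
  index₁ false false false = # 0
  index₁ false false true  = # 1
  index₁ false true  false = # 2
  index₁ false true  true  = # 3
  index₁ true  false false = # 2
  index₁ true  false true  = # 3
  index₁ true  true  false = # 4
  index₁ true  true  true  = # 5

  index₃ : Bool → Bool → Bool → Fin 8
  index₃ false false false = # 0
  index₃ false false true  = # 1
  index₃ false true  false = # 2
  index₃ false true  true  = # 3
  index₃ true  false false = # 4
  index₃ true  false true  = # 5
  index₃ true  true  false = # 6
  index₃ true  true  true  = # 7

  -- The arguments are the adjacencies 01, 02 and 12 of the type.
  terms₃ : Bool → Bool → Bool → List (ℕ × Vec ℤ 8)
  terms₃ true  true  false = termsν
  terms₃ false false false = termsσ
  terms₃ true  false false = termsμ
  terms₃ _     _     _     = []

  -- Five vertices are split as two unlabelled vertices and three roots ...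
  term₃ : Vec Bool 10 → ℤ
  term₃ (a ∷ b ∷ c ∷ d ∷ e ∷ f ∷ g ∷ h ∷ i ∷ j ∷ []) = gram (terms₃ h i j) (index₃ b c d) (index₃ e f g)

  -- ... or as two pairs of unlabelled vertices and one root.
  term₁ : Vec Bool 10 → ℤ
  term₁ (a ∷ b ∷ c ∷ d ∷ e ∷ f ∷ g ∷ h ∷ i ∷ j ∷ []) = gram terms₁ (index₁ d g a) (index₁ i j h)

  C₄-pendant-bits : Vec Bool 10
  C₄-pendant-bits = true ∷ false ∷ true ∷ true ∷ true ∷ false ∷ false ∷ true ∷ false ∷ false ∷ []

  isEqual : Vec Bool k → Vec Bool k → Bool
  isEqual []       []       = true
  isEqual (x ∷ xs) (y ∷ ys) = does (x Bool.≟ y) ∧ isEqual xs ys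

  isEqual-sound : (b c : Vec Bool k) → isEqual b c ≡ true → b ≡ c
  isEqual-sound []       []       e = refl
  isEqual-sound (x ∷ xs) (y ∷ ys) e with x Bool.≟ y
  ... | yes refl = cong (x ∷_) (isEqual-sound xs ys e)
  isEqual-sound (x ∷ xs) (y ∷ ys) () | no _

  opaque
    unfolding gram

    indicator : Table ℤ 10
    indicator = tabulate λ b → if isEqual b C₄-pendant-bits then + 1 else + 0

    indicator-def : ∀ b → indicator ! b ≡ (if isEqual b C₄-pendant-bits then + 1 else + 0)
    indicator-def = !-tabulate _

    -- Entry `b` counts the permutations that carry `b` to the fixed labelling of the pattern. The
    -- automorphism group of the 4-cycle with a pendant edge has order 2 (exchange of 1 and 3), so
    -- the value is 2 on copies of the pattern and 0 elsewhere.
    embeddings : Table ℤ 10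
    embeddings = symmetrize indicator

    embeddings-def : embeddings ≡ symmetrize indicator
    embeddings-def = refl

    -- The certificate identity multiplied by `240 * denominator`, as a summand over 5-tuples. Of
    -- the factor 240, the 120 orderings of a 5-set absorb 120, which leaves
    -- `2 * denominator * (u - λ)` with `λ = E / 2`. A form with three roots is directly a sum over
    -- 5-tuples and keeps 240; with one root, each unlabelled pair is counted in both orders, which
    -- leaves `240 / 4 = 60`.
    excess : Table ℤ 10
    excess = go embeddings
      where
      go : Table ℤ 10 → Table ℤ 10
      go E = tabulate λ b →
        + (denominator ℕ./ 31104 ℕ.* 15625) ℤ.- + denominator ℤ.* (E ! b) ℤ.- (+ 240 ℤ.* term₃ b ℤ.+ + 60 ℤ.* term₁ b)

    excess-def : ∀ b → excess ! b ≡
      + (denominator ℕ./ 31104 ℕ.* 15625) ℤ.- + denominator ℤ.* (embeddings ! b) ℤ.- (+ 240 ℤ.* term₃ b ℤ.+ + 60 ℤ.* term₁ b)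
    excess-def = !-tabulate _

    slack : Table ℤ 10
    slack = symmetrize excess

    slack-def : slack ≡ symmetrize excess
    slack-def = refl

  allBits : (Vec Bool k → Bool) → Bool
  allBits {zero}  p = p []
  allBits {suc k} p = allBits (p ∘ (true ∷_)) ∧ allBits (p ∘ (false ∷_))

  ∧-true : ∀ {a b} → a ∧ b ≡ true → a ≡ true × b ≡ true
  ∧-true {true} {true} e = refl , refl

  allBits-sound : (p : Vec Bool k → Bool) → allBits p ≡ true → ∀ b → p b ≡ true
  allBits-sound p e []          = e
  allBits-sound p e (true ∷ b)  = allBits-sound (p ∘ (true ∷_)) (proj₁ (∧-true e)) b
  allBits-sound p e (false ∷ b) = allBits-sound (p ∘ (false ∷_)) (proj₂ (∧-true e)) b

  allFinᵇ : (Fin n → Bool) → Bool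
  allFinᵇ {zero}  p = true
  allFinᵇ {suc n} p = p zero ∧ allFinᵇ (p ∘ suc)

  allFinᵇ-sound : (p : Fin n → Bool) → allFinᵇ p ≡ true → ∀ i → p i ≡ true
  allFinᵇ-sound p e zero    = proj₁ (∧-true e)
  allFinᵇ-sound p e (suc i) = allFinᵇ-sound (p ∘ suc) (proj₂ (∧-true e)) i

  occurs : Fin n → Vec (Fin n) k → Bool
  occurs x []      = false
  occurs x (y ∷ φ) = does (x Fin.≟ y) ∨ occurs x φ

  occurs-sound : (x : Fin n) (φ : Vec (Fin n) k) → occurs x φ ≡ true → x ∈ image φ
  occurs-sound x (y ∷ φ) e with x Fin.≟ y
  ... | yes refl = image-∈⁺ (x ∷ φ) zero
  ... | no _     = Subset.x∈p∪q⁺ (inj₂ (occurs-sound x φ e))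

  -- Extending only injective tails keeps the test on five vertices at the 120 permutations.
  allInjections : ∀ k → (Vec (Fin n) k → Bool) → Bool
  allInjections zero    p = p []
  allInjections (suc k) p = allInjections k λ φ → allFinᵇ λ x → occurs x φ ∨ p (x ∷ φ)

  allInjections-sound : (p : Vec (Fin n) k → Bool) → allInjections k p ≡ true → ∀ φ → IsInjective φ → p φ ≡ true
  allInjections-sound p e []      inj = e
  allInjections-sound p e (x ∷ φ) inj with injective-∷⁻ {x = x} {φ} inj
  ... | x∉ , inj′ with occurs x φ in o | allFinᵇ-sound (λ x → occurs x φ ∨ p (x ∷ φ)) (allInjections-sound _ e φ inj′) x
  ...   | true  | _  = contradiction (occurs-sound x φ o) x∉
  ...   | false | e′ = e′

  allFinᵇ-false : (p : Fin n → Bool) → allFinᵇ p ≡ false → ∃ λ i → p i ≡ false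
  allFinᵇ-false {suc n} p e with p zero in e₀
  ... | false = zero , e₀
  ... | true  = let (i , eᵢ) = allFinᵇ-false (p ∘ suc) e in suc i , eᵢ

  occurs-complete : (x : Fin n) (φ : Vec (Fin n) k) → occurs x φ ≡ false → x ∉ image φ
  occurs-complete x []      e x∈ = Subset.∉⊥ x∈
  occurs-complete x (y ∷ φ) e x∈ with x Fin.≟ y | Subset.x∈p∪q⁻ ⁅ y ⁆ (image φ) x∈
  ... | no x≢y | inj₁ x∈y = x≢y (Subset.x∈⁅y⁆⇒x≡y y x∈y)
  ... | no _   | inj₂ x∈φ = occurs-complete x φ e x∈φ

  -- A failed Boolean test yields an actual tuple; applied to `avoids b`, this produces the
  -- isomorphism with the pattern.
  allInjections-false : (p : Vec (Fin n) k → Bool) → allInjections k p ≡ false → ∃ λ φ → IsInjective φ × p φ ≡ false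
  allInjections-false {k = zero}  p e = [] , (λ { {()} }) , e
  allInjections-false {k = suc k} p e with allInjections-false {k = k} _ e
  ... | φ , inj , e′ with allFinᵇ-false _ e′
  ...   | x , e″ with occurs x φ in o
  ...     | false = x ∷ φ , injective-∷⁺ {x = x} {φ} (occurs-complete x φ o) inj , e″

  isNonNegative : ℤ → Bool
  isNonNegative (+ _)      = true
  isNonNegative ℤ.-[1+ _ ] = false

  isNonNegativeAt : Table ℤ 10 → Vec Bool 10 → Bool
  isNonNegativeAt T b = isNonNegative (T ! b)

  isFixed : Table ℤ 10 → Fin 4 → Vec Bool 10 → Bool
  isFixed T p b = does ((T ! swapBits p b) ℤ.≟ (T ! b))

  isSwapInvariant : Table ℤ 10 → Bool
  isSwapInvariant T = allFinᵇ λ p → allBits (isFixed T p)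

  avoids : Vec Bool 10 → Vec (Fin 5) 5 → Bool
  avoids b φ = not (isEqual (act φ b) C₄-pendant-bits)

  -- Tests one direction: a non-zero entry is 2 and comes with a permutation onto the pattern. That
  -- copies of the pattern have entry 2 follows later from swap invariance and the entry at the
  -- pattern itself.
  isCount : Table ℤ 10 → Vec Bool 10 → Bool
  isCount E b = does ((E ! b) ℤ.≟ + 0) ∨ (does ((E ! b) ℤ.≟ + 2) ∧ not (allInjections 5 (avoids b)))

-- Verification of the tables by computation, and their invariance under permutations.

module Evaluation where

  open import Data.Bool using (Bool; true; false; _∧_; _∨_; not; if_then_else_)
  open import Data.Fin as Fin using (Fin; zero; suc; #_)
  open import Data.Integer as ℤ using (ℤ; +_)
  open import Data.List using (List; []; _∷_)
  open import Data.Nat as ℕ using (ℕ; suc)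
  open import Data.Product using (_×_; _,_; ∃)
  open import Data.Vec as Vec using (Vec; []; _∷_; lookup)
  import Data.Vec.Properties as Vec
  open import Relation.Binary.PropositionalEquality
  open import Relation.Nullary using (Dec; does; yes; no)
  import Data.Bool.Properties as Bool
  open import Defs using (IsInjective)
  open import Data.Sum as Sum using (_⊎_; inj₁; inj₂)
  open Tuples
  open Tables

  private variable
    k n : ℕ
    A : Set

  -- These evaluations are the computational content of the certificate.
  opaque
    unfolding embeddings slack

    slack-checked : allBits (isNonNegativeAt slack) ≡ true
    slack-checked = refl

    embeddings-invariance-checked : isSwapInvariant embeddings ≡ true
    embeddings-invariance-checked = refl

    slack-invariance-checked : isSwapInvariant slack ≡ true
    slack-invariance-checked = refl

    embeddings-checked : allBits (isCount embeddings) ≡ true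
    embeddings-checked = refl

    embeddings-C₄-pendant : embeddings ! C₄-pendant-bits ≡ + 2
    embeddings-C₄-pendant = refl

  isNonNegative-sound : ∀ z → isNonNegative z ≡ true → + 0 ℤ.≤ z
  isNonNegative-sound (+ n) _ = ℤ.+≤+ ℕ.z≤n

  0≤slack : ∀ b → + 0 ℤ.≤ slack ! b
  0≤slack b = isNonNegative-sound (slack ! b) (allBits-sound (isNonNegativeAt slack) slack-checked b)

  does-sound : ∀ {P : Set} (p? : Dec P) → does p? ≡ true → P
  does-sound (yes p) _ = p

  swapBits-invariant : ∀ T → isSwapInvariant T ≡ true → ∀ p b → T ! swapBits p b ≡ T ! b
  swapBits-invariant T e p b = does-sound ((T ! swapBits p b) ℤ.≟ (T ! b))
    (allBits-sound (isFixed T p) (allFinᵇ-sound (λ p → allBits (isFixed T p)) e p) b)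

  -- Compare-exchange operations sort every injective φ : Vec (Fin 5) 5, which
  -- reduces invariance under all permutations to invariance under adjacent swaps.

  exchange : Fin 4 → Vec (Fin 5) 5 → Vec (Fin 5) 5
  exchange p φ = if does (lookup φ (suc p) Fin.<? lookup φ (Fin.inject₁ p)) then swapAt p φ else φ

  sort : List (Fin 4) → Vec (Fin 5) 5 → Vec (Fin 5) 5
  sort []       φ = φ
  sort (p ∷ ps) φ = sort ps (exchange p φ)

  bubbles : List (Fin 4)
  bubbles = # 0 ∷ # 1 ∷ # 2 ∷ # 3 ∷ # 0 ∷ # 1 ∷ # 2 ∷ # 0 ∷ # 1 ∷ # 0 ∷ []

  increasing : Vec (Fin 5) 5
  increasing = # 0 ∷ # 1 ∷ # 2 ∷ # 3 ∷ # 4 ∷ []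

  -- The ten comparisons are those of bubble sort; the claim is evaluated at all 120 injective
  -- tuples.
  sorts : ∀ φ → IsInjective φ → sort bubbles φ ≡ increasing
  sorts φ inj = does-sound (Vec.≡-dec Fin._≟_ (sort bubbles φ) increasing)
    (allInjections-sound (λ φ → does (Vec.≡-dec Fin._≟_ (sort bubbles φ) increasing)) refl φ inj)

  act-increasing : ∀ b → act increasing b ≡ b
  act-increasing (_ ∷ _ ∷ _ ∷ _ ∷ _ ∷ _ ∷ _ ∷ _ ∷ _ ∷ _ ∷ []) = refl

  module _ (T : Table ℤ 10) (T-invariant : isSwapInvariant T ≡ true) (b : Vec Bool 10) where

    private
      swap-invariant : ∀ p φ → T ! act (swapAt p φ) b ≡ T ! act φ b
      swap-invariant p φ = trans (cong (T !_) (bits-swapAt (fromBits b) (fromBits-sym b) p φ)) (swapBits-invariant T T-invariant p (act φ b))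

      choice-invariant : ∀ c p φ → T ! act (if c then swapAt p φ else φ) b ≡ T ! act φ b
      choice-invariant true  p φ = swap-invariant p φ
      choice-invariant false p φ = refl

      exchange-invariant : ∀ p φ → T ! act (exchange p φ) b ≡ T ! act φ b
      exchange-invariant p φ = choice-invariant (does (lookup φ (suc p) Fin.<? lookup φ (Fin.inject₁ p))) p φ

      sort-invariant : ∀ ps φ → T ! act (sort ps φ) b ≡ T ! act φ b
      sort-invariant []       φ = refl
      sort-invariant (p ∷ ps) φ = trans (sort-invariant ps (exchange p φ)) (exchange-invariant p φ)

      sorted-invariant : ∀ ps φ → sort ps φ ≡ increasing → T ! act φ b ≡ T ! b
      sorted-invariant ps φ e = trans (sym (sort-invariant ps φ))
        (trans (cong (λ ψ → T ! act ψ b) e) (cong (T !_) (act-increasing b)))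

    -- Each sorting step is either no change or an adjacent swap, so the entry is the same all the
    -- way from `φ` to `increasing`, which acts trivially.
    act-invariant : ∀ φ → IsInjective φ → T ! act φ b ≡ T ! b
    act-invariant φ inj = sorted-invariant bubbles φ (sorts φ inj)

  count-sound : ∀ {P Q : Set} (p? : Dec P) (q? : Dec Q) (f : Vec (Fin n) k → Bool) →
    does p? ∨ (does q? ∧ not (allInjections k f)) ≡ true → P ⊎ Q × ∃ λ φ → IsInjective φ × f φ ≡ false
  count-sound         (yes p) _       f e = inj₁ p
  count-sound {k = k} (no _)  (yes q) f e with allInjections k f in e′
  ... | false = inj₂ (q , allInjections-false f e′)

  isCount-sound : ∀ E b → isCount E b ≡ true →
    E ! b ≡ + 0 ⊎ E ! b ≡ + 2 × ∃ λ φ → IsInjective φ × avoids b φ ≡ false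
  isCount-sound E b = count-sound ((E ! b) ℤ.≟ + 0) ((E ! b) ℤ.≟ + 2) (avoids b)

  avoids-sound : ∀ b φ → avoids b φ ≡ false → act φ b ≡ C₄-pendant-bits
  avoids-sound b φ e = isEqual-sound (act φ b) C₄-pendant-bits (Bool.not-injective e)

  embeddings-values : ∀ b → embeddings ! b ≡ + 0 ⊎
    embeddings ! b ≡ + 2 × ∃ λ φ → IsInjective φ × act φ b ≡ C₄-pendant-bits
  embeddings-values b = Sum.map₂ (λ (e , φ , inj , a) → e , φ , inj , avoids-sound b φ a)
    (isCount-sound embeddings b (allBits-sound (isCount embeddings) embeddings-checked b))

-- Sums over injective 5-tuples do not see the order of the tuple.

module Symmetrization where

  open import Data.Bool using (Bool)
  open import Data.Fin using (Fin; zero; suc; #_)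
  open import Data.Fin.Subset as Subset using (Subset; _∪_; _∈_; _∉_; ⁅_⁆)
  open import Data.Fin.Subset.Properties as Subset
  open import Data.Integer as ℤ using (ℤ)
  open import Data.List using (List; []; _∷_; allFin; length)
  open import Data.Nat using (ℕ; zero; suc)
  open import Data.Product using (_×_; _,_)
  open import Data.Sum using (inj₁; inj₂)
  open import Data.Rational using (ℚ; 1ℚ; _+_; _*_)
  import Data.Rational.Properties as ℚ
  open import Data.Rational.Solver using (module +-*-Solver)
  open import Data.Vec using (Vec; []; _∷_)
  open import Function using (_∘_; mk⇔)
  open import Relation.Binary.PropositionalEquality
  open import Relation.Nullary using (does)
  open import Relation.Nullary.Decidable using (does-⇔; _×-dec_)
  open import Defs using (vectors; image)
  open Sums
  open Tuples
  open Tables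

  private variable
    k n : ℕ
    A : Set

  ∑-swapAt : ∀ (xs : List A) (p : Fin k) (f : Vec A (suc k) → ℚ) →
             ∑ (vectors xs (suc k)) (f ∘ swapAt p) ≡ ∑ (vectors xs (suc k)) f
  ∑-swapAt {k = suc k} xs zero f = begin
    ∑ (vectors xs (suc (suc k))) (f ∘ swapAt zero)
      ≡⟨ trans (∑-vectors xs {suc k} _) (∑-cong xs λ x → ∑-vectors xs {k} _) ⟩
    ∑ xs (λ x → ∑ xs λ y → ∑ (vectors xs k) λ t → f (y ∷ x ∷ t))
      ≡⟨ ∑-swap xs xs _ ⟩
    ∑ xs (λ y → ∑ xs λ x → ∑ (vectors xs k) λ t → f (y ∷ x ∷ t))
      ≡⟨ trans (∑-vectors xs {suc k} _) (∑-cong xs λ x → ∑-vectors xs {k} _) ⟨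
    ∑ (vectors xs (suc (suc k))) f ∎
    where open ≡-Reasoning
  ∑-swapAt {k = suc k} xs (suc p) f = trans (∑-vectors xs {suc k} _)
    (trans (∑-cong xs λ x → ∑-swapAt xs p (λ t → f (x ∷ t))) (sym (∑-vectors xs {suc k} f)))

  image-swapAt : (p : Fin k) (t : Vec (Fin n) (suc k)) → image (swapAt p t) ≡ image t
  image-swapAt zero (x ∷ y ∷ t) = trans (sym (Subset.∪-assoc ⁅ y ⁆ ⁅ x ⁆ (image t)))
    (trans (cong (_∪ image t) (Subset.∪-comm ⁅ y ⁆ ⁅ x ⁆)) (Subset.∪-assoc ⁅ x ⁆ ⁅ y ⁆ (image t)))
  image-swapAt (suc p) (x ∷ t) = cong (⁅ x ⁆ ∪_) (image-swapAt p t)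

  distinct-swapAt : (p : Fin k) (t : Vec (Fin n) (suc k)) → distinct (swapAt p t) ≡ distinct t
  distinct-swapAt zero (x ∷ y ∷ t) = begin
    distinct (y ∷ x ∷ t)
      ≡⟨ two y x ⟩
    ⟦ does ((y ∉? (⁅ x ⁆ ∪ S)) ×-dec (x ∉? S)) ⟧ * distinct t
      ≡⟨ cong (λ b → ⟦ b ⟧ * distinct t) (does-⇔ (mk⇔ (exchange x y) (exchange y x))
           ((y ∉? (⁅ x ⁆ ∪ S)) ×-dec (x ∉? S)) ((x ∉? (⁅ y ⁆ ∪ S)) ×-dec (y ∉? S))) ⟩
    ⟦ does ((x ∉? (⁅ y ⁆ ∪ S)) ×-dec (y ∉? S)) ⟧ * distinct t
      ≡⟨ two x y ⟨
    distinct (x ∷ y ∷ t) ∎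
    where
    open ≡-Reasoning
    S = image t
    two : ∀ x y → distinct (x ∷ y ∷ t) ≡ ⟦ does ((x ∉? (⁅ y ⁆ ∪ S)) ×-dec (y ∉? S)) ⟧ * distinct t
    two x y = trans (distinct-∷ x (y ∷ t)) (trans (cong (⟦ does (x ∉? (⁅ y ⁆ ∪ S)) ⟧ *_) (distinct-∷ y t))
      (trans (sym (ℚ.*-assoc ⟦ does (x ∉? (⁅ y ⁆ ∪ S)) ⟧ ⟦ does (y ∉? S) ⟧ (distinct t)))
             (cong (_* distinct t) (sym (⟦∧⟧ (does (x ∉? (⁅ y ⁆ ∪ S))) (does (y ∉? S)))))))
    exchange : ∀ x y → y ∉ (⁅ x ⁆ ∪ S) × x ∉ S → x ∉ (⁅ y ⁆ ∪ S) × y ∉ S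
    exchange x y (y∉ , x∉) = x∉′ , λ y∈ → y∉ (Subset.x∈p∪q⁺ {p = ⁅ x ⁆} (inj₂ y∈))
      where
      x∉′ : x ∉ (⁅ y ⁆ ∪ S)
      x∉′ x∈ with Subset.x∈p∪q⁻ ⁅ y ⁆ S x∈
      ... | inj₁ x∈y = y∉ (Subset.x∈p∪q⁺ {p = ⁅ x ⁆} (inj₁ (subst (_∈ ⁅ x ⁆) (Subset.x∈⁅y⁆⇒x≡y y x∈y) (Subset.x∈⁅x⁆ x))))
      ... | inj₂ x∈S = x∉ x∈S
  distinct-swapAt (suc p) (x ∷ t) = trans (distinct-∷ x (swapAt p t))
    (trans (cong₂ (λ S d → ⟦ does (x ∉? S) ⟧ * d) (image-swapAt p t) (distinct-swapAt p t)) (sym (distinct-∷ x t)))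

  module _ (a : Fin n → Fin n → Bool) (a-sym : ∀ x y → a x y ≡ a y x) where

    ∑-injective : (Vec Bool 10 → ℚ) → ℚ
    ∑-injective h = ∑ (vectors (allFin n) 5) λ t → distinct t * h (bits a t)

    ∑-injective-cong : ∀ {h h′} → (∀ b → h b ≡ h′ b) → ∑-injective h ≡ ∑-injective h′
    ∑-injective-cong e = ∑-cong (vectors (allFin n) 5) λ t → cong (distinct t *_) (e (bits a t))

    ∑-injective-+ : ∀ h h′ → ∑-injective (λ b → h b + h′ b) ≡ ∑-injective h + ∑-injective h′
    ∑-injective-+ h h′ = trans
      (∑-cong (vectors (allFin n) 5) λ t → ℚ.*-distribˡ-+ (distinct t) (h (bits a t)) (h′ (bits a t)))
      (∑-+ (vectors (allFin n) 5) _ _)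

    ∑-injective-* : ∀ c h → ∑-injective (λ b → c * h b) ≡ c * ∑-injective h
    ∑-injective-* c h = trans
      (∑-cong (vectors (allFin n) 5) λ t → solve 3 (λ d c h → d :* (c :* h) := c :* (d :* h)) refl (distinct t) c (h (bits a t)))
      (∑-*ˡ (vectors (allFin n) 5) c _)
      where open +-*-Solver using (solve; _:=_; _:*_)

    ∑-injective-swap : ∀ p h → ∑-injective (h ∘ swapBits p) ≡ ∑-injective h
    ∑-injective-swap p h = trans
      (∑-cong (vectors (allFin n) 5) λ t → cong₂ (λ d b → d * h b) (sym (distinct-swapAt p t)) (sym (bits-swapAt a a-sym p t)))
      (∑-swapAt (allFin n) p (λ t → distinct t * h (bits a t)))

    private
      Ω : Table ℤ 10 → ℚ
      Ω T = ∑-injective λ b → ι (T ! b)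

      -- Each translate of `T` has the same sum, because swapping two neighbouring entries permutes
      -- the injective tuples.
      Ω-orbitSum : ∀ ps T → Ω (orbitSum ps T) ≡ ιℕ (suc (length ps)) * Ω T
      Ω-orbitSum []       T = sym (trans (cong (_* Ω T) ι-1) (ℚ.*-identityˡ (Ω T)))
      Ω-orbitSum (p ∷ ps) T = begin
        Ω (orbitSum (p ∷ ps) T)
          ≡⟨ trans (∑-injective-cong λ b → trans (cong ι (!-zipTable ℤ._+_ T (orbitSum ps T′) b)) (ι-+ (T ! b) (orbitSum ps T′ ! b)))
                   (∑-injective-+ (λ b → ι (T ! b)) (λ b → ι (orbitSum ps T′ ! b))) ⟩
        Ω T + Ω (orbitSum ps T′)
          ≡⟨ cong (λ z → Ω T + z) (Ω-orbitSum ps T′) ⟩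
        Ω T + ιℕ (suc (length ps)) * Ω T′
          ≡⟨ cong (λ z → Ω T + ιℕ (suc (length ps)) * z)
               (trans (∑-injective-cong λ b → cong ι (!-tabulate (λ b → T ! swapBits p b) b)) (∑-injective-swap p (λ b → ι (T ! b)))) ⟩
        Ω T + ιℕ (suc (length ps)) * Ω T
          ≡⟨ solve 2 (λ o l → o :+ l :* o := (con 1ℚ :+ l) :* o) refl (Ω T) (ιℕ (suc (length ps))) ⟩
        (1ℚ + ιℕ (suc (length ps))) * Ω T
          ≡⟨ cong (_* Ω T) (ιℕ-suc (suc (length ps))) ⟨
        ιℕ (suc (length (p ∷ ps))) * Ω T ∎
        where
        open ≡-Reasoning
        open +-*-Solver using (solve; con; _:=_; _:*_; _:+_)
        T′ : Table ℤ 10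
        T′ = tabulate λ b → T ! swapBits p b

    ∑-symmetrize : ∀ T → ∑-injective (λ b → ι (symmetrize T ! b)) ≡ ιℕ 120 * ∑-injective (λ b → ι (T ! b))
    ∑-symmetrize T = begin
      Ω (orbitSum p₄ T₃)
        ≡⟨ trans (Ω-orbitSum p₄ T₃) (cong (ιℕ 5 *_) (trans (Ω-orbitSum p₃ T₂) (cong (ιℕ 4 *_)
             (trans (Ω-orbitSum p₂ T₁) (cong (ιℕ 3 *_) (Ω-orbitSum p₁ T)))))) ⟩
      ιℕ 5 * (ιℕ 4 * (ιℕ 3 * (ιℕ 2 * Ω T)))
        ≡⟨ solve 5 (λ a b c d o → a :* (b :* (c :* (d :* o))) := a :* (b :* (c :* d)) :* o) refl (ιℕ 5) (ιℕ 4) (ιℕ 3) (ιℕ 2) (Ω T) ⟩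
      ιℕ 5 * (ιℕ 4 * (ιℕ 3 * ιℕ 2)) * Ω T
        ≡⟨ cong (_* Ω T) (trans (cong (ιℕ 5 *_) (trans (cong (ιℕ 4 *_) (sym (ιℕ-* 3 2))) (sym (ιℕ-* 4 6)))) (sym (ιℕ-* 5 24))) ⟩
      ιℕ 120 * Ω T ∎
      where
      open ≡-Reasoning
      open +-*-Solver using (solve; _:=_; _:*_)
      p₁ = # 0 ∷ []
      p₂ = # 1 ∷ # 0 ∷ []
      p₃ = # 2 ∷ # 1 ∷ # 0 ∷ []
      p₄ = # 3 ∷ # 2 ∷ # 1 ∷ # 0 ∷ []
      T₁ = orbitSum p₁ T
      T₂ = orbitSum p₂ T₁
      T₃ = orbitSum p₃ T₂

-- The pattern in a random bipartite graph, by counting choices.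

module RandomBipartite where

  open import Data.Bool using (Bool; true; false; _∧_; _∨_; not; if_then_else_)
  import Data.Bool.Properties as Bool
  open import Data.Fin as Fin using (Fin; zero; suc)
  open import Data.Fin.Subset using (_∉_)
  open import Data.Integer as ℤ using (ℤ)
  open import Data.List using (List; []; _∷_; length; cartesianProductWith)
  open import Data.Nat as ℕ using (ℕ; zero; suc)
  import Data.Nat.Properties as ℕ
  open import Data.Product using (_×_; _,_; proj₁; proj₂)
  open import Data.Sum using (inj₂)
  open import Data.Rational using (ℚ; 0ℚ; 1ℚ; ½; _+_; _*_; _≤_; _<_; _/_)
  import Data.Rational.Properties as ℚ
  open import Data.Rational.Solver using (module +-*-Solver)
  open import Data.Vec as Vec using (Vec; []; _∷_; lookup; _[_]≔_)
  import Data.Vec.Properties as Vec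
  open import Function using (id)
  open import Relation.Binary.PropositionalEquality
  open import Relation.Nullary using (contradiction)
  open import Relation.Nullary.Decidable using (from-yes; _→-dec_)
  import Data.Fin.Properties as Fin
  open import Defs using (vectors; image; IsInjective)
  open Sums
  open Tuples
  open Tables

  private variable
    k n : ℕ
    A : Set

  allAt : Vec (A → Bool) k → Vec (Fin n) k → Vec A n → Bool
  allAt []       []      s = true
  allAt (p ∷ ps) (v ∷ t) s = p (lookup s v) ∧ allAt ps t s

  allAt-update : ∀ (ps : Vec (A → Bool) k) (t : Vec (Fin n) k) v → v ∉ image t → ∀ s x → allAt ps t (s [ v ]≔ x) ≡ allAt ps t s
  allAt-update []       []      v v∉ s x = refl
  allAt-update (p ∷ ps) (u ∷ t) v v∉ s x = cong₂ _∧_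
    (cong p (Vec.lookup∘update′ (λ { refl → v∉ (image-∈⁺ (u ∷ t) zero) }) s x))
    (allAt-update ps t v (λ v∈ → v∉ (Data.Fin.Subset.Properties.x∈p∪q⁺ {p = Data.Fin.Subset.⁅ u ⁆} (inj₂ v∈))) s x)
    where import Data.Fin.Subset.Properties

  module _ (xs : List A) where

    private
      N = ιℕ (length xs)

    -- Overwriting the coordinate `v` by every letter of `xs` meets each vector once for every
    -- previous value of that coordinate. This detaches `v` from the other coordinates.
    ∑-resample : ∀ (v : Fin n) (G : Vec A n → ℚ) →
      N * ∑ (vectors xs n) G ≡ ∑ xs λ x → ∑ (vectors xs n) λ s → G (s [ v ]≔ x)
    ∑-resample {suc n} zero G = begin
      N * ∑ (vectors xs (suc n)) G
        ≡⟨ cong (N *_) (∑-vectors xs {n} G) ⟩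
      N * ∑ xs (λ x → ∑ (vectors xs n) λ s → G (x ∷ s))
        ≡⟨ ∑-*ˡ xs N _ ⟨
      ∑ xs (λ x → N * ∑ (vectors xs n) λ s → G (x ∷ s))
        ≡⟨ ∑-cong xs (λ x → trans (∑-vectors xs {n} (λ s → G (s [ zero ]≔ x))) (∑-const xs _)) ⟨
      ∑ xs (λ x → ∑ (vectors xs (suc n)) λ s → G (s [ zero ]≔ x)) ∎
      where open ≡-Reasoning
    ∑-resample {suc n} (suc v) G = begin
      N * ∑ (vectors xs (suc n)) G
        ≡⟨ cong (N *_) (∑-vectors xs {n} G) ⟩
      N * ∑ xs (λ y → ∑ (vectors xs n) λ s → G (y ∷ s))
        ≡⟨ trans (sym (∑-*ˡ xs N _)) (∑-cong xs λ y → ∑-resample v (λ s → G (y ∷ s))) ⟩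
      ∑ xs (λ y → ∑ xs λ x → ∑ (vectors xs n) λ s → G (y ∷ (s [ v ]≔ x)))
        ≡⟨ ∑-swap xs xs _ ⟩
      ∑ xs (λ x → ∑ xs λ y → ∑ (vectors xs n) λ s → G (y ∷ (s [ v ]≔ x)))
        ≡⟨ ∑-cong xs (λ x → ∑-vectors xs {n} (λ s → G (s [ suc v ]≔ x))) ⟨
      ∑ xs (λ x → ∑ (vectors xs (suc n)) λ s → G (s [ suc v ]≔ x)) ∎
      where open ≡-Reasoning

    power : ℕ → ℚ
    power zero    = 1ℚ
    power (suc k) = N * power k

    counted : Vec (A → Bool) k → ℚ
    counted []       = 1ℚ
    counted (p ∷ ps) = ∑ xs (λ x → ⟦ p x ⟧) * counted ps

    -- Independence of the coordinates of a uniformly random vector.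
    ∑-independent : ∀ (ps : Vec (A → Bool) k) (t : Vec (Fin n) k) → IsInjective t →
      power k * ∑ (vectors xs n) (λ s → ⟦ allAt ps t s ⟧) ≡ ∑ (vectors xs n) (λ _ → 1ℚ) * counted ps
    ∑-independent {n = n} []   []      inj = trans (ℚ.*-identityˡ (∑ (vectors xs n) (λ _ → 1ℚ))) (sym (ℚ.*-identityʳ (∑ (vectors xs n) (λ _ → 1ℚ))))
    ∑-independent {suc k} {n} (p ∷ ps) (v ∷ t) inj with injective-∷⁻ {x = v} {t} inj
    ... | v∉ , inj′ = begin
      (N * power k) * ∑ S (λ s → ⟦ p (lookup s v) ∧ allAt ps t s ⟧)
        ≡⟨ solve 3 (λ a b c → (a :* b) :* c := b :* (a :* c)) refl N (power k) _ ⟩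
      power k * (N * ∑ S (λ s → ⟦ p (lookup s v) ∧ allAt ps t s ⟧))
        ≡⟨ cong (power k *_) (trans (∑-resample v (λ s → ⟦ p (lookup s v) ∧ allAt ps t s ⟧)) (∑-cong xs λ x → trans
             (∑-cong S λ s → trans (cong₂ (λ y b → ⟦ p y ∧ b ⟧) (Vec.lookup∘update v s x) (allAt-update ps t v v∉ s x)) (⟦∧⟧ (p x) _))
             (∑-*ˡ S ⟦ p x ⟧ _))) ⟩
      power k * ∑ xs (λ x → ⟦ p x ⟧ * ∑ S (λ s → ⟦ allAt ps t s ⟧))
        ≡⟨ cong (power k *_) (∑-*ʳ xs (λ x → ⟦ p x ⟧) (∑ S (λ s → ⟦ allAt ps t s ⟧))) ⟩
      power k * (∑ xs (λ x → ⟦ p x ⟧) * ∑ S (λ s → ⟦ allAt ps t s ⟧))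
        ≡⟨ solve 3 (λ a b c → a :* (b :* c) := b :* (a :* c)) refl (power k) (∑ xs (λ x → ⟦ p x ⟧)) _ ⟩
      ∑ xs (λ x → ⟦ p x ⟧) * (power k * ∑ S (λ s → ⟦ allAt ps t s ⟧))
        ≡⟨ cong (∑ xs (λ x → ⟦ p x ⟧) *_) (∑-independent ps t inj′) ⟩
      ∑ xs (λ x → ⟦ p x ⟧) * (∑ S (λ _ → 1ℚ) * counted ps)
        ≡⟨ solve 3 (λ a b c → a :* (b :* c) := b :* (a :* c)) refl (∑ xs (λ x → ⟦ p x ⟧)) (∑ S (λ _ → 1ℚ)) (counted ps) ⟩
      ∑ S (λ _ → 1ℚ) * (∑ xs (λ x → ⟦ p x ⟧) * counted ps) ∎
      where
      open ≡-Reasoning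
      open +-*-Solver using (solve; _:=_; _:*_)
      S = vectors xs n

  -- A random bipartite graph: every vertex chooses one of two sides and, for each
  -- vertex, a coin that is true with probability 5/6; a pair on different sides
  -- is decided by the coin of the vertex on the side true.

  coin : List Bool
  coin = true ∷ true ∷ true ∷ true ∷ true ∷ false ∷ []

  Choice : ℕ → Set
  Choice n = Bool × Vec Bool n

  choices : ∀ n → List (Choice n)
  choices n = cartesianProductWith _,_ (true ∷ false ∷ []) (vectors coin n)

  -- All coins for the edges at a vertex on the side `true` belong to that vertex. An event about a
  -- 5-tuple therefore splits into independent events for its five vertices, and each of these into
  -- independent coins, so `∑-independent` serves at both levels.
  arc : Vec (Choice n) n → Fin n → Fin n → Bool
  arc s u v = not (proj₁ (lookup s u)) ∧ proj₁ (lookup s v) ∧ lookup (proj₂ (lookup s v)) u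

  adjacent : Vec (Choice n) n → Fin n → Fin n → Bool
  adjacent s u v = arc s u v ∨ arc s v u

  adjacent-sym : ∀ (s : Vec (Choice n) n) u v → adjacent s u v ≡ adjacent s v u
  adjacent-sym s u v = Bool.∨-comm (arc s u v) (arc s v u)

  adjacent-irrefl : ∀ (s : Vec (Choice n) n) u → adjacent s u u ≡ false
  adjacent-irrefl s u with proj₁ (lookup s u)
  ... | true  = refl
  ... | false = refl

  flips : Vec (Bool → Bool) k → Vec (Fin n) k → Choice n → Bool
  flips ps t (b , f) = b ∧ allAt ps t f

  passive : Choice n → Bool
  passive (b , f) = not b

  -- The two bipartitions of the five vertices with which the pattern can appear.
  pattern₁ pattern₂ : Vec (Fin n) 5 → Vec (Choice n → Bool) 5
  pattern₁ (t₀ ∷ t₁ ∷ t₂ ∷ t₃ ∷ t₄ ∷ []) = 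
    passive ∷ flips (id ∷ id ∷ []) (t₀ ∷ t₂ ∷ []) ∷ passive ∷ flips (id ∷ id ∷ []) (t₀ ∷ t₂ ∷ []) ∷ flips (id ∷ not ∷ []) (t₀ ∷ t₂ ∷ []) ∷ []
  pattern₂ (t₀ ∷ t₁ ∷ t₂ ∷ t₃ ∷ t₄ ∷ []) = 
    flips (id ∷ id ∷ id ∷ []) (t₁ ∷ t₃ ∷ t₄ ∷ []) ∷ passive ∷ flips (id ∷ id ∷ not ∷ []) (t₁ ∷ t₃ ∷ t₄ ∷ []) ∷ passive ∷ passive ∷ []

  private
    isEqual-refl : (b : Vec Bool k) → isEqual b b ≡ true
    isEqual-refl []          = refl
    isEqual-refl (true ∷ b)  = isEqual-refl b
    isEqual-refl (false ∷ b) = isEqual-refl b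

    indicator-C₄-pendant : ι (indicator ! C₄-pendant-bits) ≡ 1ℚ
    indicator-C₄-pendant = trans (cong ι (indicator-def C₄-pendant-bits)) ι-1

    0≤indicator : ∀ b → 0ℚ ≤ ι (indicator ! b)
    0≤indicator b = subst (λ z → 0ℚ ≤ ι z) (sym (indicator-def b)) (go (isEqual b C₄-pendant-bits))
      where
      go : ∀ c → 0ℚ ≤ ι (if c then ℤ.+ 1 else ℤ.+ 0)
      go true  = 0≤ιℕ 1
      go false = 0≤ιℕ 0

  pattern₁-bits : ∀ (s : Vec (Choice n) n) t → allAt (pattern₁ t) t s ≡ true →
                  bits (adjacent s) t ≡ C₄-pendant-bits × allAt (pattern₂ t) t s ≡ false
  pattern₁-bits s (t₀ ∷ t₁ ∷ t₂ ∷ t₃ ∷ t₄ ∷ []) e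
    with lookup s t₀ | lookup s t₁ | lookup s t₂ | lookup s t₃ | lookup s t₄
  ... | false , f₀ | b₁ , f₁ | b₂ , f₂ | b₃ , f₃ | b₄ , f₄
    with b₁ | lookup f₁ t₀ | lookup f₁ t₂ | b₂ | b₃ | lookup f₃ t₀ | lookup f₃ t₂ | b₄ | lookup f₄ t₀ | lookup f₄ t₂
  ... | true | true | true | false | true | true | true | true | true | false = refl , refl

  pattern₂-bits : ∀ (s : Vec (Choice n) n) t → allAt (pattern₂ t) t s ≡ true → bits (adjacent s) t ≡ C₄-pendant-bits
  pattern₂-bits s (t₀ ∷ t₁ ∷ t₂ ∷ t₃ ∷ t₄ ∷ []) e
    with lookup s t₀ | lookup s t₁ | lookup s t₂ | lookup s t₃ | lookup s t₄
  ... | b₀ , f₀ | b₁ , f₁ | b₂ , f₂ | b₃ , f₃ | b₄ , f₄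
    with b₀ | lookup f₀ t₁ | lookup f₀ t₃ | lookup f₀ t₄ | b₁ | b₂ | lookup f₂ t₁ | lookup f₂ t₃ | lookup f₂ t₄ | b₃ | b₄
  ... | true | true | true | true | false | true | true | true | false | false | false = refl

  -- The two events are disjoint, since they put `t₀` on different sides, and each of them forces
  -- the pattern.
  patterns≤indicator : ∀ (s : Vec (Choice n) n) t →
    ⟦ allAt (pattern₁ t) t s ⟧ + ⟦ allAt (pattern₂ t) t s ⟧ ≤ ι (indicator ! bits (adjacent s) t)
  patterns≤indicator s t with allAt (pattern₁ t) t s in e₁ | allAt (pattern₂ t) t s in e₂
  ... | false | false = subst (_≤ ι (indicator ! bits (adjacent s) t)) (sym (ℚ.+-identityˡ 0ℚ)) (0≤indicator (bits (adjacent s) t))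
  ... | false | true  = ℚ.≤-reflexive (trans (ℚ.+-identityˡ 1ℚ) (sym (trans (cong (λ b → ι (indicator ! b)) (pattern₂-bits s t e₂)) indicator-C₄-pendant)))
  ... | true  | false = ℚ.≤-reflexive (trans (ℚ.+-identityʳ 1ℚ) (sym (trans (cong (λ b → ι (indicator ! b)) (proj₁ (pattern₁-bits s t e₁))) indicator-C₄-pendant)))
  ... | true  | true  with () ← trans (sym e₂) (proj₂ (pattern₁-bits s t e₁))

  module _ {n : ℕ} where

    private
      W = choices n
      M = ∑ (vectors coin n) (λ _ → 1ℚ)
      N = ιℕ (length W)
      Z = ∑ (vectors W n) (λ _ → 1ℚ)

      0<M : 0ℚ < M
      0<M = subst (0ℚ <_) (sym (∑-vectors-1 coin n)) (positive (ℕ.m^n>0 6 n))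
        where
        positive : ∀ {m} → 0 ℕ.< m → 0ℚ < ιℕ m
        positive {suc m} _ = 0<ιℕ m

      ∑-choices : ∀ f → ∑ W f ≡ ∑ (vectors coin n) (λ v → f (true , v)) + ∑ (vectors coin n) (λ v → f (false , v))
      ∑-choices f = trans (∑-product _,_ (true ∷ false ∷ []) (vectors coin n) f)
        (cong (∑ (vectors coin n) (λ v → f (true , v)) +_) (ℚ.+-identityʳ (∑ (vectors coin n) (λ v → f (false , v)))))

      ∑-flips : ∀ (ps : Vec (Bool → Bool) k) (t : Vec (Fin n) k) → IsInjective t →
        power coin k * ∑ W (λ w → ⟦ flips ps t w ⟧) ≡ M * counted coin ps
      ∑-flips {k = k} ps t inj = trans (cong (power coin k *_) (trans (∑-choices (λ w → ⟦ flips ps t w ⟧))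
        (trans (cong (∑ (vectors coin n) (λ f → ⟦ allAt ps t f ⟧) +_) (∑-0 (vectors coin n))) (ℚ.+-identityʳ (∑ (vectors coin n) (λ f → ⟦ allAt ps t f ⟧))))))
        (∑-independent coin ps t inj)

      ∑-passive : ∑ W (λ w → ⟦ passive w ⟧) ≡ M
      ∑-passive = trans (∑-choices (λ w → ⟦ passive w ⟧)) (trans (cong (_+ M) (∑-0 (vectors coin n))) (ℚ.+-identityˡ M))

      N≡2M : N ≡ M + M
      N≡2M = trans (sym (trans (∑-const W 1ℚ) (ℚ.*-identityʳ N))) (∑-choices (λ _ → 1ℚ))

      six : ιℕ 6 ≡ ℤ.+ 6 / 1
      six = ι-def (ℤ.+ 6)

      c₃₂ = ℤ.+ 32 / 1
      c₃₆ = ℤ.+ 36 / 1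
      c₂₁₆ = ℤ.+ 216 / 1
      c₅ = ℤ.+ 5 / 1
      c₂₅ = ℤ.+ 25 / 1
      c₁₂₅ = ℤ.+ 125 / 1
      c₃₁₂₅ = ℤ.+ 3125 / 1

      flips₂ : ∀ p q (x y : Fin n) → x ≢ y → c₃₆ * ∑ W (λ w → ⟦ flips (p ∷ q ∷ []) (x ∷ y ∷ []) w ⟧) ≡ M * counted coin (p ∷ q ∷ [])
      flips₂ p q x y x≢y = trans (cong (_* ∑ W (λ w → ⟦ flips (p ∷ q ∷ []) (x ∷ y ∷ []) w ⟧)) (sym (cong (λ z → z * (z * 1ℚ)) six))) (∑-flips (p ∷ q ∷ []) (x ∷ y ∷ []) inj)
        where
        inj : IsInjective (x ∷ y ∷ [])
        inj {zero} {zero} e = refl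
        inj {zero} {suc zero} e = contradiction e x≢y
        inj {suc zero} {zero} e = contradiction (sym e) x≢y
        inj {suc zero} {suc zero} e = refl

      flips₃ : ∀ p q r (x y z : Fin n) → IsInjective (x ∷ y ∷ z ∷ []) →
        c₂₁₆ * ∑ W (λ w → ⟦ flips (p ∷ q ∷ r ∷ []) (x ∷ y ∷ z ∷ []) w ⟧) ≡ M * counted coin (p ∷ q ∷ r ∷ [])
      flips₃ p q r x y z inj = trans (cong (_* ∑ W (λ w → ⟦ flips (p ∷ q ∷ r ∷ []) (x ∷ y ∷ z ∷ []) w ⟧)) (sym (cong (λ z → z * (z * (z * 1ℚ))) six))) (∑-flips (p ∷ q ∷ r ∷ []) (x ∷ y ∷ z ∷ []) inj)

      M⁵ = M * (M * (M * (M * M)))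

      0<M⁵ : 0ℚ < M⁵
      0<M⁵ = 0<* 0<M (0<* 0<M (0<* 0<M (0<* 0<M 0<M)))

      power-W : power W 5 ≡ c₃₂ * M⁵
      power-W = trans (cong (λ z → z * (z * (z * (z * (z * 1ℚ))))) N≡2M)
        (solve 1 (λ m → (m :+ m) :* ((m :+ m) :* ((m :+ m) :* ((m :+ m) :* ((m :+ m) :* con 1ℚ)))) := con c₃₂ :* (m :* (m :* (m :* (m :* m))))) refl M)
        where open +-*-Solver using (solve; con; _:=_; _:*_; _:+_)

    -- The probability is `(1/2)⁵ (5/6)⁵ (1/6)`: five sides, five edges and the one missing edge
    -- between the two sides. Clearing denominators gives `36³ = 6⁶`, `32 = 2⁵` and `3125 = 5⁵`. The
    -- other pattern has the same probability, with `6⁶` arising as `216²`.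
    ∑-pattern₁ : ∀ t → IsInjective t → (c₃₆ * (c₃₆ * c₃₆)) * (c₃₂ * ∑ (vectors W n) (λ s → ⟦ allAt (pattern₁ t) t s ⟧)) ≡ c₃₁₂₅ * Z
    ∑-pattern₁ t@(t₀ ∷ t₁ ∷ t₂ ∷ t₃ ∷ t₄ ∷ []) inj = *-cancelˡ-≡ M⁵ 0<M⁵ (begin
      M⁵ * ((c₃₆ * (c₃₆ * c₃₆)) * (c₃₂ * S))
        ≡⟨ solve 4 (λ m a b s → m :* (a :* (b :* s)) := a :* ((b :* m) :* s)) refl M⁵ (c₃₆ * (c₃₆ * c₃₆)) c₃₂ S ⟩
      (c₃₆ * (c₃₆ * c₃₆)) * ((c₃₂ * M⁵) * S)
        ≡⟨ cong (λ z → (c₃₆ * (c₃₆ * c₃₆)) * (z * S)) (sym power-W) ⟩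
      (c₃₆ * (c₃₆ * c₃₆)) * (power W 5 * S)
        ≡⟨ cong ((c₃₆ * (c₃₆ * c₃₆)) *_) (∑-independent W (pattern₁ t) t inj) ⟩
      (c₃₆ * (c₃₆ * c₃₆)) * (Z * (p * (h * (p * (h * (m * 1ℚ))))))
        ≡⟨ solve 5 (λ c z p h m → (c :* (c :* c)) :* (z :* (p :* (h :* (p :* (h :* (m :* con 1ℚ))))))
                   := z :* (p :* ((c :* h) :* (p :* ((c :* h) :* (c :* m)))))) refl c₃₆ Z p h m ⟩
      Z * (p * ((c₃₆ * h) * (p * ((c₃₆ * h) * (c₃₆ * m)))))
        ≡⟨ cong₂ (λ p y → Z * (p * (proj₁ y * (p * (proj₁ y * proj₂ y))))) ∑-passive
             (cong₂ _,_ (flips₂ id id t₀ t₂ t₀≢t₂) (flips₂ id not t₀ t₂ t₀≢t₂)) ⟩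
      Z * (M * ((M * c₂₅) * (M * ((M * c₂₅) * (M * c₅)))))
        ≡⟨ solve 2 (λ z m → z :* (m :* ((m :* con c₂₅) :* (m :* ((m :* con c₂₅) :* (m :* con c₅)))))
                   := (m :* (m :* (m :* (m :* m)))) :* (con c₃₁₂₅ :* z)) refl Z M ⟩
      M⁵ * (c₃₁₂₅ * Z) ∎)
      where
      open ≡-Reasoning
      open +-*-Solver using (solve; con; _:=_; _:*_; _:+_)
      S = ∑ (vectors W n) (λ s → ⟦ allAt (pattern₁ t) t s ⟧)
      p = ∑ W (λ w → ⟦ passive w ⟧)
      h = ∑ W (λ w → ⟦ flips (id ∷ id ∷ []) (t₀ ∷ t₂ ∷ []) w ⟧)
      m = ∑ W (λ w → ⟦ flips (id ∷ not ∷ []) (t₀ ∷ t₂ ∷ []) w ⟧)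
      t₀≢t₂ : t₀ ≢ t₂
      t₀≢t₂ e with () ← inj {zero} {suc (suc zero)} e

    ∑-pattern₂ : ∀ t → IsInjective t → (c₂₁₆ * c₂₁₆) * (c₃₂ * ∑ (vectors W n) (λ s → ⟦ allAt (pattern₂ t) t s ⟧)) ≡ c₃₁₂₅ * Z
    ∑-pattern₂ t@(t₀ ∷ t₁ ∷ t₂ ∷ t₃ ∷ t₄ ∷ []) inj = *-cancelˡ-≡ M⁵ 0<M⁵ (begin
      M⁵ * ((c₂₁₆ * c₂₁₆) * (c₃₂ * S))
        ≡⟨ solve 4 (λ m a b s → m :* (a :* (b :* s)) := a :* ((b :* m) :* s)) refl M⁵ (c₂₁₆ * c₂₁₆) c₃₂ S ⟩
      (c₂₁₆ * c₂₁₆) * ((c₃₂ * M⁵) * S)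
        ≡⟨ cong (λ z → (c₂₁₆ * c₂₁₆) * (z * S)) (sym power-W) ⟩
      (c₂₁₆ * c₂₁₆) * (power W 5 * S)
        ≡⟨ cong ((c₂₁₆ * c₂₁₆) *_) (∑-independent W (pattern₂ t) t inj) ⟩
      (c₂₁₆ * c₂₁₆) * (Z * (h * (p * (m * (p * (p * 1ℚ))))))
        ≡⟨ solve 5 (λ c z p h m → (c :* c) :* (z :* (h :* (p :* (m :* (p :* (p :* con 1ℚ))))))
                   := z :* ((c :* h) :* (p :* ((c :* m) :* (p :* p))))) refl c₂₁₆ Z p h m ⟩
      Z * ((c₂₁₆ * h) * (p * ((c₂₁₆ * m) * (p * p))))
        ≡⟨ cong₂ (λ p y → Z * (proj₁ y * (p * (proj₂ y * (p * p))))) ∑-passive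
             (cong₂ _,_ (flips₃ id id id t₁ t₃ t₄ inj₁₃₄) (flips₃ id id not t₁ t₃ t₄ inj₁₃₄)) ⟩
      Z * ((M * c₁₂₅) * (M * ((M * c₂₅) * (M * M))))
        ≡⟨ solve 2 (λ z m → z :* ((m :* con c₁₂₅) :* (m :* ((m :* con c₂₅) :* (m :* m))))
                   := (m :* (m :* (m :* (m :* m)))) :* (con c₃₁₂₅ :* z)) refl Z M ⟩
      M⁵ * (c₃₁₂₅ * Z) ∎)
      where
      open ≡-Reasoning
      open +-*-Solver using (solve; con; _:=_; _:*_; _:+_)
      S = ∑ (vectors W n) (λ s → ⟦ allAt (pattern₂ t) t s ⟧)
      p = ∑ W (λ w → ⟦ passive w ⟧)
      h = ∑ W (λ w → ⟦ flips (id ∷ id ∷ id ∷ []) (t₁ ∷ t₃ ∷ t₄ ∷ []) w ⟧)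
      m = ∑ W (λ w → ⟦ flips (id ∷ id ∷ not ∷ []) (t₁ ∷ t₃ ∷ t₄ ∷ []) w ⟧)
      inj₁₃₄ : IsInjective (t₁ ∷ t₃ ∷ t₄ ∷ [])
      inj₁₃₄ {x} {y} e = choose-injective x y (inj {choose x} {choose y} (trans (choose-lookup x) (trans e (sym (choose-lookup y)))))
        where
        choose : Fin 3 → Fin 5
        choose = lookup (suc zero ∷ suc (suc (suc zero)) ∷ suc (suc (suc (suc zero))) ∷ [])
        choose-lookup : ∀ x → lookup t (choose x) ≡ lookup (t₁ ∷ t₃ ∷ t₄ ∷ []) x
        choose-lookup zero = refl
        choose-lookup (suc zero) = refl
        choose-lookup (suc (suc zero)) = refl
        choose-injective : ∀ x y → choose x ≡ choose y → x ≡ y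
        choose-injective = from-yes (Fin.all? λ x → Fin.all? λ y → (choose x Fin.≟ choose y) →-dec (x Fin.≟ y))

    -- Two disjoint patterns of equal probability halve the factor `2⁵ 6⁶` to `2⁴ 6⁶ = 746496`.
    ∑-indicator-bits : ∀ t → IsInjective t →
      c₃₁₂₅ * Z ≤ ℤ.+ 746496 / 1 * ∑ (vectors W n) (λ s → ι (indicator ! bits (adjacent s) t))
    ∑-indicator-bits t inj = begin
      c₃₁₂₅ * Z
        ≡⟨ solve 1 (λ x → x := con ½ :* (x :+ x)) refl (c₃₁₂₅ * Z) ⟩
      ½ * (c₃₁₂₅ * Z + c₃₁₂₅ * Z)
        ≡⟨ cong₂ (λ x y → ½ * (x + y)) (sym (∑-pattern₁ t inj)) (sym (∑-pattern₂ t inj)) ⟩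
      ½ * ((c₃₆ * (c₃₆ * c₃₆)) * (c₃₂ * S₁) + (c₂₁₆ * c₂₁₆) * (c₃₂ * S₂))
        ≡⟨ solve 2 (λ x y → con ½ :* ((con c₃₆ :* (con c₃₆ :* con c₃₆)) :* (con c₃₂ :* x) :+ (con c₂₁₆ :* con c₂₁₆) :* (con c₃₂ :* y))
                   := con (ℤ.+ 746496 / 1) :* (x :+ y)) refl S₁ S₂ ⟩
      ℤ.+ 746496 / 1 * (S₁ + S₂)
        ≡⟨ cong (ℤ.+ 746496 / 1 *_) (∑-+ (vectors W n) _ _) ⟨
      ℤ.+ 746496 / 1 * ∑ (vectors W n) (λ s → ⟦ allAt (pattern₁ t) t s ⟧ + ⟦ allAt (pattern₂ t) t s ⟧)
        ≤⟨ *-monoˡ (ℤ.+ 746496 / 1) (ℚ.nonNegative⁻¹ _) (∑-mono (vectors W n) λ s → patterns≤indicator s t) ⟩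
      ℤ.+ 746496 / 1 * ∑ (vectors W n) (λ s → ι (indicator ! bits (adjacent s) t)) ∎
      where
      open ℚ.≤-Reasoning
      open +-*-Solver using (solve; con; _:=_; _:*_; _:+_)
      S₁ = ∑ (vectors W n) (λ s → ⟦ allAt (pattern₁ t) t s ⟧)
      S₂ = ∑ (vectors W n) (λ s → ⟦ allAt (pattern₂ t) t s ⟧)

-- Representatives of flags on three, four and five vertices.

module Representation where

  open import Data.Bool as Bool using (Bool; true; false)
  import Data.Bool.Properties as Bool
  open import Data.Fin as Fin using (Fin; zero; suc; #_)
  import Data.Fin.Properties as Fin
  open import Data.Fin.Subset as Subset using (Subset; _∈_; _∉_; ⊤; ⁅_⁆)
  import Data.Fin.Subset.Properties as Subset
  open import Data.List using (List; []; _∷_)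
  open import Data.List.Membership.Propositional using () renaming (_∈_ to _∈ᴸ_)
  import Data.List.Membership.Propositional.Properties as List
  import Data.List.Relation.Unary.Any as Any
  open import Data.Nat using (ℕ; zero; suc)
  open import Data.Product using (∃; _,_; proj₁; proj₂)
  open import Data.Vec as Vec using (Vec; []; _∷_; lookup)
  import Data.Vec.Properties as Vec
  open import Relation.Binary.PropositionalEquality hiding ([_])
  open import Relation.Nullary using (yes; no; contradiction)
  open import Relation.Nullary.Decidable using (from-yes; recompute; _→-dec_)
  open import Relation.Unary using (Decidable)
  open import Defs using (vectors; select; graphs; image; IsInjective; IsSimple; isSimple?; Graph; graph; entry; Flag; flag; _≅_; _≅_[_]; _≅_[_]?; Representatives; 𝟎; unlabelled)
  open Graph using (adj; table)
  open Flag using (underlying; roots; isEmbedding)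
  open Tuples
  open Isomorphism
  open Tables

  private variable
    k n q s : ℕ
    A : Set

  -- Simplicity of a graph is stored irrelevantly and recovered by decidability.

  adj-sym : (G : Graph n) → ∀ i j → adj G i j ≡ adj G j i
  adj-sym (graph t simple) i j = recompute (_ Bool.≟ _) (proj₁ simple i j)

  adj-irrefl : (G : Graph n) → ∀ i → adj G i i ≡ false
  adj-irrefl (graph t simple) i = recompute (_ Bool.≟ _) (proj₂ simple i)

  graph-≡ : {G H : Graph n} → table G ≡ table H → G ≡ H
  graph-≡ refl = refl

  graph-extensional : {G H : Graph n} → (∀ i j → adj G i j ≡ adj H i j) → G ≡ H
  graph-extensional e = graph-≡ (lookup-extensional λ i → lookup-extensional (e i))

  ∈-vectors : (xs : List A) → (∀ x → x ∈ᴸ xs) → (v : Vec A k) → v ∈ᴸ vectors xs k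
  ∈-vectors xs all []      = Any.here refl
  ∈-vectors xs all (x ∷ v) = List.∈-cartesianProductWith⁺ _∷_ (all x) (∈-vectors xs all v)

  ∈-select : {P : A → Set} (P? : Decidable P) {xs : List A} {x : A} → x ∈ᴸ xs → P x → ∃ λ p → (x , p) ∈ᴸ select P? xs
  ∈-select P? {y ∷ xs} (Any.here refl) p with P? y
  ... | yes p′ = p′ , Any.here refl
  ... | no ¬p  = contradiction p ¬p
  ∈-select P? {y ∷ xs} (Any.there x∈) p with P? y | ∈-select P? {xs} x∈ p
  ... | yes _ | p′ , i = p′ , Any.there i
  ... | no _  | p′ , i = p′ , i

  ∈-bools : ∀ b → b ∈ᴸ (true ∷ false ∷ [])
  ∈-bools true  = Any.here refl
  ∈-bools false = Any.there (Any.here refl)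

  ∈-graphs : (G : Graph n) → G ∈ᴸ graphs n
  ∈-graphs {n} (graph t simple) =
    List.∈-map⁺ (λ (t , t-simple) → graph t t-simple) (proj₂ (∈-select isSimple? (∈-vectors _ (∈-vectors _ ∈-bools) t) (recompute (isSimple? t) simple)))

  image-size : (φ : Vec (Fin n) k) → IsInjective φ → Subset.∣ image φ ∣ ≡ k
  image-size {n} []  inj = Subset.∣⊥∣≡0 n
  image-size (x ∷ φ) inj with injective-∷⁻ {x = x} {φ} inj
  ... | x∉ , inj′ = trans (size-∪ x (image φ) x∉) (cong suc (image-size φ inj′))

  image-⊤ : (φ : Vec (Fin n) n) → IsInjective φ → image φ ≡ ⊤
  image-⊤ φ inj = Subset.∣p∣≡n⇒p≡⊤ (image-size φ inj)

  -- Representatives of the isomorphism classes of the flags in a list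

  module _ {τ : Graph q} where

    record Classes (Hs : List (Flag τ s)) : Set where
      field
        size     : ℕ
        rep      : Fin size → Flag τ s
        separate : ∀ i j → rep i ≅ rep j → i ≡ j
        covers : ∀ {H} → H ∈ᴸ Hs → ∃ λ i → H ≅ rep i

    classes : (Hs : List (Flag τ s)) → Classes Hs
    classes []       = record { size = 0 ; rep = λ () ; separate = λ () ; covers = λ () }
    classes (H ∷ Hs) with classes Hs
    ... | record { size = size ; rep = rep ; separate = separate ; covers = covers }
      with Fin.any? (λ i → H ≅ rep i [ ⊤ ]?)
    ... | yes old = record { size = size ; rep = rep ; separate = separate ; covers = λ { (Any.here refl) → old ; (Any.there H∈) → covers H∈ } }
    ... | no ¬old = record
      { size     = suc size
      ; rep      = λ { zero → H ; (suc i) → rep i }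
      ; separate = λ { zero    zero    _   → refl
                     ; zero    (suc j) iso → contradiction (j , iso) ¬old
                     ; (suc i) zero    iso → contradiction (i , ≅-sym (rep i) H iso) ¬old
                     ; (suc i) (suc j) iso → cong suc (separate i j iso) }
      ; covers = λ { (Any.here refl) → zero , ≅-refl H
                     ; (Any.there H∈)  → let (i , iso) = covers H∈ in suc i , iso }
      }

  opaque

    -- Chosen greedily from all labelled graphs and then hidden: what is used later is only that
    -- every graph has exactly one representative, as all coefficients come from
    -- isomorphism-invariant tables.
    𝓕₀ : Representatives 𝟎 n
    𝓕₀ {n} = record
      { size     = Classes.size C
      ; rep      = Classes.rep C
      ; distinct = Classes.separate C
      ; complete = λ { (flag G [] e) → let (i , iso) = Classes.covers C (List.∈-map⁺ unlabelled (∈-graphs G)) in i , iso }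
      }
      where
      C : Classes (Data.List.map unlabelled (graphs n))
      C = classes (Data.List.map unlabelled (graphs n))

  -- One root and two further vertices: the root is the last vertex.

  private
    triangle-table : Bool → Bool → Bool → Vec (Vec Bool 3) 3
    triangle-table a b c = (false ∷ a ∷ b ∷ []) ∷ (a ∷ false ∷ c ∷ []) ∷ (b ∷ c ∷ false ∷ []) ∷ []

    triangle-simple : ∀ a b c → IsSimple (triangle-table a b c)
    triangle-simple true  true  true  = from-yes (isSimple? (triangle-table true true true))
    triangle-simple true  true  false = from-yes (isSimple? (triangle-table true true false))
    triangle-simple true  false true  = from-yes (isSimple? (triangle-table true false true))
    triangle-simple true  false false = from-yes (isSimple? (triangle-table true false false))
    triangle-simple false true  true  = from-yes (isSimple? (triangle-table false true true))
    triangle-simple false true  false = from-yes (isSimple? (triangle-table false true false))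
    triangle-simple false false true  = from-yes (isSimple? (triangle-table false false true))
    triangle-simple false false false = from-yes (isSimple? (triangle-table false false false))

  graph₃ : Bool → Bool → Bool → Graph 3
  graph₃ a b c = graph (triangle-table a b c) (triangle-simple a b c)

  adj-graph₃ : (G : Graph n) (u v w : Fin n) → ∀ i j →
    adj G (lookup (u ∷ v ∷ w ∷ []) i) (lookup (u ∷ v ∷ w ∷ []) j) ≡ adj (graph₃ (adj G u v) (adj G u w) (adj G v w)) i j
  adj-graph₃ G u v w zero             zero             = adj-irrefl G u
  adj-graph₃ G u v w zero             (suc zero)       = refl
  adj-graph₃ G u v w zero             (suc (suc zero)) = refl
  adj-graph₃ G u v w (suc zero)       zero             = adj-sym G v u
  adj-graph₃ G u v w (suc zero)       (suc zero)       = adj-irrefl G v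
  adj-graph₃ G u v w (suc zero)       (suc (suc zero)) = refl
  adj-graph₃ G u v w (suc (suc zero)) zero             = adj-sym G w u
  adj-graph₃ G u v w (suc (suc zero)) (suc zero)       = adj-sym G w v
  adj-graph₃ G u v w (suc (suc zero)) (suc (suc zero)) = adj-irrefl G w

  flagGraph₁ : Fin 6 → Graph 3
  flagGraph₁ = lookup
    ( graph₃ false false false ∷ graph₃ true false false
    ∷ graph₃ false true false  ∷ graph₃ true true false
    ∷ graph₃ false true true   ∷ graph₃ true true true ∷ [])

  module _ (τ : Graph 1) where

    rep₁ : Fin 6 → Flag τ 3
    rep₁ i = flag (flagGraph₁ i) (# 2 ∷ [])
      ( (λ { {zero} {zero} _ → refl })
      , (λ { zero zero → trans (adj-irrefl (flagGraph₁ i) (# 2)) (sym (adj-irrefl τ zero)) }))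

    private
      iso₁ : (K : Flag τ n) (u v w : Fin n) → IsInjective (u ∷ v ∷ w ∷ []) → roots K ≡ w ∷ [] → ∀ i →
             flagGraph₁ i ≡ graph₃ (adj (underlying K) u v) (adj (underlying K) u w) (adj (underlying K) v w) →
             rep₁ i ≅ K [ image (u ∷ v ∷ w ∷ []) ]
      iso₁ K u v w inj r i e = u ∷ v ∷ w ∷ [] ,
        ((λ {x} {y} → inj {x} {y}) , (λ x y → trans (adj-graph₃ (underlying K) u v w x y) (cong (λ H → adj H x y) (sym e)))) , refl , sym r

    -- Since `index₁` forgets the order of the two unlabelled vertices, two of the eight cases match
    -- their representative only after `u` and `v` are exchanged.
    classify₁ : (K : Flag τ n) (u v w : Fin n) → IsInjective (u ∷ v ∷ w ∷ []) → roots K ≡ w ∷ [] →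
      rep₁ (index₁ (adj (underlying K) u w) (adj (underlying K) v w) (adj (underlying K) u v)) ≅ K [ image (u ∷ v ∷ w ∷ []) ]
    classify₁ K u v w inj r = go _ _ _ refl refl refl
      where
      G = underlying K
      same : ∀ {a b c} → adj G u w ≡ a → adj G v w ≡ b → adj G u v ≡ c → ∀ i → flagGraph₁ i ≡ graph₃ c a b → rep₁ i ≅ K [ image (u ∷ v ∷ w ∷ []) ]
      same refl refl refl i e = iso₁ K u v w inj r i e
      swapped-inj : IsInjective (v ∷ u ∷ w ∷ [])
      swapped-inj {x} {y} e = swap-injective x y (inj {lookup swap x} {lookup swap y} (trans (at x) (trans e (sym (at y)))))
        where
        swap : Vec (Fin 3) 3
        swap = # 1 ∷ # 0 ∷ # 2 ∷ []
        at : ∀ x → lookup (u ∷ v ∷ w ∷ []) (lookup swap x) ≡ lookup (v ∷ u ∷ w ∷ []) x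
        at zero = refl
        at (suc zero) = refl
        at (suc (suc zero)) = refl
        swap-injective : ∀ x y → lookup swap x ≡ lookup swap y → x ≡ y
        swap-injective = from-yes (Fin.all? λ x → Fin.all? λ y → (lookup swap x Fin.≟ lookup swap y) →-dec (x Fin.≟ y))
      swapped : ∀ {a b c} → adj G u w ≡ a → adj G v w ≡ b → adj G u v ≡ c → ∀ i → flagGraph₁ i ≡ graph₃ c b a → rep₁ i ≅ K [ image (u ∷ v ∷ w ∷ []) ]
      swapped refl refl refl i e = subst (λ S → rep₁ i ≅ K [ S ]) (image-swap u v w)
        (iso₁ K v u w swapped-inj r i (trans e (cong (λ c → graph₃ c (adj G v w) (adj G u w)) (adj-sym G u v))))
        where
        image-swap : ∀ u v w → image (v ∷ u ∷ w ∷ []) ≡ image (u ∷ v ∷ w ∷ [])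
        image-swap u v w = trans (sym (Subset.∪-assoc ⁅ v ⁆ ⁅ u ⁆ _)) (trans (cong (Subset._∪ image (w ∷ [])) (Subset.∪-comm ⁅ v ⁆ ⁅ u ⁆)) (Subset.∪-assoc ⁅ u ⁆ ⁅ v ⁆ _))
      go : ∀ a b c → adj G u w ≡ a → adj G v w ≡ b → adj G u v ≡ c → rep₁ (index₁ a b c) ≅ K [ image (u ∷ v ∷ w ∷ []) ]
      go false false false d e f = same d e f (# 0) refl
      go false false true  d e f = same d e f (# 1) refl
      go false true  false d e f = swapped d e f (# 2) refl
      go false true  true  d e f = swapped d e f (# 3) refl
      go true  false false d e f = same d e f (# 2) refl
      go true  false true  d e f = same d e f (# 3) refl
      go true  true  false d e f = same d e f (# 4) refl
      go true  true  true  d e f = same d e f (# 5) refl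

    private
      others : ∀ (r : Fin 3) → ∃ λ u → ∃ λ v → IsInjective (u ∷ v ∷ r ∷ [])
      others zero = # 1 , # 2 , λ {x} {y} → from-yes (Fin.all? λ x → Fin.all? λ y → (lookup p x Fin.≟ lookup p y) →-dec (x Fin.≟ y)) x y
        where
        p : Vec (Fin 3) 3
        p = # 1 ∷ # 2 ∷ # 0 ∷ []
      others (suc zero) = # 0 , # 2 , λ {x} {y} → from-yes (Fin.all? λ x → Fin.all? λ y → (lookup p x Fin.≟ lookup p y) →-dec (x Fin.≟ y)) x y
        where
        p : Vec (Fin 3) 3
        p = # 0 ∷ # 2 ∷ # 1 ∷ []
      others (suc (suc zero)) = # 0 , # 1 , λ {x} {y} → from-yes (Fin.all? λ x → Fin.all? λ y → (lookup p x Fin.≟ lookup p y) →-dec (x Fin.≟ y)) x y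
        where
        p : Vec (Fin 3) 3
        p = # 0 ∷ # 1 ∷ # 2 ∷ []

    opaque

      rep₁-distinct : ∀ i j → rep₁ i ≅ rep₁ j → i ≡ j
      rep₁-distinct = from-yes (Fin.all? λ i → Fin.all? λ j → (rep₁ i ≅ rep₁ j [ ⊤ ]?) →-dec (i Fin.≟ j))

      rep₁-complete : ∀ H → ∃ λ i → H ≅ rep₁ i
      rep₁-complete H@(flag G (r ∷ []) e) = let (u , v , inj) = others r ; i = index₁ (adj G u r) (adj G v r) (adj G u v) in
        i , ≅-sym (rep₁ i) H (subst (λ S → rep₁ i ≅ H [ S ]) (image-⊤ (u ∷ v ∷ r ∷ []) inj) (classify₁ H u v r inj refl))

    𝓕₁ : Representatives τ 3
    𝓕₁ = record { size = 6 ; rep = rep₁ ; distinct = rep₁-distinct ; complete = rep₁-complete }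

  -- Three roots and one further vertex: the roots are the last vertices.

  extend : Graph q → Vec Bool q → Graph (suc q)
  extend (graph t simple) v = graph ((false ∷ v) ∷ Vec.zipWith _∷_ v t) (symmetric , irreflexive)
    where
    at : ∀ i j → lookup (lookup (Vec.zipWith _∷_ v t) i) j ≡ lookup (lookup v i ∷ lookup t i) j
    at i j = cong (λ row → lookup row j) (Vec.lookup-zipWith _∷_ i v t)
    symmetric : ∀ i j → entry ((false ∷ v) ∷ Vec.zipWith _∷_ v t) i j ≡ entry ((false ∷ v) ∷ Vec.zipWith _∷_ v t) j i
    symmetric zero    zero    = refl
    symmetric zero    (suc j) = sym (at j zero)
    symmetric (suc i) zero    = at i zero
    symmetric (suc i) (suc j) = trans (at i (suc j)) (trans (recompute (_ Bool.≟ _) (proj₁ simple i j)) (sym (at j (suc i))))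
    irreflexive : ∀ i → entry ((false ∷ v) ∷ Vec.zipWith _∷_ v t) i i ≡ false
    irreflexive zero    = refl
    irreflexive (suc i) = trans (at i (suc i)) (recompute (_ Bool.≟ _) (proj₂ simple i))

  adj-extend-suc : (G : Graph q) (v : Vec Bool q) → ∀ i j → adj (extend G v) (suc i) (suc j) ≡ adj G i j
  adj-extend-suc (graph t _) v i j = cong (λ row → lookup row (suc j)) (Vec.lookup-zipWith _∷_ i v t)

  bits₃ : Fin 8 → Vec Bool 3
  bits₃ = lookup
    ( (false ∷ false ∷ false ∷ []) ∷ (false ∷ false ∷ true ∷ []) ∷ (false ∷ true ∷ false ∷ []) ∷ (false ∷ true ∷ true ∷ [])
    ∷ (true  ∷ false ∷ false ∷ []) ∷ (true  ∷ false ∷ true ∷ []) ∷ (true  ∷ true ∷ false ∷ []) ∷ (true  ∷ true ∷ true ∷ []) ∷ [])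

  bits₃-index₃ : ∀ a b c → bits₃ (index₃ a b c) ≡ a ∷ b ∷ c ∷ []
  bits₃-index₃ false false false = refl
  bits₃-index₃ false false true  = refl
  bits₃-index₃ false true  false = refl
  bits₃-index₃ false true  true  = refl
  bits₃-index₃ true  false false = refl
  bits₃-index₃ true  false true  = refl
  bits₃-index₃ true  true  false = refl
  bits₃-index₃ true  true  true  = refl

  module _ (τ : Graph 3) where

    private
      ends : Vec (Fin 4) 3
      ends = # 1 ∷ # 2 ∷ # 3 ∷ []

      lookup-ends : ∀ i → lookup ends i ≡ suc i
      lookup-ends zero             = refl
      lookup-ends (suc zero)       = refl
      lookup-ends (suc (suc zero)) = refl

    rep₃ : Fin 8 → Flag τ 4
    rep₃ i = flag (extend τ (bits₃ i)) ends
      ( (λ {x} {y} e → Fin.suc-injective (trans (sym (lookup-ends x)) (trans e (lookup-ends y))))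
      , (λ x y → trans (cong₂ (adj (extend τ (bits₃ i))) (lookup-ends x) (lookup-ends y)) (adj-extend-suc τ (bits₃ i) x y)))

    classify₃ : (K : Flag τ n) (x a b c : Fin n) → IsInjective (x ∷ a ∷ b ∷ c ∷ []) → roots K ≡ a ∷ b ∷ c ∷ [] →
      rep₃ (index₃ (adj (underlying K) x a) (adj (underlying K) x b) (adj (underlying K) x c)) ≅ K [ image (x ∷ a ∷ b ∷ c ∷ []) ]
    classify₃ K x a b c inj r = x ∷ a ∷ b ∷ c ∷ [] , ((λ {y} {z} → inj {y} {z}) , matches) , refl , sym r
      where
      G = underlying K
      v = bits₃ (index₃ (adj G x a) (adj G x b) (adj G x c))
      first : ∀ i → adj G x (lookup (a ∷ b ∷ c ∷ []) i) ≡ lookup v i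
      first i = trans (row i) (cong (λ v → lookup v i) (sym (bits₃-index₃ (adj G x a) (adj G x b) (adj G x c))))
        where
        row : ∀ i → adj G x (lookup (a ∷ b ∷ c ∷ []) i) ≡ lookup (adj G x a ∷ adj G x b ∷ adj G x c ∷ []) i
        row zero             = refl
        row (suc zero)       = refl
        row (suc (suc zero)) = refl
      matches : ∀ i j → adj G (lookup (x ∷ a ∷ b ∷ c ∷ []) i) (lookup (x ∷ a ∷ b ∷ c ∷ []) j) ≡ adj (extend τ v) i j
      matches zero    zero    = adj-irrefl G x
      matches zero    (suc j) = first j
      matches (suc i) zero    = trans (adj-sym G _ x) (trans (first i) (sym (adj-sym (extend τ v) (suc i) zero)))
      matches (suc i) (suc j) = trans (subst (λ r → adj G (lookup r i) (lookup r j) ≡ adj τ i j) r (proj₂ (isEmbedding K) i j)) (sym (adj-extend-suc τ v i j))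

    private
      bits₃-injective : ∀ i j → bits₃ i ≡ bits₃ j → i ≡ j
      bits₃-injective = from-yes (Fin.all? λ i → Fin.all? λ j → Vec.≡-dec Bool._≟_ (bits₃ i) (bits₃ j) →-dec (i Fin.≟ j))

      outside : ∀ (a b c : Fin 4) → ∃ λ x → x ∉ image (a ∷ b ∷ c ∷ [])
      outside = from-yes (Fin.all? {4} λ a → Fin.all? {4} λ b → Fin.all? {4} λ c → Fin.any? {4} λ x → x ∉? image (a ∷ b ∷ c ∷ []))

    opaque

      -- An isomorphism fixes the three roots, hence also the remaining vertex, and so preserves the
      -- three bits that define the flag.
      rep₃-distinct : ∀ i j → rep₃ i ≅ rep₃ j → i ≡ j
      rep₃-distinct i j (φ , (inj , e) , _ , r) = bits₃-injective i j (lookup-extensional λ k →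
        trans (sym (e zero (suc k))) (cong₂ (adj (extend τ (bits₃ j))) φ-zero (φ-suc k)))
        where
        φ-suc : ∀ k → lookup φ (suc k) ≡ suc k
        φ-suc k = trans (cong (lookup φ) (sym (lookup-ends k))) (trans (sym (Vec.lookup-map k (lookup φ) ends))
          (trans (cong (λ v → lookup v k) r) (lookup-ends k)))
        φ-zero : lookup φ zero ≡ zero
        φ-zero with lookup φ zero in e₀
        ... | zero  = refl
        ... | suc k with () ← inj {zero} {suc k} (trans e₀ (sym (φ-suc k)))

      rep₃-complete : ∀ H → ∃ λ i → H ≅ rep₃ i
      rep₃-complete H@(flag G (a ∷ b ∷ c ∷ []) e) = i ,
        ≅-sym (rep₃ i) H (subst (λ S → rep₃ i ≅ H [ S ]) (image-⊤ (x ∷ a ∷ b ∷ c ∷ []) inj) (classify₃ H x a b c inj refl))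
        where
        x : Fin 4
        x = proj₁ (outside a b c)
        i : Fin 8
        i = index₃ (adj G x a) (adj G x b) (adj G x c)
        inj : IsInjective (x ∷ a ∷ b ∷ c ∷ [])
        inj = injective-∷⁺ {x = x} {a ∷ b ∷ c ∷ []} (proj₂ (outside a b c)) (proj₁ e)

    𝓕₃ : Representatives τ 4
    𝓕₃ = record { size = 8 ; rep = rep₃ ; distinct = rep₃-distinct ; complete = rep₃-complete }

-- Quadratic forms and five-vertex counts as sums over tuples.

module FiveVertices where

  open import Data.Bool using (Bool; true; false)
  open import Data.Fin as Fin using (Fin; zero; suc; #_)
  import Data.Fin.Properties as Fin
  open import Data.Fin.Subset using (⊤)
  open import Data.Integer as ℤ using (ℤ)
  open import Data.List using (List; []; _∷_; allFin)
  open import Data.List.Membership.Propositional using () renaming (_∈_ to _∈ᴸ_)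
  import Data.List.Relation.Unary.Any as Any
  open import Data.Nat as ℕ using (ℕ; zero; suc; _!)
  import Data.Nat.Properties as ℕ
  open import Data.Nat.Combinatorics using (_C_)
  open import Data.Product using (∃; _×_; _,_; proj₁; proj₂)
  open import Data.Sum as Sum using (_⊎_; inj₁; inj₂)
  open import Data.Rational using (ℚ; 0ℚ; 1ℚ; _+_; _*_; _-_; -_; _≤_; ∣_∣)
  import Data.Rational.Properties as ℚ
  open import Data.Rational.Solver using (module +-*-Solver)
  open import Data.Vec using (Vec; []; _∷_; lookup; _++_)
  open import Function using (_∘_; mk⇔)
  open import Relation.Binary.PropositionalEquality hiding ([_])
  open import Relation.Nullary using (Dec; does; yes; no; contradiction)
  open import Relation.Nullary.Decidable using (does-⇔; from-yes)
  open import Defs using (vectors; image; IsInjective; Graph; Flag; P; _≅_; _≅_[_]; _≅_[_]?; Representatives; 𝟎; unlabelled; inducedType; entry-tabulate; density; C₄-pendant)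
  open Graph using (adj)
  open Flag using (underlying; roots)
  open Representatives using (size; rep)
  open Sums
  open Tuples
  open Isomorphism
  open Tables
  open Evaluation
  open Symmetrization
  open Representation

  private variable
    k n q s : ℕ
    A B : Set

  -- Quadratic forms in flag counts are sums over pairs of tuples.

  -- The form is opaque, since unfolding it at an explicit R is costly.
  opaque

    quadraticForm : {τ : Graph q} (R : Representatives τ s) (K : Flag τ n) (w : Fin (size R) → Fin (size R) → ℚ) → ℚ
    quadraticForm R K w = ∑ (allFin (size R)) λ i → ιℕ (P (rep R i) K) * ∑ (allFin (size R)) λ j → w i j * ιℕ (P (rep R j) K)

    quadraticForm-def : {τ : Graph q} (R : Representatives τ s) (K : Flag τ n) (w : Fin (size R) → Fin (size R) → ℚ) →
      quadraticForm R K w ≡ ∑ (allFin (size R)) λ i → ιℕ (P (rep R i) K) * ∑ (allFin (size R)) λ j → w i j * ιℕ (P (rep R j) K)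
    quadraticForm-def R K w = refl

  module _ {τ : Graph q} (R : Representatives τ s) (K : Flag τ n) (w : Fin (size R) → Fin (size R) → ℚ)
           (class : Vec (Fin n) (s ℕ.∸ q) → Fin (size R))
           (classify : ∀ t → IsInjective (t ++ roots K) → rep R (class t) ≅ K [ image (t ++ roots K) ]) where

    private
      I = allFin (size R)
      T = vectors (allFin n) (s ℕ.∸ q)
      f = ιℕ ((s ℕ.∸ q) !)
      V : Fin (size R) → ℚ
      V i = ιℕ (P (rep R i) K)

    -- `∑-classes` is applied once to each of the two vectors of counts, each time at the cost of
    -- one factorial `f`.
    ∑-quadratic : (f * f) * quadraticForm R K w ≡
      ∑ T λ t → ∑ T λ t′ → (distinct (t ++ roots K) * distinct (t′ ++ roots K)) * w (class t) (class t′)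
    ∑-quadratic = begin
      (f * f) * quadraticForm R K w
        ≡⟨ cong ((f * f) *_) (quadraticForm-def R K w) ⟩
      (f * f) * ∑ I (λ i → V i * g i)
        ≡⟨ trans (ℚ.*-assoc f f _) (cong (λ z → f * (f * z)) (∑-cong I λ i → ℚ.*-comm (V i) (g i))) ⟩
      f * (f * ∑ I (λ i → g i * V i))
        ≡⟨ cong (f *_) (∑-classes R K g (g ∘ class) (λ t inj → class t , classify t inj , refl)) ⟩
      f * ∑ T (λ t → distinct (t ++ roots K) * g (class t))
        ≡⟨ trans (sym (∑-*ˡ T f _)) (∑-cong T λ t → swap f (distinct (t ++ roots K)) (g (class t))) ⟩
      ∑ T (λ t → distinct (t ++ roots K) * (f * g (class t)))
        ≡⟨ ∑-cong T (λ t → cong (distinct (t ++ roots K) *_) (∑-classes R K (w (class t)) (w (class t) ∘ class) (λ t inj → class t , classify t inj , refl))) ⟩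
      ∑ T (λ t → distinct (t ++ roots K) * ∑ T λ t′ → distinct (t′ ++ roots K) * w (class t) (class t′))
        ≡⟨ ∑-cong T (λ t → trans (sym (∑-*ˡ T (distinct (t ++ roots K)) _))
             (∑-cong T λ t′ → sym (ℚ.*-assoc (distinct (t ++ roots K)) (distinct (t′ ++ roots K)) (w (class t) (class t′))))) ⟩
      ∑ T (λ t → ∑ T λ t′ → (distinct (t ++ roots K) * distinct (t′ ++ roots K)) * w (class t) (class t′)) ∎
      where
      open ≡-Reasoning
      open +-*-Solver using (solve; _:=_; _:*_)
      g : Fin (size R) → ℚ
      g i = ∑ I λ j → w i j * V j
      swap : ∀ a b c → a * (b * c) ≡ b * (a * c)
      swap = solve 3 (λ a b c → a :* (b :* c) := b :* (a :* c)) refl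

  -- Graphs on five vertices and their adjacency bits

  bits-cong : (a : A → A → Bool) (b : B → B → Bool) (φ : Vec A 5) (ψ : Vec B 5) →
    (∀ i j → a (lookup φ i) (lookup φ j) ≡ b (lookup ψ i) (lookup ψ j)) → bits a φ ≡ bits b ψ
  bits-cong a b (_ ∷ _ ∷ _ ∷ _ ∷ _ ∷ []) (_ ∷ _ ∷ _ ∷ _ ∷ _ ∷ []) e =
    cong₂ _∷_ (e (# 0) (# 1)) (cong₂ _∷_ (e (# 0) (# 2)) (cong₂ _∷_ (e (# 0) (# 3)) (cong₂ _∷_ (e (# 0) (# 4))
    (cong₂ _∷_ (e (# 1) (# 2)) (cong₂ _∷_ (e (# 1) (# 3)) (cong₂ _∷_ (e (# 1) (# 4))
    (cong₂ _∷_ (e (# 2) (# 3)) (cong₂ _∷_ (e (# 2) (# 4)) (cong₂ _∷_ (e (# 3) (# 4)) refl)))))))))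

  fromBits-bits : (a : A → A → Bool) → (∀ x y → a x y ≡ a y x) → (∀ x → a x x ≡ false) →
    ∀ t i j → fromBits (bits a t) i j ≡ a (lookup t i) (lookup t j)
  fromBits-bits a s r (u ∷ v ∷ w ∷ x ∷ y ∷ []) = λ where
    zero zero → sym (r u)
    zero (suc zero) → refl
    zero (suc (suc zero)) → refl
    zero (suc (suc (suc zero))) → refl
    zero (suc (suc (suc (suc zero)))) → refl
    (suc zero) zero → s u v
    (suc zero) (suc zero) → sym (r v)
    (suc zero) (suc (suc zero)) → refl
    (suc zero) (suc (suc (suc zero))) → refl
    (suc zero) (suc (suc (suc (suc zero)))) → refl
    (suc (suc zero)) zero → s u w
    (suc (suc zero)) (suc zero) → s v w
    (suc (suc zero)) (suc (suc zero)) → sym (r w)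
    (suc (suc zero)) (suc (suc (suc zero))) → refl
    (suc (suc zero)) (suc (suc (suc (suc zero)))) → refl
    (suc (suc (suc zero))) zero → s u x
    (suc (suc (suc zero))) (suc zero) → s v x
    (suc (suc (suc zero))) (suc (suc zero)) → s w x
    (suc (suc (suc zero))) (suc (suc (suc zero))) → sym (r x)
    (suc (suc (suc zero))) (suc (suc (suc (suc zero)))) → refl
    (suc (suc (suc (suc zero)))) zero → s u y
    (suc (suc (suc (suc zero)))) (suc zero) → s v y
    (suc (suc (suc (suc zero)))) (suc (suc zero)) → s w y
    (suc (suc (suc (suc zero)))) (suc (suc (suc zero))) → s x y
    (suc (suc (suc (suc zero)))) (suc (suc (suc (suc zero)))) → sym (r y)

  bitsOf : Graph 5 → Vec Bool 10
  bitsOf H = bits (adj H) increasing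

  lookup-increasing : ∀ i → lookup increasing i ≡ i
  lookup-increasing = from-yes (Fin.all? λ i → lookup increasing i Fin.≟ i)

  fromBits-bitsOf : ∀ H i j → fromBits (bitsOf H) i j ≡ adj H i j
  fromBits-bitsOf H i j = trans (fromBits-bits (adj H) (adj-sym H) (adj-irrefl H) increasing i j) (cong₂ (adj H) (lookup-increasing i) (lookup-increasing j))

  act-bitsOf : ∀ H φ → act φ (bitsOf H) ≡ bits (adj H) φ
  act-bitsOf H φ = bits-cong (fromBits (bitsOf H)) (adj H) φ φ λ i j → fromBits-bitsOf H (lookup φ i) (lookup φ j)

  -- An isomorphism of graphs on five vertices is a permutation, and it acts on the bits; thus a
  -- swap-invariant table is a graph invariant.
  isomorphic-entries : ∀ (T : Table ℤ 10) → isSwapInvariant T ≡ true → (H H′ : Flag 𝟎 5) → H ≅ H′ →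
                       T ! bitsOf (underlying H) ≡ T ! bitsOf (underlying H′)
  isomorphic-entries T inv H H′ (φ , (inj , e) , _) = trans
    (cong (T !_) (trans (sym (bits-cong (adj (underlying H′)) (adj (underlying H)) φ increasing λ i j → trans (e i j) (sym (cong₂ (adj (underlying H)) (lookup-increasing i) (lookup-increasing j)))))
                        (sym (act-bitsOf (underlying H′) φ))))
    (act-invariant T inv (bitsOf (underlying H′)) φ inj)

  private
    twice-indicator : {P : Set} (z : ℤ) (p? : Dec P) → z ≡ ℤ.+ 0 ⊎ z ≡ ℤ.+ 2 × P → (P → z ≡ ℤ.+ 2) → ι z ≡ ιℕ 2 * ⟦ does p? ⟧
    twice-indicator z (yes p) _               f = trans (cong ι (f p)) (sym (ℚ.*-identityʳ (ιℕ 2)))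
    twice-indicator z (no ¬p) (inj₁ e)        f = trans (trans (cong ι e) ι-0) (sym (ℚ.*-zeroʳ (ιℕ 2)))
    twice-indicator z (no ¬p) (inj₂ (_ , p)) f = contradiction p ¬p

  -- A non-zero entry carries a permutation, which is the isomorphism; conversely, invariance
  -- transports the entry 2 from the pattern to every copy of it.
  C₄-pendant≅ : ∀ H → ι (embeddings ! bitsOf H) ≡ ιℕ 2 * ⟦ does (unlabelled C₄-pendant ≅ unlabelled H [ ⊤ ]?) ⟧
  C₄-pendant≅ H = twice-indicator (embeddings ! bitsOf H) (unlabelled C₄-pendant ≅ unlabelled H [ ⊤ ]?)
    (Sum.map₂ (λ (e , φ , inj , f) → e , isomorphism φ inj f) (embeddings-values (bitsOf H)))
    (λ iso → trans (sym (isomorphic-entries embeddings embeddings-invariance-checked (unlabelled C₄-pendant) (unlabelled H) iso)) embeddings-C₄-pendant)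
    where
    isomorphism : ∀ φ → IsInjective φ → act φ (bitsOf H) ≡ C₄-pendant-bits → unlabelled C₄-pendant ≅ unlabelled H
    isomorphism φ inj e = φ , ((λ {x} {y} → inj {x} {y}) , matches) , image-⊤ φ inj , refl
      where
      matches : ∀ i j → adj H (lookup φ i) (lookup φ j) ≡ adj C₄-pendant i j
      matches i j = trans (sym (fromBits-bits (adj H) (adj-sym H) (adj-irrefl H) φ i j))
        (trans (cong (λ b → fromBits b i j) (trans (sym (act-bitsOf H φ)) e)) (fromBits-bitsOf C₄-pendant i j))

  module _ (G : Graph n) (t : Vec (Fin n) 5) (inj : IsInjective t) where

    private
      H : Graph 5
      H = inducedType G (t , λ {x} {y} → inj {x} {y})

      adj-H : ∀ i j → adj H i j ≡ adj G (lookup t i) (lookup t j)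
      adj-H = entry-tabulate λ i j → adj G (lookup t i) (lookup t j)

      H≅ : unlabelled H ≅ unlabelled G [ image t ]
      H≅ = t , ((λ {x} {y} → inj {x} {y}) , λ i j → sym (adj-H i j)) , refl , refl

      bitsOf-H : bitsOf H ≡ bits (adj G) t
      bitsOf-H = bits-cong (adj H) (adj G) increasing t λ i j → trans (adj-H (lookup increasing i) (lookup increasing j)) (cong₂ (λ i j → adj G (lookup t i) (lookup t j)) (lookup-increasing i) (lookup-increasing j))

    -- One representative serves every invariant table, so the same classification applies to
    -- `embeddings` and to `slack`.
    classify₀ : ∃ λ i → rep 𝓕₀ i ≅ unlabelled G [ image t ] ×
      (∀ T → isSwapInvariant T ≡ true → T ! bitsOf (underlying (rep 𝓕₀ i)) ≡ T ! bits (adj G) t)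
    classify₀ = i , ≅-trans (rep 𝓕₀ i) (unlabelled H) (unlabelled G) iso H≅ ,
      λ T inv → trans (isomorphic-entries T inv (rep 𝓕₀ i) (unlabelled H) iso) (cong (T !_) bitsOf-H)
      where
      i = proj₁ (Representatives.complete 𝓕₀ (unlabelled H))
      iso : rep 𝓕₀ i ≅ unlabelled H
      iso = ≅-sym (unlabelled H) (rep 𝓕₀ i) (proj₂ (Representatives.complete 𝓕₀ (unlabelled H)))

    C₄-pendant-tuple : ιℕ 2 * ⟦ does (unlabelled C₄-pendant ≅ unlabelled G [ image t ]?) ⟧ ≡ ι (embeddings ! bits (adj G) t)
    C₄-pendant-tuple = trans (cong (λ b → ιℕ 2 * ⟦ b ⟧) (does-⇔
        (mk⇔ (λ iso → ≅-join (unlabelled C₄-pendant) (unlabelled H) (unlabelled G) iso H≅)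
             (λ iso → ≅-trans (unlabelled C₄-pendant) (unlabelled H) (unlabelled G) iso H≅))
        (unlabelled C₄-pendant ≅ unlabelled G [ image t ]?) (unlabelled C₄-pendant ≅ unlabelled H [ ⊤ ]?)))
      (trans (sym (C₄-pendant≅ H)) (cong (λ b → ι (embeddings ! b)) bitsOf-H))

  ++[] : (t : Vec (Fin n) 5) → t ++ [] ≡ t
  ++[] (a ∷ b ∷ c ∷ d ∷ e ∷ []) = refl

  private
    factor : ∀ (G : Graph n) (h : Vec (Fin n) 5 → ℚ) → ∑ (vectors (allFin n) 5) (λ t → distinct (t ++ []) * h t) ≡ ∑ (vectors (allFin n) 5) (λ t → distinct t * h t)
    factor {n} G h = ∑-cong (vectors (allFin n) 5) λ t → cong (λ φ → distinct φ * h t) (++[] t)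

  copies-C₄-pendant : (G : Graph n) → ιℕ 240 * ιℕ (P (unlabelled C₄-pendant) (unlabelled G)) ≡
                      ∑-injective (adj G) (adj-sym G) (λ b → ι (embeddings ! b))
  copies-C₄-pendant {n} G = begin
    ιℕ 240 * p
      ≡⟨ trans (cong (_* p) (ιℕ-* 2 120)) (ℚ.*-assoc (ιℕ 2) (ιℕ 120) p) ⟩
    ιℕ 2 * (ιℕ (5 !) * p)
      ≡⟨ cong (ιℕ 2 *_) (P-tuples (unlabelled C₄-pendant) (unlabelled G)) ⟩
    ιℕ 2 * ∑ T (λ t → distinct (t ++ []) * ⟦ does (unlabelled C₄-pendant ≅ unlabelled G [ image (t ++ []) ]?) ⟧)
      ≡⟨ trans (sym (∑-*ˡ T (ιℕ 2) _)) (∑-cong T each) ⟩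
    ∑ T (λ t → distinct t * ι (embeddings ! bits (adj G) t)) ∎
    where
    open ≡-Reasoning
    open +-*-Solver using (solve; _:=_; _:*_)
    T = vectors (allFin n) 5
    p = ιℕ (P (unlabelled C₄-pendant) (unlabelled G))
    each : ∀ t → ιℕ 2 * (distinct (t ++ []) * ⟦ does (unlabelled C₄-pendant ≅ unlabelled G [ image (t ++ []) ]?) ⟧) ≡
                 distinct t * ι (embeddings ! bits (adj G) t)
    each t = trans
      (cong (λ φ → ιℕ 2 * (distinct φ * ⟦ does (unlabelled C₄-pendant ≅ unlabelled G [ image φ ]?) ⟧)) (++[] t))
      (trans (solve 3 (λ a b c → a :* (b :* c) := b :* (a :* c)) refl (ιℕ 2) (distinct t) ⟦ does (unlabelled C₄-pendant ≅ unlabelled G [ image t ]?) ⟧)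
             (distinct-*-cong t (C₄-pendant-tuple G t)))

  private
    copies-constant : (G : Graph n) (c : ℚ) → (∀ t → IsInjective t → ι (embeddings ! bits (adj G) t) ≡ c) →
                      ιℕ 240 * ιℕ (P (unlabelled C₄-pendant) (unlabelled G)) ≡ (ιℕ 120 * ιℕ (n C 5)) * c
    copies-constant {n} G c e = trans (copies-C₄-pendant G)
      (trans (∑-cong (vectors (allFin n) 5) λ t → distinct-*-cong t (e t))
      (trans (∑-*ʳ (vectors (allFin n) 5) distinct c) (cong (_* c) (∑-distinct {n} 5))))

  -- For a graph on exactly five vertices all 120 injective tuples contribute the same invariant
  -- entry, and there is a single 5-subset.
  density-C₄-pendant : ∀ H → ιℕ 2 * density C₄-pendant H ℕ.≤-refl ≡ ι (embeddings ! bitsOf H)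
  density-C₄-pendant H = *-cancelˡ-≡ (ιℕ 120) (0<ιℕ 119) (begin
    ιℕ 120 * (ιℕ 2 * density C₄-pendant H ℕ.≤-refl)
      ≡⟨ cong (λ z → ιℕ 120 * (ιℕ 2 * z)) (sym (ι-def (ℤ.+ p))) ⟩
    ιℕ 120 * (ιℕ 2 * ιℕ p)
      ≡⟨ trans (sym (ℚ.*-assoc (ιℕ 120) (ιℕ 2) (ιℕ p))) (cong (_* ιℕ p) (sym (ιℕ-* 120 2))) ⟩
    ιℕ 240 * ιℕ p
      ≡⟨ copies-constant H (ι (embeddings ! bitsOf H)) (λ t inj → cong ι (trans (cong (embeddings !_) (sym (act-bitsOf H t)))
           (act-invariant embeddings embeddings-invariance-checked (bitsOf H) t inj))) ⟩
    (ιℕ 120 * ιℕ 1) * ι (embeddings ! bitsOf H)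
      ≡⟨ cong (_* ι (embeddings ! bitsOf H)) (trans (cong (ιℕ 120 *_) ι-1) (ℚ.*-identityʳ (ιℕ 120))) ⟩
    ιℕ 120 * ι (embeddings ! bitsOf H) ∎)
    where
    open ≡-Reasoning
    p = P (unlabelled C₄-pendant) (unlabelled H)

  ∑-classes₀ : (G : Graph n) (w : Fin (size (𝓕₀ {5})) → ℚ) (T : Table ℤ 10) (f : ℤ → ℚ) → isSwapInvariant T ≡ true →
    (∀ i → w i ≡ f (T ! bitsOf (underlying (rep 𝓕₀ i)))) →
    ιℕ 120 * ∑ (allFin (size 𝓕₀)) (λ i → w i * ιℕ (P (rep 𝓕₀ i) (unlabelled G))) ≡ ∑-injective (adj G) (adj-sym G) (λ b → f (T ! b))
  ∑-classes₀ G w T f inv e = trans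
    (∑-classes 𝓕₀ (unlabelled G) w (λ t → f (T ! bits (adj G) t)) classify)
    (factor G (λ t → f (T ! bits (adj G) t)))
    where
    classify : ∀ t → IsInjective (t ++ []) → ∃ λ i → rep 𝓕₀ i ≅ unlabelled G [ image (t ++ []) ] × w i ≡ f (T ! bits (adj G) t)
    classify t inj rewrite ++[] t = let (i , iso , same) = classify₀ G t inj in i , iso , trans (e i) (cong f (same T inv))

  -- Tuples with a repeated entry contribute O(n⁴).

  ∈⇒≤∑ : (xs : List A) (f : A → ℚ) → (∀ x → 0ℚ ≤ f x) → ∀ {x} → x ∈ᴸ xs → f x ≤ ∑ xs f
  ∈⇒≤∑ (x ∷ xs) f 0≤f (Any.here refl) = ℚ.≤-trans (ℚ.≤-reflexive (sym (ℚ.+-identityʳ (f x)))) (ℚ.+-monoʳ-≤ (f x) (∑-nonNeg xs 0≤f))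
  ∈⇒≤∑ (y ∷ xs) f 0≤f (Any.there x∈) = ℚ.≤-trans (∈⇒≤∑ xs f 0≤f x∈) (ℚ.≤-trans (ℚ.≤-reflexive (sym (ℚ.+-identityˡ (∑ xs f)))) (ℚ.+-monoˡ-≤ (∑ xs f) (0≤f y)))

  opaque

    -- A crude bound for `∣ h ∣`, namely a sum over all bit patterns; what matters is that it does
    -- not depend on any graph.
    bound : (Vec Bool k → ℚ) → ℚ
    bound {k} h = ∑ (vectors (true ∷ false ∷ []) k) λ b → ∣ h b ∣

    0≤bound : (h : Vec Bool k → ℚ) → 0ℚ ≤ bound h
    0≤bound {k} h = ∑-nonNeg (vectors (true ∷ false ∷ []) k) (λ b → 0≤∣∣ (h b))

    ≤bound : (h : Vec Bool k → ℚ) → ∀ b → ∣ h b ∣ ≤ bound h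
    ≤bound {k} h b = ∈⇒≤∑ (vectors (true ∷ false ∷ []) k) (λ b → ∣ h b ∣) (λ b → 0≤∣∣ (h b)) (∈-vectors (true ∷ false ∷ []) ∈-bools b)

  -- The weight `W` can differ from `distinct` only at tuples with a repeated entry, and there by at
  -- most 1.
  noise : (G : Graph n) (W : Vec (Fin n) 5 → ℚ) (h : Vec Bool 10 → ℚ) →
    (∀ t → 0ℚ ≤ W t) → (∀ t → W t ≤ 1ℚ) → (∀ t → IsInjective t → W t ≡ 1ℚ) →
    ∣ ∑ (vectors (allFin n) 5) (λ t → (distinct t - W t) * h (bits (adj G) t)) ∣ ≤ bound h * ιℕ (10 ℕ.* n ℕ.^ 4)
  noise {n} G W h 0≤W W≤1 W-injective = begin
    ∣ ∑ T (λ t → (distinct t - W t) * h (bits (adj G) t)) ∣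
      ≤⟨ ∑-abs T _ ⟩
    ∑ T (λ t → ∣ (distinct t - W t) * h (bits (adj G) t) ∣)
      ≤⟨ ∑-mono T each ⟩
    ∑ T (λ t → bound h * (1ℚ - distinct t))
      ≡⟨ ∑-*ˡ T (bound h) _ ⟩
    bound h * ∑ T (λ t → 1ℚ - distinct t)
      ≤⟨ *-monoˡ (bound h) (0≤bound h) (∑-repeated {n} 4) ⟩
    bound h * ιℕ (10 ℕ.* n ℕ.^ 4) ∎
    where
    open ℚ.≤-Reasoning
    T = vectors (allFin n) 5
    gap : ∀ t → ∣ distinct t - W t ∣ ≤ 1ℚ - distinct t
    gap t with distinct-cases t
    ... | inj₁ inj rewrite distinct-yes t inj | W-injective t inj = ℚ.≤-refl
    ... | inj₂ d≡0 rewrite d≡0 = ℚ.≤-trans (ℚ.≤-reflexive (trans (cong ∣_∣ (ℚ.+-identityˡ (- W t))) (trans (ℚ.∣-p∣≡∣p∣ (W t)) (ℚ.0≤p⇒∣p∣≡p (0≤W t))))) (W≤1 t)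
    each : ∀ t → ∣ (distinct t - W t) * h (bits (adj G) t) ∣ ≤ bound h * (1ℚ - distinct t)
    each t = begin
      ∣ (distinct t - W t) * h (bits (adj G) t) ∣
        ≡⟨ ℚ.∣p*q∣≡∣p∣*∣q∣ (distinct t - W t) (h (bits (adj G) t)) ⟩
      ∣ distinct t - W t ∣ * ∣ h (bits (adj G) t) ∣
        ≤⟨ *-mono (0≤∣∣ (distinct t - W t)) (ℚ.≤-trans (0≤∣∣ (h (bits (adj G) t))) (≤bound h (bits (adj G) t))) (gap t) (≤bound h (bits (adj G) t)) ⟩
      (1ℚ - distinct t) * bound h
        ≡⟨ ℚ.*-comm (1ℚ - distinct t) (bound h) ⟩
      bound h * (1ℚ - distinct t) ∎

-- The certificate identity over the rationals, with an explicit error.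

module Identity where

  open import Data.Bool using (Bool; true)
  open import Data.Fin using (Fin; zero; suc; #_)
  open import Data.Integer as ℤ using (ℤ)
  open import Data.List using (List; []; _∷_; allFin)
  open import Data.Nat as ℕ using (ℕ; zero; suc; _!)
  import Data.Nat.Properties as ℕ
  open import Data.Product using (_×_; _,_)
  open import Data.Rational using (ℚ; 0ℚ; 1ℚ; ½; _+_; _*_; _-_; -_; _≤_; ∣_∣; _/_)
  import Data.Rational.Properties as ℚ
  open import Data.Rational.Solver using (module +-*-Solver)
  open import Data.Vec using (Vec; []; _∷_; lookup; _++_)
  open import Relation.Binary.PropositionalEquality hiding ([_])
  open import Defs using (vectors; IsInjective; isInjective?; Injection; injections; Graph; Flag; P; Representatives; 𝟎; unlabelled; inducedType; rooted; density; C₄-pendant)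
  open Graph using (adj)
  open Flag using (underlying)
  open Representatives using (size; rep)
  open Sums
  open Tuples
  open Isomorphism
  open Tables
  open Evaluation
  open Symmetrization
  open Representation
  open FiveVertices

  private variable
    k n m : ℕ
    A : Set

  opaque

    ρ : ℚ
    ρ = ℤ.+ 1 / denominator

    denominator*ρ : ιℕ denominator * ρ ≡ 1ℚ
    denominator*ρ = trans (cong (_* ρ) (ι-def (ℤ.+ denominator))) refl

    0≤ρ : 0ℚ ≤ ρ
    0≤ρ = ℚ.nonNegative⁻¹ ρ

  u : ℚ
  u = ℤ.+ 15625 / 62208

  typeTerms : Graph 3 → List (ℕ × Vec ℤ 8)
  typeTerms τ = terms₃ (adj τ (# 0) (# 1)) (adj τ (# 0) (# 2)) (adj τ (# 1) (# 2))

  form₁ : (G : Graph n) → Injection 1 n → ℚ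
  form₁ G f = quadraticForm (𝓕₁ (inducedType G f)) (rooted G f) λ i j → ι (gram terms₁ i j) * ρ

  form₃ : (G : Graph n) → Injection 3 n → ℚ
  form₃ G f = quadraticForm (𝓕₃ (inducedType G f)) (rooted G f) λ i j → ι (gram (typeTerms (inducedType G f)) i j) * ρ

  -- Opaque, since unfolding the density of an explicit graph is costly.
  opaque

    weightedDeficit : ∀ {κ N} (F : Graph κ) → .(κ ℕ.≤ N) → ℚ → Representatives 𝟎 N → Graph n → ℚ
    weightedDeficit F κ≤N u R G = ∑ (allFin (size R)) λ i → (u - density F (underlying (rep R i)) κ≤N) * ιℕ (P (rep R i) (unlabelled G))

    weightedDeficit-def : ∀ {κ N} (F : Graph κ) .(κ≤N : κ ℕ.≤ N) u (R : Representatives 𝟎 N) (G : Graph n) →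
      weightedDeficit F κ≤N u R G ≡ ∑ (allFin (size R)) λ i → (u - density F (underlying (rep R i)) κ≤N) * ιℕ (P (rep R i) (unlabelled G))
    weightedDeficit-def F κ≤N u R G = refl

    weightedSum : ∀ {N} (R : Representatives 𝟎 N) → (Fin (size R) → ℚ) → Graph n → ℚ
    weightedSum R w G = ∑ (allFin (size R)) λ i → w i * ιℕ (P (rep R i) (unlabelled G))

    weightedSum-def : ∀ {N} (R : Representatives 𝟎 N) w (G : Graph n) →
      weightedSum R w G ≡ ∑ (allFin (size R)) λ i → w i * ιℕ (P (rep R i) (unlabelled G))
    weightedSum-def R w G = refl

  -- The constituents of the certificate. The factor `1 / 240` in `slacks` undoes the 120 of the
  -- symmetrization and the 2 in `2 * denominator * (u - λ)`.
  sum₁ sum₃ deficit slacks : Graph n → ℚ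
  sum₁ {n} G = ∑ (injections 1 n) (form₁ G)
  sum₃ {n} G = ∑ (injections 3 n) (form₃ G)
  deficit G = weightedDeficit C₄-pendant ℕ.≤-refl u 𝓕₀ G
  slacks G = weightedSum 𝓕₀ (λ i → ι (slack ! bitsOf (underlying (rep 𝓕₀ i))) * (ρ * (ℤ.+ 1 / 240))) G

  ∑-vectors-++ : ∀ (xs : List A) k {m} (f : Vec A (k ℕ.+ m) → ℚ) →
    ∑ (vectors xs (k ℕ.+ m)) f ≡ ∑ (vectors xs k) λ s → ∑ (vectors xs m) λ t → f (s ++ t)
  ∑-vectors-++ xs zero    f = sym (ℚ.+-identityʳ (∑ (vectors xs _) f))
  ∑-vectors-++ xs (suc k) f = trans (∑-vectors xs f)
    (trans (∑-cong xs λ x → ∑-vectors-++ xs k (λ v → f (x ∷ v))) (sym (∑-vectors xs _)))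

  ∑-injections : (f : Injection k n → ℚ) (h : Vec (Fin n) k → ℚ) → (∀ x (p : IsInjective x) → f (x , p) ≡ h x) →
                 ∑ (injections k n) f ≡ ∑ (vectors (allFin n) k) λ x → distinct x * h x
  ∑-injections {k} {n} f h e = trans (∑-select isInjective? (vectors (allFin n) k) f h (λ x p → e x p))
    (∑-cong (vectors (allFin n) k) λ x → cong (_* h x) (sym (distinct-def x)))

  -- The tuples over which a product of two flag counts really runs: either flag is injective
  -- together with the roots, but the two may share unlabelled vertices.
  weight₁ weight₃ : Vec (Fin n) 5 → ℚ
  weight₁ (u ∷ v ∷ w ∷ x ∷ a ∷ []) = distinct (a ∷ []) * (distinct (u ∷ v ∷ a ∷ []) * distinct (w ∷ x ∷ a ∷ []))
  weight₃ (x ∷ y ∷ a ∷ b ∷ c ∷ []) = distinct (a ∷ b ∷ c ∷ []) * (distinct (x ∷ a ∷ b ∷ c ∷ []) * distinct (y ∷ a ∷ b ∷ c ∷ []))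

  private
    0≤product : ∀ (x : Vec (Fin n) k) (y : Vec (Fin n) m) {l} (z : Vec (Fin n) l) → 0ℚ ≤ distinct x * (distinct y * distinct z)
    0≤product x y z = 0≤* (0≤distinct x) (0≤* (0≤distinct y) (0≤distinct z))

    product≤1 : ∀ (x : Vec (Fin n) k) (y : Vec (Fin n) m) {l} (z : Vec (Fin n) l) → distinct x * (distinct y * distinct z) ≤ 1ℚ
    product≤1 x y z = ℚ.≤-trans (*-mono (0≤distinct x) (0≤⟦⟧ true) (distinct≤1 x)
      (ℚ.≤-trans (*-mono (0≤distinct y) (0≤⟦⟧ true) (distinct≤1 y) (distinct≤1 z)) (ℚ.≤-reflexive (ℚ.*-identityˡ 1ℚ)))) (ℚ.≤-reflexive (ℚ.*-identityˡ 1ℚ))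

    product-1 : ∀ (x : Vec (Fin n) k) (y : Vec (Fin n) m) {l} (z : Vec (Fin n) l) →
                IsInjective x → IsInjective y → IsInjective z → distinct x * (distinct y * distinct z) ≡ 1ℚ
    product-1 x y z p q r = trans (cong₂ _*_ (distinct-yes x p) (trans (cong₂ _*_ (distinct-yes y q) (distinct-yes z r)) (ℚ.*-identityˡ 1ℚ))) (ℚ.*-identityˡ 1ℚ)

    regroup : ∀ d e f g z → d * ((e * f) * (g * z)) ≡ z * ((d * (e * f)) * g)
    regroup = solve 5 (λ d e f g z → d :* ((e :* f) :* (g :* z)) := z :* ((d :* (e :* f)) :* g)) refl
      where open +-*-Solver using (solve; _:=_; _:*_)

    select-injective : (t : Vec (Fin n) k) → IsInjective t → (p : Vec (Fin k) m) → IsInjective p → (s : Vec (Fin n) m) →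
                       (∀ i → lookup s i ≡ lookup t (lookup p i)) → IsInjective s
    select-injective t t-inj p p-inj s e {x} {y} d = p-inj (t-inj (trans (sym (e x)) (trans d (e y))))

  weight₁-injective : (t : Vec (Fin n) 5) → IsInjective t → weight₁ t ≡ 1ℚ
  weight₁-injective t@(u ∷ v ∷ w ∷ x ∷ a ∷ []) inj = product-1 (a ∷ []) (u ∷ v ∷ a ∷ []) (w ∷ x ∷ a ∷ [])
    (select-injective t inj (# 4 ∷ []) (λ { {zero} {zero} _ → refl }) (a ∷ []) (λ { zero → refl }))
    (select-injective t inj (# 0 ∷ # 1 ∷ # 4 ∷ []) (λ {i} {j} → from-yes (isInjective? p₁) {i} {j}) (u ∷ v ∷ a ∷ []) (λ { zero → refl ; (suc zero) → refl ; (suc (suc zero)) → refl }))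
    (select-injective t inj (# 2 ∷ # 3 ∷ # 4 ∷ []) (λ {i} {j} → from-yes (isInjective? p₂) {i} {j}) (w ∷ x ∷ a ∷ []) (λ { zero → refl ; (suc zero) → refl ; (suc (suc zero)) → refl }))
    where
    open import Relation.Nullary.Decidable using (from-yes)
    p₁ p₂ : Vec (Fin 5) 3
    p₁ = # 0 ∷ # 1 ∷ # 4 ∷ []
    p₂ = # 2 ∷ # 3 ∷ # 4 ∷ []

  weight₃-injective : (t : Vec (Fin n) 5) → IsInjective t → weight₃ t ≡ 1ℚ
  weight₃-injective (x ∷ y ∷ a ∷ b ∷ c ∷ []) inj with injective-∷⁻ {x = x} {y ∷ a ∷ b ∷ c ∷ []} inj
  ... | x∉ , inj′ with injective-∷⁻ {x = y} {a ∷ b ∷ c ∷ []} inj′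
  ...   | y∉ , inj″ = product-1 (a ∷ b ∷ c ∷ []) (x ∷ a ∷ b ∷ c ∷ []) (y ∷ a ∷ b ∷ c ∷ []) inj″
    (injective-∷⁺ {x = x} {a ∷ b ∷ c ∷ []} (λ x∈ → x∉ (Subset.x∈p∪q⁺ {p = Data.Fin.Subset.⁅ y ⁆} (inj₂ x∈))) inj″) inj′
    where
    import Data.Fin.Subset
    import Data.Fin.Subset.Properties as Subset
    open import Data.Sum using (inj₂)

  module _ (G : Graph n) where

    private
      V : ∀ k → List (Vec (Fin n) k)
      V = vectors (allFin n)
      a = adj G

      pull : ∀ w x y → w * (x * y) ≡ (w * x) * y
      pull w x y = sym (ℚ.*-assoc w x y)

    -- The 4 is `(2!)²`, as both unlabelled pairs are summed in either order. The root moves behind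
    -- the two pairs, to the place where `term₁` expects it.
    four-sum₁ : ιℕ 4 * sum₁ G ≡ ρ * ∑ (V 5) λ t → weight₁ t * ι (term₁ (bits a t))
    four-sum₁ = begin
      ιℕ 4 * sum₁ G
        ≡⟨ ∑-*ˡ (injections 1 n) (ιℕ 4) _ ⟨
      ∑ (injections 1 n) (λ f → ιℕ 4 * form₁ G f)
        ≡⟨ ∑-injections (λ f → ιℕ 4 * form₁ G f) h quadratic ⟩
      ∑ (V 1) (λ r → distinct r * h r)
        ≡⟨ ∑-cong (V 1) (λ r → trans (sym (∑-*ˡ (V 2) (distinct r) _)) (∑-cong (V 2) λ s → sym (∑-*ˡ (V 2) (distinct r) _))) ⟩
      ∑ (V 1) (λ r → ∑ (V 2) λ s → ∑ (V 2) λ t → distinct r * summand r s t)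
        ≡⟨ trans (∑-swap (V 1) (V 2) _) (∑-cong (V 2) λ s → ∑-swap (V 1) (V 2) _) ⟩
      ∑ (V 2) (λ s → ∑ (V 2) λ t → ∑ (V 1) λ r → distinct r * summand r s t)
        ≡⟨ ∑-cong (V 2) (λ s → ∑-cong (V 2) λ t → ∑-cong (V 1) λ r → pointwise r s t) ⟩
      ∑ (V 2) (λ s → ∑ (V 2) λ t → ∑ (V 1) λ r → F (s ++ (t ++ r)))
        ≡⟨ trans (∑-vectors-++ (allFin n) 2 F) (∑-cong (V 2) λ s → ∑-vectors-++ (allFin n) 2 (λ v → F (s ++ v))) ⟨
      ∑ (V 5) F
        ≡⟨ ∑-*ˡ (V 5) ρ _ ⟩
      ρ * ∑ (V 5) (λ t → weight₁ t * ι (term₁ (bits a t))) ∎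
      where
      open ≡-Reasoning
      class : Vec (Fin n) 1 → Vec (Fin n) 2 → Fin 6
      class (w ∷ []) (u ∷ v ∷ []) = index₁ (a u w) (a v w) (a u v)
      summand : Vec (Fin n) 1 → Vec (Fin n) 2 → Vec (Fin n) 2 → ℚ
      summand r s t = (distinct (s ++ r) * distinct (t ++ r)) * (ι (gram terms₁ (class r s) (class r t)) * ρ)
      h : Vec (Fin n) 1 → ℚ
      h r = ∑ (V 2) λ s → ∑ (V 2) λ t → summand r s t
      F : Vec (Fin n) 5 → ℚ
      F t = ρ * (weight₁ t * ι (term₁ (bits a t)))
      pointwise : ∀ r s t → distinct r * summand r s t ≡ F (s ++ (t ++ r))
      pointwise (w ∷ []) (p ∷ q ∷ []) (x ∷ y ∷ []) =
        regroup (distinct (w ∷ [])) (distinct (p ∷ q ∷ w ∷ [])) (distinct (x ∷ y ∷ w ∷ []))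
          (ι (gram terms₁ (index₁ (a p w) (a q w) (a p q)) (index₁ (a x w) (a y w) (a x y)))) ρ
      quadratic : ∀ r (p : IsInjective r) → ιℕ 4 * form₁ G (r , p) ≡ h r
      quadratic r@(w ∷ []) p = trans (cong (_* form₁ G (r , p)) (ιℕ-* 2 2))
        (∑-quadratic (𝓕₁ τ) (rooted G (r , p)) (λ i j → ι (gram terms₁ i j) * ρ) (class r) classify)
        where
        τ = inducedType G (r , p)
        classify : ∀ t → IsInjective (t ++ r) → Defs._≅_[_] (rep₁ τ (class r t)) (rooted G (r , p)) (Defs.image (t ++ r))
        classify (u ∷ v ∷ []) inj = classify₁ τ (rooted G (r , p)) u v w inj refl

    sum₃-tuples : sum₃ G ≡ ρ * ∑ (V 5) λ t → weight₃ t * ι (term₃ (bits a t))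
    sum₃-tuples = begin
      sum₃ G
        ≡⟨ ∑-injections (form₃ G) h quadratic ⟩
      ∑ (V 3) (λ r → distinct r * h r)
        ≡⟨ ∑-cong (V 3) (λ r → trans (sym (∑-*ˡ (V 1) (distinct r) _)) (∑-cong (V 1) λ s → sym (∑-*ˡ (V 1) (distinct r) _))) ⟩
      ∑ (V 3) (λ r → ∑ (V 1) λ s → ∑ (V 1) λ t → distinct r * summand r s t)
        ≡⟨ trans (∑-swap (V 3) (V 1) _) (∑-cong (V 1) λ s → ∑-swap (V 3) (V 1) _) ⟩
      ∑ (V 1) (λ s → ∑ (V 1) λ t → ∑ (V 3) λ r → distinct r * summand r s t)
        ≡⟨ ∑-cong (V 1) (λ s → ∑-cong (V 1) λ t → ∑-cong (V 3) λ r → pointwise r s t) ⟩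
      ∑ (V 1) (λ s → ∑ (V 1) λ t → ∑ (V 3) λ r → F (s ++ (t ++ r)))
        ≡⟨ trans (∑-vectors-++ (allFin n) 1 F) (∑-cong (V 1) λ s → ∑-vectors-++ (allFin n) 1 (λ v → F (s ++ v))) ⟨
      ∑ (V 5) F
        ≡⟨ ∑-*ˡ (V 5) ρ _ ⟩
      ρ * ∑ (V 5) (λ t → weight₃ t * ι (term₃ (bits a t))) ∎
      where
      open ≡-Reasoning
      class : Vec (Fin n) 3 → Vec (Fin n) 1 → Fin 8
      class (u ∷ v ∷ w ∷ []) (x ∷ []) = index₃ (a x u) (a x v) (a x w)
      ts : Vec (Fin n) 3 → List (ℕ × Vec ℤ 8)
      ts (u ∷ v ∷ w ∷ []) = terms₃ (a u v) (a u w) (a v w)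
      summand : Vec (Fin n) 3 → Vec (Fin n) 1 → Vec (Fin n) 1 → ℚ
      summand r s t = (distinct (s ++ r) * distinct (t ++ r)) * (ι (gram (ts r) (class r s) (class r t)) * ρ)
      h : Vec (Fin n) 3 → ℚ
      h r = ∑ (V 1) λ s → ∑ (V 1) λ t → summand r s t
      F : Vec (Fin n) 5 → ℚ
      F t = ρ * (weight₃ t * ι (term₃ (bits a t)))
      pointwise : ∀ r s t → distinct r * summand r s t ≡ F (s ++ (t ++ r))
      pointwise r@(u ∷ v ∷ w ∷ []) s@(x ∷ []) t@(y ∷ []) =
        regroup (distinct r) (distinct (x ∷ r)) (distinct (y ∷ r)) (ι (gram (ts r) (class r s) (class r t))) ρ
      quadratic : ∀ r (p : IsInjective r) → form₃ G (r , p) ≡ h r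
      quadratic r@(u ∷ v ∷ w ∷ []) p = trans (sym (trans (cong (_* q) (trans (cong₂ _*_ ι-1 ι-1) (ℚ.*-identityˡ 1ℚ))) (ℚ.*-identityˡ q)))
        (∑-quadratic (𝓕₃ τ) (rooted G (r , p)) (λ i j → ι (gram (typeTerms τ) i j) * ρ) (class r) classify)
        where
        τ = inducedType G (r , p)
        q = form₃ G (r , p)
        classify : ∀ t → IsInjective (t ++ r) → Defs._≅_[_] (rep₃ τ (class r t)) (rooted G (r , p)) (Defs.image (t ++ r))
        classify (x ∷ []) inj = classify₃ τ (rooted G (r , p)) x u v w inj refl

    private
      Ω : (Vec Bool 10 → ℚ) → ℚ
      Ω = ∑-injective (adj G) (adj-sym G)

      t₁ t₃ : Vec Bool 10 → ℚ
      t₁ b = ι (term₁ b)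
      t₃ b = ι (term₃ b)

      U = ιℕ (denominator ℕ./ 31104 ℕ.* 15625)
      D = ιℕ denominator
      E = Ω (λ b → U - D * ι (embeddings ! b))

    deficit-Ω : ιℕ 120 * deficit G ≡ Ω (λ b → u - ½ * ι (embeddings ! b))
    deficit-Ω = trans (cong (ιℕ 120 *_) (weightedDeficit-def C₄-pendant ℕ.≤-refl u 𝓕₀ G)) (∑-classes₀ G _ embeddings (λ z → u - ½ * ι z) embeddings-invariance-checked each)
      where
      open +-*-Solver using (solve; con; _:=_; _:*_)
      two : ιℕ 2 ≡ ℤ.+ 2 / 1
      two = ι-def (ℤ.+ 2)
      each : ∀ i → u - density C₄-pendant (underlying (rep 𝓕₀ i)) ℕ.≤-refl ≡ u - ½ * ι (embeddings ! bitsOf (underlying (rep 𝓕₀ i)))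
      each i = cong (λ z → u - z) (trans (solve 1 (λ d → d := con ½ :* (con (ℤ.+ 2 / 1) :* d)) refl d)
        (cong (½ *_) (trans (cong (_* d) (sym two)) (density-C₄-pendant (underlying (rep 𝓕₀ i))))))
        where d = density C₄-pendant (underlying (rep 𝓕₀ i)) ℕ.≤-refl

    twice-deficit : ιℕ 240 * (D * deficit G) ≡ E
    twice-deficit = begin
      ιℕ 240 * (D * deficit G)
        ≡⟨ cong (_* (D * deficit G)) (ιℕ-* 2 120) ⟩
      (ιℕ 2 * ιℕ 120) * (D * deficit G)
        ≡⟨ solve 4 (λ a b c d → (a :* b) :* (c :* d) := (a :* c) :* (b :* d)) refl (ιℕ 2) (ιℕ 120) D (deficit G) ⟩
      (ιℕ 2 * D) * (ιℕ 120 * deficit G)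
        ≡⟨ cong ((ιℕ 2 * D) *_) deficit-Ω ⟩
      (ιℕ 2 * D) * Ω (λ b → u - ½ * ι (embeddings ! b))
        ≡⟨ sym (∑-injective-* (adj G) (adj-sym G) (ιℕ 2 * D) (λ b → u - ½ * ι (embeddings ! b))) ⟩
      Ω (λ b → (ιℕ 2 * D) * (u - ½ * ι (embeddings ! b)))
        ≡⟨ ∑-injective-cong (adj G) (adj-sym G) (λ b → expand (ι (embeddings ! b))) ⟩
      E ∎
      where
      open ≡-Reasoning
      open +-*-Solver using (solve; con; _:=_; _:*_; _:-_)
      two : ιℕ 2 ≡ ℤ.+ 2 / 1
      two = ι-def (ℤ.+ 2)
      expand : ∀ z → (ιℕ 2 * D) * (u - ½ * z) ≡ U - D * z
      expand z = trans (cong (λ t → (t * D) * (u - ½ * z)) two)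
        (trans (solve 3 (λ d u z → (con (ℤ.+ 2 / 1) :* d) :* (u :- con ½ :* z) := (con (ℤ.+ 2 / 1) :* u) :* d :- d :* z) refl D u z)
        (cong (λ w → w - D * z) constant))
        where
        constant : (ℤ.+ 2 / 1 * u) * D ≡ U
        -- The inner `refl` evaluates closed fractions; it succeeds because `62208 = 2 * 31104` and
        -- 31104 divides `denominator`.
        constant = trans (cong ((ℤ.+ 2 / 1 * u) *_) (ι-def (ℤ.+ denominator))) (trans refl (sym (ι-def (ℤ.+ (denominator ℕ./ 31104 ℕ.* 15625)))))

    slacks-Ω : ιℕ 240 * (D * slacks G) ≡ Ω (λ b → ι (excess ! b))
    slacks-Ω = *-cancelˡ-≡ (ιℕ 120) (0<ιℕ 119) (begin
      ιℕ 120 * (ιℕ 240 * (D * slacks G))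
        ≡⟨ solve 4 (λ a b c d → a :* (b :* (c :* d)) := b :* (c :* (a :* d))) refl (ιℕ 120) (ιℕ 240) D (slacks G) ⟩
      ιℕ 240 * (D * (ιℕ 120 * slacks G))
        ≡⟨ cong (λ z → ιℕ 240 * (D * z)) (trans (cong (ιℕ 120 *_) (weightedSum-def 𝓕₀ _ G)) (∑-classes₀ G _ slack (λ z → ι z * ρ′) slack-invariance-checked (λ i → refl))) ⟩
      ιℕ 240 * (D * Ω (λ b → ι (slack ! b) * ρ′))
        ≡⟨ cong (λ z → ιℕ 240 * (D * z)) (trans (∑-injective-cong (adj G) (adj-sym G) (λ b → ℚ.*-comm (ι (slack ! b)) ρ′)) (∑-injective-* (adj G) (adj-sym G) ρ′ (λ b → ι (slack ! b)))) ⟩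
      ιℕ 240 * (D * (ρ′ * Ω (λ b → ι (slack ! b))))
        ≡⟨ trans (solve 5 (λ a b c d e → a :* (b :* ((c :* d) :* e)) := ((b :* c) :* (a :* d)) :* e) refl (ιℕ 240) D ρ (ℤ.+ 1 / 240) (Ω (λ b → ι (slack ! b))))
             (trans (cong₂ (λ x y → (x * y) * Ω (λ b → ι (slack ! b))) denominator*ρ (cong (_* (ℤ.+ 1 / 240)) (ι-def (ℤ.+ 240)))) (ℚ.*-identityˡ _)) ⟩
      Ω (λ b → ι (slack ! b))
        ≡⟨ cong (λ T → Ω (λ b → ι (T ! b))) slack-def ⟩
      Ω (λ b → ι (symmetrize excess ! b))
        ≡⟨ ∑-symmetrize (adj G) (adj-sym G) excess ⟩
      ιℕ 120 * Ω (λ b → ι (excess ! b)) ∎)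
      where
      open ≡-Reasoning
      open +-*-Solver using (solve; con; _:=_; _:*_; _:-_)
      ρ′ = ρ * (ℤ.+ 1 / 240)

    Ω-excess : E ≡ Ω (λ b → ι (excess ! b)) + (ιℕ 240 * Ω t₃ + ιℕ 60 * Ω t₁)
    Ω-excess = begin
      E
        ≡⟨ ∑-injective-cong (adj G) (adj-sym G) split ⟩
      Ω (λ b → ι (excess ! b) + (ιℕ 240 * t₃ b + ιℕ 60 * t₁ b))
        ≡⟨ ∑-injective-+ (adj G) (adj-sym G) (λ b → ι (excess ! b)) (λ b → ιℕ 240 * t₃ b + ιℕ 60 * t₁ b) ⟩
      Ω (λ b → ι (excess ! b)) + Ω (λ b → ιℕ 240 * t₃ b + ιℕ 60 * t₁ b)
        ≡⟨ cong (Ω (λ b → ι (excess ! b)) +_) (trans (∑-injective-+ (adj G) (adj-sym G) (λ b → ιℕ 240 * t₃ b) (λ b → ιℕ 60 * t₁ b))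
             (cong₂ _+_ (∑-injective-* (adj G) (adj-sym G) (ιℕ 240) t₃) (∑-injective-* (adj G) (adj-sym G) (ιℕ 60) t₁))) ⟩
      Ω (λ b → ι (excess ! b)) + (ιℕ 240 * Ω t₃ + ιℕ 60 * Ω t₁) ∎
      where
      open ≡-Reasoning
      open +-*-Solver using (solve; con; _:=_; _:*_; _:-_; _:+_)
      split : ∀ b → U - D * ι (embeddings ! b) ≡ ι (excess ! b) + (ιℕ 240 * t₃ b + ιℕ 60 * t₁ b)
      split b = trans (solve 2 (λ x y → x := (x :- y) :+ y) refl (U - D * ι (embeddings ! b)) (ιℕ 240 * t₃ b + ιℕ 60 * t₁ b))
        (cong (_+ (ιℕ 240 * t₃ b + ιℕ 60 * t₁ b)) (sym (trans (cong ι (excess-def b))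
          (trans (ι-- _ _) (cong₂ _-_ (trans (ι-- _ _) (cong (λ z → U - z) (ι-* _ _)))
            (trans (ι-+ _ _) (cong₂ _+_ (ι-* (ℤ.+ 240) (term₃ b)) (ι-* (ℤ.+ 60) (term₁ b)))))))))

    private
      δ : (Vec (Fin n) 5 → ℚ) → (Vec Bool 10 → ℚ) → ℚ
      δ W h = ∑ (V 5) λ t → (distinct t - W t) * h (bits a t)

      Ω-δ : ∀ W h → Ω h ≡ δ W h + ∑ (V 5) (λ t → W t * h (bits a t))
      Ω-δ W h = trans (∑-cong (V 5) λ t → solve 3 (λ d w h → d :* h := (d :- w) :* h :+ w :* h) refl (distinct t) (W t) (h (bits a t)))
        (∑-+ (V 5) _ _)
        where open +-*-Solver using (solve; _:=_; _:*_; _:-_; _:+_)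

      B₁ = ∑ (V 5) λ t → weight₁ t * t₁ (bits a t)
      B₃ = ∑ (V 5) λ t → weight₃ t * t₃ (bits a t)

      R = deficit G - ((sum₁ G + sum₃ G) + slacks G)

    -- With `distinct` in place of the weights the identity would be exact, since `slack` is defined
    -- as what is left over; only the change of weights remains.
    remainder : ιℕ 240 * (D * R) ≡ ιℕ 240 * δ weight₃ t₃ + ιℕ 60 * δ weight₁ t₁
    remainder = begin
      ιℕ 240 * (D * R)
        ≡⟨ solve 6 (λ a d x p q s → a :* (d :* (x :- ((p :+ q) :+ s))) := a :* (d :* x) :- a :* (d :* s) :- (a :* (d :* p) :+ a :* (d :* q))) refl
             (ιℕ 240) D (deficit G) (sum₁ G) (sum₃ G) (slacks G) ⟩
      ιℕ 240 * (D * deficit G) - ιℕ 240 * (D * slacks G) - (ιℕ 240 * (D * sum₁ G) + ιℕ 240 * (D * sum₃ G))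
        ≡⟨ cong₂ _-_ (cong₂ _-_ (trans twice-deficit Ω-excess) slacks-Ω) (cong₂ _+_ sum₁-B₁ sum₃-B₃) ⟩
      (X + (ιℕ 240 * Ω t₃ + ιℕ 60 * Ω t₁)) - X - (ιℕ 60 * B₁ + ιℕ 240 * B₃)
        ≡⟨ cong₂ (λ x y → (X + (ιℕ 240 * x + ιℕ 60 * y)) - X - (ιℕ 60 * B₁ + ιℕ 240 * B₃)) (Ω-δ weight₃ t₃) (Ω-δ weight₁ t₁) ⟩
      (X + (ιℕ 240 * (δ weight₃ t₃ + B₃) + ιℕ 60 * (δ weight₁ t₁ + B₁))) - X - (ιℕ 60 * B₁ + ιℕ 240 * B₃)
        ≡⟨ solve 7 (λ x a b d e f g → (x :+ (a :* (d :+ f) :+ b :* (e :+ g))) :- x :- (b :* g :+ a :* f) := a :* d :+ b :* e) refl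
             X (ιℕ 240) (ιℕ 60) (δ weight₃ t₃) (δ weight₁ t₁) B₃ B₁ ⟩
      ιℕ 240 * δ weight₃ t₃ + ιℕ 60 * δ weight₁ t₁ ∎
      where
      open ≡-Reasoning
      open +-*-Solver using (solve; con; _:=_; _:*_; _:-_; _:+_)
      X = Ω (λ b → ι (excess ! b))
      sum₁-B₁ : ιℕ 240 * (D * sum₁ G) ≡ ιℕ 60 * B₁
      sum₁-B₁ = trans (trans (cong (_* (D * sum₁ G)) (ιℕ-* 60 4)) (solve 4 (λ a b c d → (a :* b) :* (c :* d) := a :* (c :* (b :* d))) refl (ιℕ 60) (ιℕ 4) D (sum₁ G)))
        (cong (ιℕ 60 *_) (trans (cong (D *_) four-sum₁) (trans (sym (ℚ.*-assoc D ρ B₁)) (trans (cong (_* B₁) denominator*ρ) (ℚ.*-identityˡ B₁)))))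
      sum₃-B₃ : ιℕ 240 * (D * sum₃ G) ≡ ιℕ 240 * B₃
      sum₃-B₃ = cong (ιℕ 240 *_) (trans (cong (D *_) sum₃-tuples) (trans (sym (ℚ.*-assoc D ρ B₃)) (trans (cong (_* B₃) denominator*ρ) (ℚ.*-identityˡ B₃))))

    private
      b₁ = bound t₁
      b₃ = bound t₃

    certificate-error : ∣ R ∣ ≤ ((ρ * (ℤ.+ 1 / 240)) * (ℤ.+ 10 / 1 * (ιℕ 240 * b₃ + ιℕ 60 * b₁))) * ιℕ (n ℕ.^ 4)
    certificate-error = begin
      ∣ R ∣
        ≡⟨ cong ∣_∣ recover ⟩
      ∣ ρ′ * Z ∣
        ≡⟨ trans (ℚ.∣p*q∣≡∣p∣*∣q∣ ρ′ Z) (cong (_* ∣ Z ∣) (ℚ.0≤p⇒∣p∣≡p 0≤ρ′)) ⟩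
      ρ′ * ∣ Z ∣
        ≤⟨ *-monoˡ ρ′ 0≤ρ′ (ℚ.∣p+q∣≤∣p∣+∣q∣ (ιℕ 240 * δ weight₃ t₃) (ιℕ 60 * δ weight₁ t₁)) ⟩
      ρ′ * (∣ ιℕ 240 * δ weight₃ t₃ ∣ + ∣ ιℕ 60 * δ weight₁ t₁ ∣)
        ≡⟨ cong (ρ′ *_) (cong₂ _+_ (scale 240 (δ weight₃ t₃)) (scale 60 (δ weight₁ t₁))) ⟩
      ρ′ * (ιℕ 240 * ∣ δ weight₃ t₃ ∣ + ιℕ 60 * ∣ δ weight₁ t₁ ∣)
        ≤⟨ *-monoˡ ρ′ 0≤ρ′ (ℚ.+-mono-≤
             (*-monoˡ (ιℕ 240) (0≤ιℕ 240) (noise G weight₃ t₃ (λ { (x ∷ y ∷ a ∷ b ∷ c ∷ []) → 0≤product (a ∷ b ∷ c ∷ []) (x ∷ a ∷ b ∷ c ∷ []) (y ∷ a ∷ b ∷ c ∷ []) })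
                (λ { (x ∷ y ∷ a ∷ b ∷ c ∷ []) → product≤1 (a ∷ b ∷ c ∷ []) (x ∷ a ∷ b ∷ c ∷ []) (y ∷ a ∷ b ∷ c ∷ []) }) weight₃-injective))
             (*-monoˡ (ιℕ 60) (0≤ιℕ 60) (noise G weight₁ t₁ (λ { (u ∷ v ∷ w ∷ x ∷ a ∷ []) → 0≤product (a ∷ []) (u ∷ v ∷ a ∷ []) (w ∷ x ∷ a ∷ []) })
                (λ { (u ∷ v ∷ w ∷ x ∷ a ∷ []) → product≤1 (a ∷ []) (u ∷ v ∷ a ∷ []) (w ∷ x ∷ a ∷ []) }) weight₁-injective))) ⟩
      ρ′ * (ιℕ 240 * (b₃ * ιℕ (10 ℕ.* n ℕ.^ 4)) + ιℕ 60 * (b₁ * ιℕ (10 ℕ.* n ℕ.^ 4)))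
        ≡⟨ cong (λ z → ρ′ * (ιℕ 240 * (b₃ * z) + ιℕ 60 * (b₁ * z))) (trans (ιℕ-* 10 (n ℕ.^ 4)) (cong (_* ιℕ (n ℕ.^ 4)) (ι-def (ℤ.+ 10)))) ⟩
      ρ′ * (ιℕ 240 * (b₃ * (ℤ.+ 10 / 1 * N)) + ιℕ 60 * (b₁ * (ℤ.+ 10 / 1 * N)))
        ≡⟨ solve 7 (λ r a x b y t n → r :* (a :* (x :* (t :* n)) :+ b :* (y :* (t :* n))) := (r :* (t :* (a :* x :+ b :* y))) :* n) refl
             ρ′ (ιℕ 240) b₃ (ιℕ 60) b₁ (ℤ.+ 10 / 1) N ⟩
      (ρ′ * (ℤ.+ 10 / 1 * (ιℕ 240 * b₃ + ιℕ 60 * b₁))) * N ∎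
      where
      open ℚ.≤-Reasoning
      open +-*-Solver using (solve; con; _:=_; _:*_; _:-_; _:+_)
      ρ′ = ρ * (ℤ.+ 1 / 240)
      N = ιℕ (n ℕ.^ 4)
      Z = ιℕ 240 * δ weight₃ t₃ + ιℕ 60 * δ weight₁ t₁
      0≤ρ′ : 0ℚ ≤ ρ′
      0≤ρ′ = 0≤* 0≤ρ (ℚ.nonNegative⁻¹ (ℤ.+ 1 / 240))
      scale : ∀ k x → ∣ ιℕ k * x ∣ ≡ ιℕ k * ∣ x ∣
      scale k x = trans (ℚ.∣p*q∣≡∣p∣*∣q∣ (ιℕ k) x) (cong (_* ∣ x ∣) (ℚ.0≤p⇒∣p∣≡p (0≤ιℕ k)))
      recover : R ≡ ρ′ * Z
      recover = trans (sym (trans (cong₂ (λ x y → (x * y) * R) denominator*ρ (cong (_* (ℤ.+ 1 / 240)) (ι-def (ℤ.+ 240)))) (ℚ.*-identityˡ R)))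
        (trans (solve 5 (λ d r a i x → ((d :* r) :* (a :* i)) :* x := (r :* i) :* (a :* (d :* x))) refl D ρ (ιℕ 240) (ℤ.+ 1 / 240) R)
               (cong (ρ′ *_) remainder))

-- Positivity of Gram matrices, and integer certificates for their kernels.

module Forms where

  open import Data.Fin as Fin using (Fin; zero; suc; #_)
  import Data.Fin.Properties as Fin
  open import Data.Integer as ℤ using (ℤ; +_)
  import Data.Integer.Properties as ℤ
  open import Data.List as List using (List; []; _∷_; allFin)
  open import Data.List.Relation.Unary.All as All using (All; []; _∷_)
  open import Data.Nat as ℕ using (ℕ; zero; suc)
  import Data.Nat.Properties as ℕ
  open import Data.Product using (∃; _×_; _,_)
  open import Data.Rational using (ℚ; 0ℚ; 1ℚ; ½; _+_; _*_; _-_; -_; _≤_; _<_; ∣_∣)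
  import Data.Rational.Properties as ℚ
  open import Data.Rational.Solver using (module +-*-Solver)
  open import Data.Vec as Vec using (Vec; []; _∷_; lookup)
  import Data.Vec.Properties as Vec
  open import Function using (_∘_)
  open import Relation.Binary.PropositionalEquality
  open import Relation.Nullary using (Dec)
  open import Relation.Nullary.Decidable using (toWitness)
  open Sums
  open Tables

  private variable
    k m n : ℕ

  -- What `≈ 0ℝ` says about the approximating sequence. Integer combinations and division by a
  -- positive integer preserve it, which is all the linear algebra below requires.
  Null : (ℕ → ℚ) → Set
  Null a = ∀ ε → 0ℚ < ε → ∃ λ N → ∀ n → N ℕ.≤ n → ∣ a n ∣ ≤ ε

  null-cong : ∀ {a b} → (∀ n → a n ≡ b n) → Null a → Null b
  null-cong e null ε 0<ε = let (N , small) = null ε 0<ε in N , λ n N≤n → subst (λ z → ∣ z ∣ ≤ ε) (e n) (small n N≤n)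

  null-0 : Null (λ _ → 0ℚ)
  null-0 ε 0<ε = 0 , λ _ _ → ℚ.<⇒≤ 0<ε

  null-neg : ∀ {a} → Null a → Null (λ n → - a n)
  null-neg {a} null ε 0<ε = let (N , small) = null ε 0<ε in N , λ n N≤n → subst (_≤ ε) (sym (ℚ.∣-p∣≡∣p∣ (a n))) (small n N≤n)

  null-+ : ∀ {a b} → Null a → Null b → Null (λ n → a n + b n)
  null-+ {a} {b} null-a null-b ε 0<ε =
    let 0<½ε = 0<* (ℚ.positive⁻¹ ½) 0<ε
        (M , small-a) = null-a (½ * ε) 0<½ε
        (N , small-b) = null-b (½ * ε) 0<½ε
    in M ℕ.⊔ N , λ n ≤n → ℚ.≤-trans (ℚ.∣p+q∣≤∣p∣+∣q∣ (a n) (b n))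
      (ℚ.≤-trans (ℚ.+-mono-≤ (small-a n (ℕ.m⊔n≤o⇒m≤o M N ≤n)) (small-b n (ℕ.m⊔n≤o⇒n≤o M N ≤n)))
                 (ℚ.≤-reflexive (solve 1 (λ e → con ½ :* e :+ con ½ :* e := e) refl ε)))
    where open +-*-Solver using (solve; con; _:=_; _:*_; _:+_)

  null-ιℕ : ∀ {a} m → Null a → Null (λ n → ιℕ m * a n)
  null-ιℕ {a} zero    null = null-cong (λ n → sym (trans (cong (_* a n) ι-0) (ℚ.*-zeroˡ (a n)))) null-0
  null-ιℕ {a} (suc m) null = null-cong
    (λ n → trans (solve 2 (λ a m → a :+ m :* a := (con 1ℚ :+ m) :* a) refl (a n) (ιℕ m)) (cong (_* a n) (sym (ιℕ-suc m))))
    (null-+ null (null-ιℕ m null))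
    where open +-*-Solver using (solve; con; _:=_; _:*_; _:+_)

  null-ι : ∀ {a} z → Null a → Null (λ n → ι z * a n)
  null-ι {a} (+ m)       null = null-ιℕ m null
  null-ι {a} ℤ.-[1+ m ] null = null-cong
    (λ n → trans (ℚ.neg-distribˡ-* (ιℕ (suc m)) (a n)) (cong (_* a n) (sym (ι-neg (+ suc m)))))
    (null-neg {λ n → ιℕ (suc m) * a n} (null-ιℕ (suc m) null))

  null-÷ : ∀ {a} m → Null (λ n → ιℕ (suc m) * a n) → Null a
  null-÷ {a} m null ε 0<ε = let (N , small) = null ε 0<ε in N , λ n N≤n → ℚ.≤-trans (grow n) (small n N≤n)
    where
    grow : ∀ n → ∣ a n ∣ ≤ ∣ ιℕ (suc m) * a n ∣
    grow n = ℚ.≤-trans (ℚ.≤-reflexive (sym (ℚ.*-identityˡ ∣ a n ∣)))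
      (ℚ.≤-trans (*-monoʳ ∣ a n ∣ (0≤∣∣ (a n)) (subst (_≤ ιℕ (suc m)) ι-1 (ιℕ-mono {1} {suc m} (ℕ.s≤s ℕ.z≤n))))
        (ℚ.≤-reflexive (trans (cong (_* ∣ a n ∣) (sym (ℚ.0≤p⇒∣p∣≡p (0≤ιℕ (suc m))))) (sym (ℚ.∣p*q∣≡∣p∣*∣q∣ (ιℕ (suc m)) (a n))))))

  module _ (ρ : ℚ) (0≤ρ : 0ℚ ≤ ρ) (y : Fin k → ℚ) where

    private
      I = allFin k

      quadratic : List (ℕ × Vec ℤ k) → ℚ
      quadratic ts = ∑ I λ i → ∑ I λ j → y i * ((ι (gram ts i j) * ρ) * y j)

      square : Vec ℤ k → ℚ
      square l = ∑ I λ i → ι (lookup l i) * y i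

      quadratic-∷ : ∀ d l ts → quadratic ((d , l) ∷ ts) ≡ (ιℕ d * ρ) * (square l * square l) + quadratic ts
      quadratic-∷ d l ts = begin
        quadratic ((d , l) ∷ ts)
          ≡⟨ ∑-cong I (λ i → trans (∑-cong I (entry i)) (∑-+ I _ _)) ⟩
        ∑ I (λ i → ∑ I (λ j → (ιℕ d * ρ) * (p i * p j)) + ∑ I λ j → y i * ((ι (gram ts i j) * ρ) * y j))
          ≡⟨ ∑-+ I _ _ ⟩
        ∑ I (λ i → ∑ I λ j → (ιℕ d * ρ) * (p i * p j)) + quadratic ts
          ≡⟨ cong (_+ quadratic ts) (trans (∑-cong I λ i → trans (∑-*ˡ I (ιℕ d * ρ) _) (cong ((ιℕ d * ρ) *_) (∑-*ˡ I (p i) p)))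
               (trans (∑-*ˡ I (ιℕ d * ρ) _) (cong ((ιℕ d * ρ) *_) (∑-*ʳ I p (square l))))) ⟩
        (ιℕ d * ρ) * (square l * square l) + quadratic ts ∎
        where
        open ≡-Reasoning
        open +-*-Solver using (solve; _:=_; _:*_; _:+_)
        p : Fin k → ℚ
        p i = ι (lookup l i) * y i
        entry : ∀ i j → y i * ((ι (gram ((d , l) ∷ ts) i j) * ρ) * y j) ≡ (ιℕ d * ρ) * (p i * p j) + y i * ((ι (gram ts i j) * ρ) * y j)
        entry i j = trans (cong (λ z → y i * ((z * ρ) * y j)) (trans (cong ι (gram-∷ d l ts i j)) (trans (ι-+ (+ d ℤ.* (lookup l i ℤ.* lookup l j)) (gram ts i j)) (cong (_+ ι (gram ts i j))
            (trans (ι-* (+ d) (lookup l i ℤ.* lookup l j)) (cong (ιℕ d *_) (ι-* (lookup l i) (lookup l j))))))))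
          (solve 7 (λ d a b g r x z → x :* (((d :* (a :* b) :+ g) :* r) :* z) := (d :* r) :* ((a :* x) :* (b :* z)) :+ x :* ((g :* r) :* z)) refl
            (ιℕ d) (ι (lookup l i)) (ι (lookup l j)) (ι (gram ts i j)) ρ (y i) (y j))

      0≤quadratic : ∀ ts → 0ℚ ≤ quadratic ts
      0≤quadratic [] = ℚ.≤-reflexive (sym (trans (∑-cong I λ i → trans (∑-cong I λ j → trans
        (cong (λ z → y i * ((z * ρ) * y j)) (trans (cong ι (gram-[] i j)) ι-0))
        (solve 3 (λ x r z → x :* ((con 0ℚ :* r) :* z) := con 0ℚ) refl (y i) ρ (y j))) (∑-0 I)) (∑-0 I)))
        where open +-*-Solver using (solve; con; _:=_; _:*_)
      0≤quadratic ((d , l) ∷ ts) = subst (0ℚ ≤_) (sym (quadratic-∷ d l ts))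
        (0≤+ (0≤* (0≤* (0≤ιℕ d) 0≤ρ) (0≤square (square l))) (0≤quadratic ts))

    gram-positive : ∀ ts → 0ℚ ≤ ∑ I λ i → y i * ∑ I λ j → (ι (gram ts i j) * ρ) * y j
    gram-positive ts = subst (0ℚ ≤_) (∑-cong I λ i → ∑-*ˡ I (y i) _) (0≤quadratic ts)

  gram-sym : ∀ (ts : List (ℕ × Vec ℤ k)) i j → gram ts i j ≡ gram ts j i
  gram-sym []             i j = trans (gram-[] i j) (sym (gram-[] j i))
  gram-sym ((d , l) ∷ ts) i j = trans (gram-∷ d l ts i j) (trans
    (cong₂ (λ a b → + d ℤ.* a ℤ.+ b) (ℤ.*-comm (lookup l i) (lookup l j)) (gram-sym ts i j)) (sym (gram-∷ d l ts j i)))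

  -- Linear forms with integer coefficients

  dot : Vec ℤ m → (Fin m → ℚ) → ℚ
  dot []      x = 0ℚ
  dot (a ∷ l) x = ι a * x zero + dot l (x ∘ suc)

  infixr 7 _*ᵛ_
  infixl 6 _+ᵛ_

  _+ᵛ_ : Vec ℤ m → Vec ℤ m → Vec ℤ m
  _+ᵛ_ = Vec.zipWith ℤ._+_

  _*ᵛ_ : ℤ → Vec ℤ m → Vec ℤ m
  z *ᵛ l = Vec.map (z ℤ.*_) l

  dot-+ᵛ : ∀ (l l′ : Vec ℤ m) x → dot (l +ᵛ l′) x ≡ dot l x + dot l′ x
  dot-+ᵛ []      []       x = refl
  dot-+ᵛ (a ∷ l) (b ∷ l′) x = trans (cong₂ (λ u v → u * x zero + v) (ι-+ a b) (dot-+ᵛ l l′ (x ∘ suc)))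
    (solve 5 (λ a b x u v → (a :+ b) :* x :+ (u :+ v) := (a :* x :+ u) :+ (b :* x :+ v)) refl (ι a) (ι b) (x zero) (dot l (x ∘ suc)) (dot l′ (x ∘ suc)))
    where open +-*-Solver using (solve; con; _:=_; _:*_; _:+_)

  dot-*ᵛ : ∀ z (l : Vec ℤ m) x → dot (z *ᵛ l) x ≡ ι z * dot l x
  dot-*ᵛ z []      x = sym (ℚ.*-zeroʳ (ι z))
  dot-*ᵛ z (a ∷ l) x = trans (cong₂ (λ u v → u * x zero + v) (ι-* z a) (dot-*ᵛ z l (x ∘ suc)))
    (solve 4 (λ z a x u → (z :* a) :* x :+ z :* u := z :* (a :* x :+ u)) refl (ι z) (ι a) (x zero) (dot l (x ∘ suc)))
    where open +-*-Solver using (solve; con; _:=_; _:*_; _:+_)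

  dot-replicate-0 : ∀ m x → dot (Vec.replicate m (+ 0)) x ≡ 0ℚ
  dot-replicate-0 zero    x = refl
  dot-replicate-0 (suc m) x = trans (cong₂ _+_ (trans (cong (_* x zero) ι-0) (ℚ.*-zeroˡ (x zero))) (dot-replicate-0 m (x ∘ suc))) (ℚ.+-identityˡ 0ℚ)

  dot-tabulate : (f : Fin m → ℤ) → ∀ x → dot (Vec.tabulate f) x ≡ ∑ (allFin m) λ j → ι (f j) * x j
  dot-tabulate {zero}  f x = refl
  dot-tabulate {suc m} f x = trans (cong (λ z → ι (f zero) * x zero + z) (dot-tabulate (f ∘ suc) (x ∘ suc))) (sym (∑-allFin (λ j → ι (f j) * x j)))

  dotℤ : Vec ℤ m → Vec ℤ m → ℤ
  dotℤ []      []      = + 0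
  dotℤ (a ∷ l) (b ∷ v) = a ℤ.* b ℤ.+ dotℤ l v

  dot-ι : ∀ (l v : Vec ℤ m) → dot l (ι ∘ lookup v) ≡ ι (dotℤ l v)
  dot-ι []      []      = sym ι-0
  dot-ι (a ∷ l) (b ∷ v) = trans (cong₂ _+_ (sym (ι-* a b)) (dot-ι l v)) (sym (ι-+ (a ℤ.* b) (dotℤ l v)))

  unit : Fin m → Vec ℤ m
  unit {suc m} zero    = + 1 ∷ Vec.replicate m (+ 0)
  unit {suc m} (suc i) = + 0 ∷ unit i

  dot-unit : (i : Fin m) → ∀ x → dot (unit i) x ≡ x i
  dot-unit {suc m} zero    x = trans (cong₂ _+_ (trans (cong (_* x zero) ι-1) (ℚ.*-identityˡ (x zero))) (dot-replicate-0 m (x ∘ suc))) (ℚ.+-identityʳ (x zero))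
  dot-unit {suc m} (suc i) x = trans (cong₂ _+_ (trans (cong (_* x zero) ι-0) (ℚ.*-zeroˡ (x zero))) (dot-unit i (x ∘ suc))) (ℚ.+-identityˡ (x (suc i)))

  linear : List ℤ → List (Vec ℤ m) → Vec ℤ m
  linear {m} (c ∷ cs) (l ∷ ls) = c *ᵛ l +ᵛ linear cs ls
  linear {m} _        _        = Vec.replicate m (+ 0)

  -- A rule (c , d , l) states that the combination of the known forms with coefficients c is d > 0 times the form l.
  Rule : ℕ → Set
  Rule m = List ℤ × ℕ × Vec ℤ m

  -- For a positive `d` the factor `suc (pred d)` is `d` itself, in a form that is visibly non-zero,
  -- as `null-÷` demands.
  Valid : List (Vec ℤ m) → Rule m → Set
  Valid ls (c , d , l) = linear c ls ≡ + suc (ℕ.pred d) *ᵛ l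

  valid? : (ls : List (Vec ℤ m)) (r : Rule m) → Dec (Valid ls r)
  valid? ls (c , d , l) = Vec.≡-dec ℤ._≟_ _ _

  conclusion : Rule m → Vec ℤ m
  conclusion (_ , _ , l) = l

  module _ (x : ℕ → Fin m → ℚ) where

    NullForm : Vec ℤ m → Set
    NullForm l = Null λ n → dot l (x n)

    null-linear : ∀ cs {ls} → All NullForm ls → NullForm (linear cs ls)
    null-linear []       []       = null-cong (λ n → sym (dot-replicate-0 m (x n))) null-0
    null-linear []       (_ ∷ _)  = null-cong (λ n → sym (dot-replicate-0 m (x n))) null-0
    null-linear (c ∷ cs) []       = null-cong (λ n → sym (dot-replicate-0 m (x n))) null-0
    null-linear (c ∷ cs) {l ∷ ls} (null ∷ nulls) = null-cong
      (λ n → sym (trans (dot-+ᵛ (c *ᵛ l) (linear cs ls) (x n)) (cong (_+ dot (linear cs ls) (x n)) (dot-*ᵛ c l (x n)))))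
      (null-+ (null-ι {λ n → dot l (x n)} c null) (null-linear cs nulls))

    deduce : ∀ {ls} → All NullForm ls → ∀ {rs} → All (Valid ls) rs → All NullForm (List.map conclusion rs)
    deduce nulls [] = []
    deduce nulls {(c , d , l) ∷ rs} (v ∷ vs) =
      null-÷ {λ n → dot l (x n)} (ℕ.pred d) (null-cong (λ n → trans (cong (λ l → dot l (x n)) v) (dot-*ᵛ (+ suc (ℕ.pred d)) l (x n))) (null-linear c nulls))
      ∷ deduce nulls vs

  rows : List (ℕ × Vec ℤ m) → List (Vec ℤ m)
  rows {m} ts = List.map (λ i → Vec.tabulate (gram ts i)) (allFin m)

  -- Recovers the squared forms from the rows of `X = ∑ d l lᵀ`. A coefficient vector orthogonal to
  -- all forms but one is sent by `X` to a multiple of that one; for instance, the second unit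
  -- vector meets only the first form, with the value 3900.
  duals₁ : List (Rule 6)
  duals₁ =
    (+ 0 ∷ + 1 ∷ + 0 ∷ + 0 ∷ + 0 ∷ + 0 ∷ [] , 260504428410437033891250000000 , − 295 ∷ + 3900 ∷ − 1911 ∷ + 0 ∷ + 429 ∷ + 388 ∷ []) ∷
    (+ 0 ∷ + 49 ∷ + 100 ∷ + 0 ∷ + 0 ∷ + 0 ∷ [] , 2491162566766474367812500000000 , − 1550 ∷ + 0 ∷ + 3900 ∷ − 4251 ∷ + 7800 ∷ − 8229 ∷ []) ∷
    (+ 0 ∷ + 5341 ∷ + 10900 ∷ + 10000 ∷ + 0 ∷ + 0 ∷ [] , 2649056069928240324400400625000000 , − 200 ∷ + 0 ∷ + 0 ∷ + 1300 ∷ − 2288 ∷ + 425 ∷ []) ∷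
    (− 48750 ∷ − 17187 ∷ − 27550 ∷ − 7500 ∷ + 0 ∷ + 0 ∷ [] , 539227543543894260847194243750000 , − 2500 ∷ + 0 ∷ + 0 ∷ + 0 ∷ + 3900 ∷ + 1207 ∷ []) ∷
    (+ 470730000 ∷ + 906765797 ∷ + 1975835300 ∷ − 246330000 ∷ + 0 ∷ + 975000000 ∷ [] , 95041034916140591324439120000000000000000 , + 0 ∷ + 0 ∷ + 0 ∷ + 0 ∷ + 0 ∷ + 1 ∷ []) ∷
    []

  -- 144 times the flag densities at a vertex of the random bipartite graph. For example, 39 is
  -- `36 + 1 + 2`: both further vertices on the side of the root, both opposite, or one on each
  -- side, with no edge among the three.
  kernel₁ : Vec ℤ 6
  kernel₁ = + 39 ∷ + 10 ∷ + 20 ∷ + 50 ∷ + 25 ∷ + 0 ∷ []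

  -- The five forms are triangular enough to be solved for each coordinate in terms of the first:
  -- rule `i` ends in `39 xᵢ - kᵢ x₀`, where `k` is `kernel₁`.
  relations₁ : List (Rule 6)
  relations₁ =
    (+ 250000 ∷ + 122500 ∷ + 400575 ∷ − 37496 ∷ + 786065797 ∷ [] , 25000000 , − 10 ∷ + 39 ∷ + 0 ∷ + 0 ∷ + 0 ∷ + 0 ∷ []) ∷
    (+ 0 ∷ + 2500 ∷ + 8175 ∷ − 204 ∷ + 17344353 ∷ [] , 250000 , − 20 ∷ + 0 ∷ + 39 ∷ + 0 ∷ + 0 ∷ + 0 ∷ []) ∷
    (+ 0 ∷ + 0 ∷ + 75 ∷ + 44 ∷ − 84983 ∷ [] , 2500 , − 50 ∷ + 0 ∷ + 0 ∷ + 39 ∷ + 0 ∷ + 0 ∷ []) ∷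
    (+ 0 ∷ + 0 ∷ + 0 ∷ + 1 ∷ − 1207 ∷ [] , 100 , − 25 ∷ + 0 ∷ + 0 ∷ + 0 ∷ + 39 ∷ + 0 ∷ []) ∷
    (+ 0 ∷ + 0 ∷ + 0 ∷ + 0 ∷ + 39 ∷ [] , 1 , + 0 ∷ + 0 ∷ + 0 ∷ + 0 ∷ + 0 ∷ + 39 ∷ []) ∷
    []

  dualsν : List (Rule 8)
  dualsν =
    (+ 0 ∷ + 1 ∷ + 1 ∷ + 0 ∷ + 0 ∷ + 0 ∷ + 0 ∷ + 0 ∷ [] , 10304806472469715342318000000000 , + 845 ∷ + 700 ∷ + 700 ∷ − 231 ∷ − 238 ∷ − 47 ∷ − 47 ∷ + 24 ∷ []) ∷
    (+ 0 ∷ + 33 ∷ + 33 ∷ + 200 ∷ + 0 ∷ + 0 ∷ + 0 ∷ + 0 ∷ [] , 486786604125293086563111800000000 , − 190 ∷ + 0 ∷ + 0 ∷ + 700 ∷ − 539 ∷ + 36 ∷ + 36 ∷ + 145 ∷ []) ∷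
    (− 14000 ∷ + 7823 ∷ + 7823 ∷ − 3800 ∷ + 0 ∷ + 0 ∷ + 0 ∷ + 0 ∷ [] , 36157262045259246560677967868000000 , − 1500 ∷ + 0 ∷ + 0 ∷ + 0 ∷ + 350 ∷ − 213 ∷ − 213 ∷ + 371 ∷ []) ∷
    (− 994000 ∷ + 731033 ∷ + 731033 ∷ − 629800 ∷ + 0 ∷ + 3500000 ∷ + 3500000 ∷ + 0 ∷ [] , 13079753242862498034570000000000000000 , + 0 ∷ + 0 ∷ + 0 ∷ + 0 ∷ + 0 ∷ + 100 ∷ + 100 ∷ − 21 ∷ []) ∷
    (+ 456778000 ∷ − 351953221 ∷ − 351953221 ∷ − 333697400 ∷ + 0 ∷ + 220500000 ∷ + 220500000 ∷ + 2100000000 ∷ [] , 679771001548245042157962240000000000000000 , + 0 ∷ + 0 ∷ + 0 ∷ + 0 ∷ + 0 ∷ + 0 ∷ + 0 ∷ + 1 ∷ []) ∷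
    (+ 0 ∷ − 1 ∷ + 1 ∷ + 0 ∷ + 0 ∷ + 0 ∷ + 0 ∷ + 0 ∷ [] , 92801966193104280977149420590000 , + 0 ∷ − 100 ∷ + 100 ∷ + 0 ∷ + 0 ∷ − 1 ∷ + 1 ∷ + 0 ∷ []) ∷
    (+ 0 ∷ + 1 ∷ − 1 ∷ + 0 ∷ + 0 ∷ − 100 ∷ + 100 ∷ + 0 ∷ [] , 222911919338872562525825280000000000 , + 0 ∷ + 0 ∷ + 0 ∷ + 0 ∷ + 0 ∷ − 1 ∷ + 1 ∷ + 0 ∷ []) ∷
    []

  -- 72 times the flag densities at a cherry, whose centre lies opposite to its two leaves. A fourth
  -- vertex on the side of the centre contributes 1, 5, 5, 25, and one on the side of the leaves 6
  -- and 30.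
  kernelν : Vec ℤ 8
  kernelν = + 7 ∷ + 5 ∷ + 5 ∷ + 25 ∷ + 30 ∷ + 0 ∷ + 0 ∷ + 0 ∷ []

  relationsν : List (Rule 8)
  relationsν =
    (+ 500000 ∷ + 165000 ∷ + 594100 ∷ + 1441033 ∷ − 226074407 ∷ − 3500000 ∷ + 3500000 ∷ [] , 100000000 , − 5 ∷ + 7 ∷ + 0 ∷ + 0 ∷ + 0 ∷ + 0 ∷ + 0 ∷ + 0 ∷ []) ∷
    (+ 500000 ∷ + 165000 ∷ + 594100 ∷ + 1441033 ∷ − 226074407 ∷ + 3500000 ∷ − 3500000 ∷ [] , 100000000 , − 5 ∷ + 0 ∷ + 7 ∷ + 0 ∷ + 0 ∷ + 0 ∷ + 0 ∷ + 0 ∷ []) ∷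
    (+ 0 ∷ + 5000 ∷ + 7700 ∷ + 14601 ∷ − 3275079 ∷ + 0 ∷ + 0 ∷ [] , 500000 , − 25 ∷ + 0 ∷ + 0 ∷ + 7 ∷ + 0 ∷ + 0 ∷ + 0 ∷ + 0 ∷ []) ∷
    (+ 0 ∷ + 0 ∷ + 100 ∷ + 213 ∷ − 32627 ∷ + 0 ∷ + 0 ∷ [] , 5000 , − 30 ∷ + 0 ∷ + 0 ∷ + 0 ∷ + 7 ∷ + 0 ∷ + 0 ∷ + 0 ∷ []) ∷
    (+ 0 ∷ + 0 ∷ + 0 ∷ + 7 ∷ + 147 ∷ + 0 ∷ − 700 ∷ [] , 200 , + 0 ∷ + 0 ∷ + 0 ∷ + 0 ∷ + 0 ∷ + 7 ∷ + 0 ∷ + 0 ∷ []) ∷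
    (+ 0 ∷ + 0 ∷ + 0 ∷ + 7 ∷ + 147 ∷ + 0 ∷ + 700 ∷ [] , 200 , + 0 ∷ + 0 ∷ + 0 ∷ + 0 ∷ + 0 ∷ + 0 ∷ + 7 ∷ + 0 ∷ []) ∷
    (+ 0 ∷ + 0 ∷ + 0 ∷ + 0 ∷ + 7 ∷ + 0 ∷ + 0 ∷ [] , 1 , + 0 ∷ + 0 ∷ + 0 ∷ + 0 ∷ + 0 ∷ + 0 ∷ + 0 ∷ + 7 ∷ []) ∷
    []

  -- Four rules for five forms: the last three forms of `termsσ` add up to zero, so the fifth is
  -- minus the sum of the two before it.
  dualsσ : List (Rule 8)
  dualsσ =
    (− 7 ∷ − 20 ∷ − 20 ∷ + 20 ∷ + 0 ∷ + 0 ∷ + 0 ∷ + 0 ∷ [] , 77940428342753429743972500000000 , + 300 ∷ − 665 ∷ − 665 ∷ + 980 ∷ − 665 ∷ + 980 ∷ + 980 ∷ − 1029 ∷ []) ∷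
    (− 77 ∷ − 10 ∷ − 10 ∷ + 10 ∷ + 0 ∷ + 0 ∷ + 0 ∷ + 0 ∷ [] , 2317930954431328765620000000000 , − 200 ∷ + 35 ∷ + 35 ∷ + 0 ∷ + 35 ∷ + 0 ∷ + 0 ∷ + 343 ∷ []) ∷
    (− 7 ∷ − 5 ∷ − 35 ∷ − 25 ∷ + 0 ∷ + 0 ∷ + 0 ∷ + 0 ∷ [] , 4669892310182772947156524687500000 , + 0 ∷ + 0 ∷ − 1 ∷ − 1 ∷ + 1 ∷ + 1 ∷ + 0 ∷ + 0 ∷ []) ∷
    (+ 7 ∷ + 35 ∷ + 5 ∷ + 25 ∷ + 0 ∷ + 0 ∷ + 0 ∷ + 0 ∷ [] , 4669892310182772947156524687500000 , + 0 ∷ + 1 ∷ + 0 ∷ + 1 ∷ − 1 ∷ + 0 ∷ − 1 ∷ + 0 ∷ []) ∷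
    []

  -- The last four coefficients multiply the coordinates listed in `multiEdge`. Together with them
  -- the recovered forms generate the other four coordinates, so a kernel vector without multi-edge
  -- coordinates vanishes.
  relationsσ : List (Rule 8)
  relationsσ =
    (− 1 ∷ − 19 ∷ + 0 ∷ + 0 ∷ + 980 ∷ + 980 ∷ + 980 ∷ + 5488 ∷ [] , 3500 , + 1 ∷ + 0 ∷ + 0 ∷ + 0 ∷ + 0 ∷ + 0 ∷ + 0 ∷ + 0 ∷ []) ∷
    (− 2 ∷ − 3 ∷ + 1225 ∷ + 2450 ∷ + 735 ∷ + 735 ∷ + 4410 ∷ − 1029 ∷ [] , 3675 , + 0 ∷ + 1 ∷ + 0 ∷ + 0 ∷ + 0 ∷ + 0 ∷ + 0 ∷ + 0 ∷ []) ∷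
    (− 2 ∷ − 3 ∷ − 2450 ∷ − 1225 ∷ + 735 ∷ + 4410 ∷ + 735 ∷ − 1029 ∷ [] , 3675 , + 0 ∷ + 0 ∷ + 1 ∷ + 0 ∷ + 0 ∷ + 0 ∷ + 0 ∷ + 0 ∷ []) ∷
    (− 2 ∷ − 3 ∷ + 1225 ∷ − 1225 ∷ + 4410 ∷ + 735 ∷ + 735 ∷ − 1029 ∷ [] , 3675 , + 0 ∷ + 0 ∷ + 0 ∷ + 0 ∷ + 1 ∷ + 0 ∷ + 0 ∷ + 0 ∷ []) ∷
    []

  dualsμ : List (Rule 8)
  dualsμ =
    (+ 0 ∷ + 1 ∷ + 0 ∷ + 0 ∷ + 0 ∷ + 0 ∷ + 0 ∷ + 0 ∷ [] , 3770384868192668897449687500000 , − 690 ∷ + 700 ∷ + 453 ∷ − 581 ∷ + 453 ∷ − 581 ∷ − 100 ∷ + 359 ∷ []) ∷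
    (− 245 ∷ − 1534 ∷ + 875 ∷ − 875 ∷ + 0 ∷ + 0 ∷ + 0 ∷ + 0 ∷ [] , 10482696558064091724054421275000000 , − 50 ∷ + 0 ∷ + 100 ∷ − 126 ∷ + 100 ∷ − 126 ∷ + 45 ∷ + 13 ∷ []) ∷
    (− 3955 ∷ − 2606 ∷ − 875 ∷ + 875 ∷ + 0 ∷ + 0 ∷ + 0 ∷ + 0 ∷ [] , 1757455423766095516428195184500000 , − 2500 ∷ + 0 ∷ + 0 ∷ + 700 ∷ + 0 ∷ + 700 ∷ + 2052 ∷ + 1783 ∷ []) ∷
    (+ 1444485 ∷ + 1716502 ∷ − 28875 ∷ + 28875 ∷ + 0 ∷ + 0 ∷ + 1750000 ∷ + 0 ∷ [] , 331132993490189823660000000000000000 , + 0 ∷ + 0 ∷ + 0 ∷ + 0 ∷ + 0 ∷ + 0 ∷ + 100 ∷ − 61 ∷ []) ∷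
    (+ 624891505 ∷ + 327049766 ∷ + 44284625 ∷ − 44284625 ∷ + 0 ∷ + 0 ∷ + 320250000 ∷ + 525000000 ∷ [] , 135181733262435093610958400000000000000000 , + 0 ∷ + 0 ∷ + 0 ∷ + 0 ∷ + 0 ∷ + 0 ∷ + 0 ∷ + 1 ∷ []) ∷
    (− 7 ∷ − 5 ∷ − 35 ∷ − 25 ∷ + 0 ∷ + 0 ∷ + 0 ∷ + 0 ∷ [] , 71841590719805467660452542962500000 , + 0 ∷ + 0 ∷ − 1 ∷ − 1 ∷ + 1 ∷ + 1 ∷ + 0 ∷ + 0 ∷ []) ∷
    []

  relationsμ : List (Rule 8)
  relationsμ =
    (+ 0 ∷ + 0 ∷ − 25 ∷ + 513 ∷ + 75868 ∷ + 0 ∷ + 17500 ∷ + 17500 ∷ + 0 ∷ + 0 ∷ [] , 62500 , + 1 ∷ + 0 ∷ + 0 ∷ + 0 ∷ + 0 ∷ + 0 ∷ + 0 ∷ + 0 ∷ []) ∷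
    (+ 250000 ∷ − 1132500 ∷ − 46350 ∷ + 1710727 ∷ + 111968897 ∷ + 0 ∷ + 35000000 ∷ + 35000000 ∷ + 0 ∷ + 0 ∷ [] , 175000000 , + 0 ∷ + 1 ∷ + 0 ∷ + 0 ∷ + 0 ∷ + 0 ∷ + 0 ∷ + 0 ∷ []) ∷
    (+ 0 ∷ + 2500 ∷ − 50 ∷ − 99 ∷ + 50611 ∷ − 250000 ∷ + 100000 ∷ + 600000 ∷ + 0 ∷ + 0 ∷ [] , 500000 , + 0 ∷ + 0 ∷ + 1 ∷ + 0 ∷ + 0 ∷ + 0 ∷ + 0 ∷ + 0 ∷ []) ∷
    (+ 0 ∷ + 2500 ∷ − 50 ∷ − 99 ∷ + 50611 ∷ + 250000 ∷ + 600000 ∷ + 100000 ∷ + 0 ∷ + 0 ∷ [] , 500000 , + 0 ∷ + 0 ∷ + 0 ∷ + 0 ∷ + 1 ∷ + 0 ∷ + 0 ∷ + 0 ∷ []) ∷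
    []

  units : List (Fin m) → List (Vec ℤ m)
  units = List.map unit

  -- The indices with at least two binary digits 1, that is, at least two edges from the unlabelled
  -- vertex to the roots.
  multiEdge : List (Fin 8)
  multiEdge = # 3 ∷ # 5 ∷ # 6 ∷ # 7 ∷ []

  opaque
    unfolding gram

    duals₁-valid : All (Valid (rows terms₁)) duals₁
    duals₁-valid = toWitness {a? = All.all? (valid? (rows terms₁)) duals₁} _

    dualsν-valid : All (Valid (rows termsν)) dualsν
    dualsν-valid = toWitness {a? = All.all? (valid? (rows termsν)) dualsν} _

    dualsσ-valid : All (Valid (rows termsσ)) dualsσ
    dualsσ-valid = toWitness {a? = All.all? (valid? (rows termsσ)) dualsσ} _

    dualsμ-valid : All (Valid (rows termsμ)) dualsμ
    dualsμ-valid = toWitness {a? = All.all? (valid? (rows termsμ)) dualsμ} _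

    kernel₁-zero : ∀ i → dotℤ (Vec.tabulate (gram terms₁ i)) kernel₁ ≡ + 0
    kernel₁-zero = toWitness {a? = Fin.all? λ i → dotℤ (Vec.tabulate (gram terms₁ i)) kernel₁ ℤ.≟ + 0} _

    kernelν-zero : ∀ i → dotℤ (Vec.tabulate (gram termsν i)) kernelν ≡ + 0
    kernelν-zero = toWitness {a? = Fin.all? λ i → dotℤ (Vec.tabulate (gram termsν i)) kernelν ℤ.≟ + 0} _

  relations₁-valid : All (Valid (List.map conclusion duals₁)) relations₁
  relations₁-valid = toWitness {a? = All.all? (valid? (List.map conclusion duals₁)) relations₁} _

  relationsν-valid : All (Valid (List.map conclusion dualsν)) relationsν
  relationsν-valid = toWitness {a? = All.all? (valid? (List.map conclusion dualsν)) relationsν} _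

  relationsσ-valid : All (Valid (List.map conclusion dualsσ List.++ units multiEdge)) relationsσ
  relationsσ-valid = toWitness {a? = All.all? (valid? (List.map conclusion dualsσ List.++ units multiEdge)) relationsσ} _

  relationsμ-valid : All (Valid (List.map conclusion dualsμ List.++ units multiEdge)) relationsμ
  relationsμ-valid = toWitness {a? = All.all? (valid? (List.map conclusion dualsμ List.++ units multiEdge)) relationsμ} _

-- Lower and upper bounds for the maximum density.

module Bounds where

  open import Data.Fin using (Fin; zero; suc)
  open import Data.Integer as ℤ using (ℤ)
  import Data.Integer.Properties as ℤ
  open import Data.List as List using (List; []; _∷_; allFin; length)
  import Data.List.Extrema as Extrema
  import Data.List.Membership.Propositional.Properties as List
  open import Data.List.Relation.Unary.All as All using (All; []; _∷_)
  import Data.List.Relation.Unary.All.Properties as All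
  open import Data.Nat as ℕ using (ℕ; zero; suc; _!)
  import Data.Nat.Properties as ℕ
  open import Data.Nat.Combinatorics using (_C_)
  open import Data.Sum using (_⊎_; inj₁; inj₂)
  open import Data.Product using (∃; _×_; _,_; proj₁; proj₂)
  open import Data.Rational using (ℚ; mkℚ; 0ℚ; 1ℚ; ½; _+_; _*_; _-_; -_; _≤_; _<_; ∣_∣; _/_; 1/_; toℚᵘ; ↥_; positive; Positive; NonZero)

  import Data.Rational.Properties as ℚ
  open import Data.Rational.Solver using (module +-*-Solver)
  import Data.Rational.Unnormalised as ℚᵘ
  import Data.Rational.Unnormalised.Properties as ℚᵘ
  open import Data.Vec using (Vec; _∷_; lookup)
  open import Relation.Binary.Bundles using (DecTotalOrder)
  open import Relation.Binary.PropositionalEquality hiding ([_])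
  open import Defs using (vectors; graphs; IsInjective; Graph; Flag; P; Representatives; unlabelled; inducedType; rooted; fromAdjacency; entry-tabulate; density; maxDensity; nCk-nonZero; C₄-pendant)
  open Graph using (adj)
  open Representatives using (size; rep)
  open Sums
  open Tuples
  open Tables
  open Symmetrization
  open RandomBipartite
  open Representation
  open FiveVertices
  open Identity
  open Forms

  private variable
    n : ℕ

  ceiling : ∀ r → ∃ λ m → r ≤ ιℕ m
  ceiling r = ℤ.∣ ↥ r ∣ , ℚ.≤-trans (a≤∣a∣ r) (ℚ.≤-trans (∣r∣≤ r) (ℚ.≤-reflexive (sym (ι-def (ℤ.+ ℤ.∣ ↥ r ∣)))))
    where
    ∣r∣≤ : ∀ r → ∣ r ∣ ≤ ℤ.+ ℤ.∣ ↥ r ∣ / 1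
    ∣r∣≤ r@(mkℚ z d c) = ℚ.toℚᵘ-cancel-≤ (ℚᵘ.≤-respʳ-≃ (ℚᵘ.≃-sym (ℚ.toℚᵘ-fromℚᵘ (ℚᵘ.mkℚᵘ (ℤ.+ ℤ.∣ z ∣) 0)))
      (ℚᵘ.*≤* (ℤ.*-monoˡ-≤-nonNeg (ℤ.+ ℤ.∣ z ∣) {ℤ.+ 1} {ℤ.+ suc d} (ℤ.+≤+ (ℕ.s≤s ℕ.z≤n)))))

  quotient : ∀ p c .{{_ : ℕ.NonZero c}} → (ℤ.+ p / c) * ιℕ c ≡ ιℕ p
  quotient p c@(suc c′) = trans (cong ((ℤ.+ p / c) *_) (ι-def (ℤ.+ c))) (trans (ℚ.toℚᵘ-injective (begin
    toℚᵘ ((ℤ.+ p / c) * (ℤ.+ c / 1))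
      ≈⟨ ℚ.toℚᵘ-homo-* (ℤ.+ p / c) (ℤ.+ c / 1) ⟩
    toℚᵘ (ℤ.+ p / c) ℚᵘ.* toℚᵘ (ℤ.+ c / 1)
      ≈⟨ ℚᵘ.*-cong (ℚ.toℚᵘ-fromℚᵘ (ℚᵘ.mkℚᵘ (ℤ.+ p) c′)) (ℚ.toℚᵘ-fromℚᵘ (ℚᵘ.mkℚᵘ (ℤ.+ c) 0)) ⟩
    ℚᵘ.mkℚᵘ (ℤ.+ p) c′ ℚᵘ.* ℚᵘ.mkℚᵘ (ℤ.+ c) 0
      ≈⟨ ℚᵘ.*≡* (trans (ℤ.*-identityʳ (ℤ.+ p ℤ.* ℤ.+ c)) (cong (λ m → ℤ.+ p ℤ.* ℤ.+ m) (sym (ℕ.*-identityʳ c)))) ⟩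
    ℚᵘ.mkℚᵘ (ℤ.+ p) 0
      ≈⟨ ℚ.toℚᵘ-fromℚᵘ (ℚᵘ.mkℚᵘ (ℤ.+ p) 0) ⟨
    toℚᵘ (ℤ.+ p / 1) ∎)) (sym (ι-def (ℤ.+ p))))
    where open ℚᵘ.≃-Reasoning

  module _ (F : Graph 5) where

    density-C : ∀ (G : Graph n) .(5≤n : 5 ℕ.≤ n) → density F G 5≤n * ιℕ (n C 5) ≡ ιℕ (P (unlabelled F) (unlabelled G))
    density-C {n} G 5≤n = quotient (P (unlabelled F) (unlabelled G)) (n C 5) {{nCk-nonZero 5≤n}}

    private
      module Max = Extrema (DecTotalOrder.totalOrder ℚ.≤-decTotalOrder)

    density≤max : ∀ (G : Graph n) .(5≤n : 5 ℕ.≤ n) → density F G 5≤n ≤ maxDensity F n 5≤n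
    density≤max G 5≤n = All.lookup (Max.xs≤max 0ℚ _) (List.∈-map⁺ (λ G → density F G 5≤n) (∈-graphs G))

    max≤ : ∀ .(5≤n : 5 ℕ.≤ n) {v} → 0ℚ ≤ v → (∀ (G : Graph n) → density F G 5≤n ≤ v) → maxDensity F n 5≤n ≤ v
    max≤ {n} 5≤n 0≤v d≤v = Max.max≤v⁺ 0≤v (All.map⁺ (All.universal d≤v (graphs n)))

  distinct-*-mono : ∀ {k} (φ : Vec (Fin n) k) {a b : ℚ} → (IsInjective φ → a ≤ b) → distinct φ * a ≤ distinct φ * b
  distinct-*-mono φ {a} {b} a≤b = go (distinct φ) (0≤distinct φ) (distinct-cases φ)
    where
    go : ∀ d → 0ℚ ≤ d → IsInjective φ ⊎ d ≡ 0ℚ → d * a ≤ d * b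
    go d 0≤d (inj₁ inj)  = *-monoˡ d 0≤d (a≤b inj)
    go d 0≤d (inj₂ refl) = ℚ.≤-reflexive (trans (ℚ.*-zeroˡ a) (sym (ℚ.*-zeroˡ b)))

  0<C : 5 ℕ.≤ n → 0ℚ < ιℕ (n C 5)
  0<C {n} 5≤n = go (n C 5) {{nCk-nonZero 5≤n}}
    where
    go : ∀ c .{{_ : ℕ.NonZero c}} → 0ℚ < ιℕ c
    go (suc c) = 0<ιℕ c

  random : Vec (Choice n) n → Graph n
  random s = fromAdjacency (adjacent s) (adjacent-sym s) (adjacent-irrefl s)

  -- First-moment argument: labelled copies are counted over all choices `s` and all injective
  -- tuples `t`. For fixed `t` their number is bounded below by `∑-indicator-bits`; for fixed `s` it
  -- is twice the number of copies. `K` is `2 * 746496`, which accounts for that 2.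
  u≤max : ∀ (5≤n : 5 ℕ.≤ n) → u ≤ maxDensity C₄-pendant n 5≤n
  u≤max {n} 5≤n = ℚ.*-cancelˡ-≤-pos (K * (c * Z)) {{positive (0<* (ℚ.positive⁻¹ K) (0<* (0<C 5≤n) 0<Z))}} (begin
    (K * (c * Z)) * u
      ≡⟨ solve 2 (λ c z → (con K :* (c :* z)) :* con u := con (ℤ.+ 120 / 1) :* c :* (con c₃₁₂₅ :* z)) refl c Z ⟩
    (ℤ.+ 120 / 1 * c) * (c₃₁₂₅ * Z)
      ≡⟨ cong (_* (c₃₁₂₅ * Z)) (trans (cong (_* c) (sym (ι-def (ℤ.+ 120)))) (sym (∑-distinct {n} 5))) ⟩
    ∑ T distinct * (c₃₁₂₅ * Z)
      ≡⟨ ∑-*ʳ T distinct (c₃₁₂₅ * Z) ⟨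
    ∑ T (λ t → distinct t * (c₃₁₂₅ * Z))
      ≤⟨ ∑-mono T each ⟩
    ∑ T (λ t → distinct t * (k * ∑ S λ s → ι (indicator ! bits (adjacent s) t)))
      ≡⟨ trans (∑-cong T λ t → trans (swap (distinct t) k _) (cong (k *_) (sym (∑-*ˡ S (distinct t) _)))) (∑-*ˡ T k _) ⟩
    k * ∑ T (λ t → ∑ S λ s → distinct t * ι (indicator ! bits (adjacent s) t))
      ≡⟨ cong (k *_) (∑-swap T S _) ⟩
    k * ∑ S (λ s → ∑ T λ t → distinct t * ι (indicator ! bits (adjacent s) t))
      ≡⟨ cong (k *_) (∑-cong S twice-copies) ⟨
    k * ∑ S (λ s → ℤ.+ 2 / 1 * p s)
      ≤⟨ *-monoˡ k (ℚ.nonNegative⁻¹ k) (∑-mono S λ s → *-monoˡ (ℤ.+ 2 / 1) (ℚ.nonNegative⁻¹ (ℤ.+ 2 / 1)) (p≤ s)) ⟩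
    k * ∑ S (λ s → ℤ.+ 2 / 1 * (d * c))
      ≡⟨ cong (k *_) (trans (∑-cong S λ s → sym (ℚ.*-identityʳ _)) (∑-*ˡ S (ℤ.+ 2 / 1 * (d * c)) (λ _ → 1ℚ))) ⟩
    k * ((ℤ.+ 2 / 1 * (d * c)) * Z)
      ≡⟨ solve 3 (λ c z d → con k :* ((con (ℤ.+ 2 / 1) :* (d :* c)) :* z) := (con K :* (c :* z)) :* d) refl c Z d ⟩
    (K * (c * Z)) * d ∎)
    where
    open ℚ.≤-Reasoning
    open +-*-Solver using (solve; con; _:=_; _:*_)
    T = vectors (allFin n) 5
    S = vectors (choices n) n
    c = ιℕ (n C 5)
    Z = ∑ S (λ _ → 1ℚ)
    c₃₁₂₅ = ℤ.+ 3125 / 1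
    k = ℤ.+ 746496 / 1
    K = ℤ.+ 1492992 / 1
    d = maxDensity C₄-pendant n 5≤n
    p : Vec (Choice n) n → ℚ
    p s = ιℕ (P (unlabelled C₄-pendant) (unlabelled (random s)))
    swap : ∀ a b c → a * (b * c) ≡ b * (a * c)
    swap = solve 3 (λ a b c → a :* (b :* c) := b :* (a :* c)) refl
    0<Z : 0ℚ < Z
    0<Z = subst (0ℚ <_) (sym (∑-vectors-1 (choices n) n)) (go (choices≢0 n))
      where
      go : ∀ {m} → 0 ℕ.< m → 0ℚ < ιℕ (m ℕ.^ n)
      go {suc m} _ with suc m ℕ.^ n | ℕ.m^n>0 (suc m) n
      ... | suc q | _ = 0<ιℕ q
      vectors≢0 : ∀ n → 0 ℕ.< length (vectors coin n)
      vectors≢0 zero = ℕ.z<s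
      vectors≢0 (suc n) with vectors coin n | vectors≢0 n
      ... | _ ∷ _ | _ = ℕ.z<s
      choices≢0 : ∀ n → 0 ℕ.< length (choices n)
      choices≢0 n with vectors coin n | vectors≢0 n
      ... | _ ∷ _ | _ = ℕ.z<s
    p≤ : ∀ s → p s ≤ d * c
    p≤ s = subst (_≤ d * c) (density-C C₄-pendant (random s) 5≤n) (*-monoʳ c (0≤ιℕ (n C 5)) (density≤max C₄-pendant (random s) 5≤n))
    each : ∀ t → distinct t * (c₃₁₂₅ * Z) ≤ distinct t * (k * ∑ S λ s → ι (indicator ! bits (adjacent s) t))
    each t = distinct-*-mono t (∑-indicator-bits t)
    twice-copies : ∀ s → ℤ.+ 2 / 1 * p s ≡ ∑ T λ t → distinct t * ι (indicator ! bits (adjacent s) t)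
    twice-copies s = *-cancelˡ-≡ (ιℕ 120) (0<ιℕ 119) (begin-equality
      ιℕ 120 * (ℤ.+ 2 / 1 * p s)
        ≡⟨ trans (cong (λ z → ιℕ 120 * (z * p s)) (sym (ι-def (ℤ.+ 2)))) (trans (sym (ℚ.*-assoc (ιℕ 120) (ιℕ 2) (p s))) (cong (_* p s) (sym (ιℕ-* 120 2)))) ⟩
      ιℕ 240 * p s
        ≡⟨ copies-C₄-pendant (random s) ⟩
      ∑-injective (adj (random s)) (adj-sym (random s)) (λ b → ι (embeddings ! b))
        ≡⟨ cong (λ T → ∑-injective (adj (random s)) (adj-sym (random s)) (λ b → ι (T ! b))) embeddings-def ⟩
      ∑-injective (adj (random s)) (adj-sym (random s)) (λ b → ι (symmetrize indicator ! b))
        ≡⟨ ∑-symmetrize (adj (random s)) (adj-sym (random s)) indicator ⟩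
      ιℕ 120 * ∑ T (λ t → distinct t * ι (indicator ! bits (adj (random s)) t))
        ≡⟨ cong (ιℕ 120 *_) (∑-cong T λ t → cong (λ b → distinct t * ι (indicator ! b))
             (bits-cong (adj (random s)) (adjacent s) t t λ i j → entry-tabulate (adjacent s) (lookup t i) (lookup t j))) ⟩
      ιℕ 120 * ∑ T (λ t → distinct t * ι (indicator ! bits (adjacent s) t)) ∎)

  -- Upper bound from the certificate

  0≤form : ∀ {q s} {τ : Graph q} (R : Representatives τ s) (K : Flag τ n) (ts : List (ℕ × Vec ℤ (size R))) →
           0ℚ ≤ quadraticForm R K (λ i j → ι (gram ts i j) * ρ)
  0≤form R K ts = subst (0ℚ ≤_) (sym (quadraticForm-def R K (λ i j → ι (gram ts i j) * ρ))) (gram-positive ρ 0≤ρ (λ i → ιℕ (P (rep R i) K)) ts)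

  module _ (G : Graph n) where

    0≤rhs : 0ℚ ≤ (sum₁ G + sum₃ G) + slacks G
    0≤rhs = 0≤+ (0≤+ (∑-nonNeg (Defs.injections 1 n) λ f → 0≤form (𝓕₁ (inducedType G f)) (rooted G f) terms₁)
                     (∑-nonNeg (Defs.injections 3 n) λ f → 0≤form (𝓕₃ (inducedType G f)) (rooted G f) (typeTerms (inducedType G f))))
                (subst (0ℚ ≤_) (sym (weightedSum-def 𝓕₀ _ G)) (∑-nonNeg (allFin (size 𝓕₀)) λ i →
                  0≤* (0≤* (subst (_≤ ι (slack ! bitsOf (Flag.underlying (rep 𝓕₀ i)))) ι-0 (ι-mono (Evaluation.0≤slack (bitsOf (Flag.underlying (rep 𝓕₀ i))))))
                           (0≤* 0≤ρ (ℚ.nonNegative⁻¹ (ℤ.+ 1 / 240)))) (0≤ιℕ (P (rep 𝓕₀ i) (unlabelled G)))))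

    -- Every 5-subset contributes `u` minus the indicator that it induces the pattern, grouped by
    -- isomorphism class on the left.
    deficit-copies : deficit G ≡ u * ιℕ (n C 5) - ιℕ (P (unlabelled C₄-pendant) (unlabelled G))
    deficit-copies = *-cancelˡ-≡ (ιℕ 120) (0<ιℕ 119) (begin
      ιℕ 120 * deficit G
        ≡⟨ deficit-Ω G ⟩
      Ω (λ b → u - ½ * ι (embeddings ! b))
        ≡⟨ trans (∑-cong T λ t → solve 3 (λ d u e → d :* (u :- con ½ :* e) := d :* u :- con ½ :* (d :* e)) refl (distinct t) u (ι (embeddings ! bits (adj G) t)))
             (trans (∑-- T _ _) (cong₂ _-_ (∑-*ʳ T distinct u) (∑-*ˡ T ½ _))) ⟩
      ∑ T distinct * u - ½ * Ω (λ b → ι (embeddings ! b))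
        ≡⟨ cong₂ (λ x y → x * u - ½ * y) (∑-distinct {n} 5) (sym (copies-C₄-pendant G)) ⟩
      (ιℕ 120 * c) * u - ½ * (ιℕ 240 * p)
        ≡⟨ cong (λ z → (ιℕ 120 * c) * u - ½ * (z * p)) (trans (ιℕ-* 2 120) (cong (_* ιℕ 120) (ι-def (ℤ.+ 2)))) ⟩
      (ιℕ 120 * c) * u - ½ * ((ℤ.+ 2 / 1 * ιℕ 120) * p)
        ≡⟨ solve 4 (λ a c u p → (a :* c) :* u :- con ½ :* ((con (ℤ.+ 2 / 1) :* a) :* p) := a :* (u :* c :- p)) refl (ιℕ 120) c u p ⟩
      ιℕ 120 * (u * c - p) ∎)
      where
      open ≡-Reasoning
      open +-*-Solver using (solve; con; _:=_; _:*_; _:-_)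
      T = vectors (allFin n) 5
      Ω = ∑-injective (adj G) (adj-sym G)
      c = ιℕ (n C 5)
      p = ιℕ (P (unlabelled C₄-pendant) (unlabelled G))

  errorBound : ℚ
  errorBound = (ρ * (ℤ.+ 1 / 240)) * (ℤ.+ 10 / 1 * (ιℕ 240 * bound (λ b → ι (term₃ b)) + ιℕ 60 * bound (λ b → ι (term₁ b))))

  max≤u+ε : ∀ ε → 0ℚ < ε → ∃ λ n₀ → ∀ n (5≤n : 5 ℕ.≤ n) → n₀ ℕ.≤ n → maxDensity C₄-pendant n 5≤n ≤ u + ε
  -- Since `120 (n C 5)` is at least `(n - 10) n⁴`, for `n ≥ 10 + m` it is at least `m n⁴`; and `m`
  -- is chosen with `ε m ≥ 120 errorBound`.
  max≤u+ε ε 0<ε = 10 ℕ.+ m , λ n 5≤n n₀≤n → max≤ C₄-pendant 5≤n 0≤u+ε (λ G → each G 5≤n n₀≤n)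
    where
    instance
      ε-pos : Positive ε
      ε-pos = positive 0<ε
      ε-nonZero : NonZero ε
      ε-nonZero = ℚ.pos⇒nonZero ε
    e = ℤ.+ 120 / 1 * errorBound
    m = proj₁ (ceiling (e * 1/ ε))
    e≤εm : e ≤ ε * ιℕ m
    e≤εm = ℚ.≤-trans (ℚ.≤-reflexive (sym (trans (solve 3 (λ x y z → x :* (y :* z) := y :* (x :* z)) refl ε e (1/ ε))
        (trans (cong (e *_) (ℚ.*-inverseʳ ε)) (ℚ.*-identityʳ e)))))
      (*-monoˡ ε (ℚ.<⇒≤ 0<ε) (proj₂ (ceiling (e * 1/ ε))))
      where open +-*-Solver using (solve; con; _:=_; _:*_)
    0≤u+ε : 0ℚ ≤ u + ε
    0≤u+ε = 0≤+ (ℚ.nonNegative⁻¹ u) (ℚ.<⇒≤ 0<ε)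
    each : ∀ {n} (G : Graph n) (5≤n : 5 ℕ.≤ n) → 10 ℕ.+ m ℕ.≤ n → density C₄-pendant G 5≤n ≤ u + ε
    each {n} G 5≤n n₀≤n = ℚ.*-cancelʳ-≤-pos c {{positive (0<C 5≤n)}} (begin
      density C₄-pendant G 5≤n * c
        ≡⟨ density-C C₄-pendant G 5≤n ⟩
      p
        ≡⟨ trans (solve 2 (λ p x → p := x :- (x :- p)) refl p (u * c)) (cong (λ z → u * c - z) (sym (deficit-copies G))) ⟩
      u * c - deficit G
        ≤⟨ ℚ.+-monoʳ-≤ (u * c) (ℚ.neg-antimono-≤ lower) ⟩
      u * c - - (errorBound * N)
        ≤⟨ ℚ.+-monoʳ-≤ (u * c) (ℚ.≤-trans (ℚ.≤-reflexive (solve 1 (λ x → :- (:- x) := x) refl (errorBound * N))) errorBound≤) ⟩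
      u * c + ε * c
        ≡⟨ ℚ.*-distribʳ-+ c u ε ⟨
      (u + ε) * c ∎)
      where
      open ℚ.≤-Reasoning
      open +-*-Solver using (solve; con; _:=_; _:*_; _:-_; _:+_; :-_)
      c = ιℕ (n C 5)
      N = ιℕ (n ℕ.^ 4)
      p = ιℕ (P (unlabelled C₄-pendant) (unlabelled G))
      rhs = (sum₁ G + sum₃ G) + slacks G
      lower : - (errorBound * N) ≤ deficit G
      lower = begin
        - (errorBound * N)
          ≤⟨ ℚ.neg-antimono-≤ (certificate-error G) ⟩
        - ∣ deficit G - rhs ∣
          ≤⟨ ℚ.neg-antimono-≤ (ℚ.≤-trans (a≤∣a∣ (- (deficit G - rhs))) (ℚ.≤-reflexive (ℚ.∣-p∣≡∣p∣ (deficit G - rhs)))) ⟩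
        - (- (deficit G - rhs))
          ≡⟨ solve 2 (λ x y → :- (:- (x :- y)) := x :- y) refl (deficit G) rhs ⟩
        deficit G - rhs
          ≤⟨ ℚ.+-monoʳ-≤ (deficit G) (ℚ.neg-antimono-≤ (0≤rhs G)) ⟩
        deficit G - 0ℚ
          ≡⟨ ℚ.+-identityʳ (deficit G) ⟩
        deficit G ∎
      -- All 5-tuples minus those with a repetition, of which there are at most `10 n⁴`.
      120c : ιℕ n * N - ℤ.+ 10 / 1 * N ≤ ℤ.+ 120 / 1 * c
      120c = begin
        ιℕ n * N - ℤ.+ 10 / 1 * N
          ≡⟨ cong₂ (λ x y → x - y) (sym (trans (∑-1 {n} 5) (ιℕ-* n (n ℕ.^ 4)))) (trans (cong (_* N) (sym (ι-def (ℤ.+ 10)))) (sym (ιℕ-* 10 (n ℕ.^ 4)))) ⟩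
        ∑ T (λ _ → 1ℚ) - ιℕ (10 ℕ.* n ℕ.^ 4)
          ≤⟨ ℚ.+-monoʳ-≤ (∑ T (λ _ → 1ℚ)) (ℚ.neg-antimono-≤ (∑-repeated {n} 4)) ⟩
        ∑ T (λ _ → 1ℚ) - ∑ T (λ t → 1ℚ - distinct t)
          ≡⟨ cong (λ z → ∑ T (λ _ → 1ℚ) - z) (∑-- T (λ _ → 1ℚ) distinct) ⟩
        ∑ T (λ _ → 1ℚ) - (∑ T (λ _ → 1ℚ) - ∑ T distinct)
          ≡⟨ solve 2 (λ x y → x :- (x :- y) := y) refl (∑ T (λ _ → 1ℚ)) (∑ T distinct) ⟩
        ∑ T distinct
          ≡⟨ trans (∑-distinct {n} 5) (cong (_* c) (ι-def (ℤ.+ 120))) ⟩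
        ℤ.+ 120 / 1 * c ∎
        where T = vectors (allFin n) 5
      errorBound≤ : errorBound * N ≤ ε * c
      errorBound≤ = ℚ.*-cancelˡ-≤-pos (ℤ.+ 120 / 1) (begin
        ℤ.+ 120 / 1 * (errorBound * N)
          ≡⟨ ℚ.*-assoc (ℤ.+ 120 / 1) errorBound N ⟨
        e * N
          ≤⟨ *-monoʳ N (0≤ιℕ (n ℕ.^ 4)) e≤εm ⟩
        (ε * ιℕ m) * N
          ≡⟨ solve 3 (λ e m n → (e :* m) :* n := e :* (((con (ℤ.+ 10 / 1) :+ m) :* n) :- con (ℤ.+ 10 / 1) :* n)) refl ε (ιℕ m) N ⟩
        ε * ((ℤ.+ 10 / 1 + ιℕ m) * N - ℤ.+ 10 / 1 * N)
          ≡⟨ cong (λ z → ε * (z * N - ℤ.+ 10 / 1 * N)) (trans (cong (_+ ιℕ m) (sym (ι-def (ℤ.+ 10)))) (sym (ιℕ-+ 10 m))) ⟩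
        ε * (ιℕ (10 ℕ.+ m) * N - ℤ.+ 10 / 1 * N)
          ≤⟨ *-monoˡ ε (ℚ.<⇒≤ 0<ε) (ℚ.≤-trans (ℚ.+-monoˡ-≤ (- (ℤ.+ 10 / 1 * N)) (*-monoʳ N (0≤ιℕ (n ℕ.^ 4)) (ιℕ-mono n₀≤n))) 120c) ⟩
        ε * (ℤ.+ 120 / 1 * c)
          ≡⟨ solve 2 (λ e c → e :* (con (ℤ.+ 120 / 1) :* c) := con (ℤ.+ 120 / 1) :* (e :* c)) refl ε c ⟩
        ℤ.+ 120 / 1 * (ε * c) ∎)

-- Transfer to Cauchy reals, and assembly of the theorem.

open import Defs hiding (_*_)
open import Data.Integer using (+_)
open import Data.Nat using (_^_; _*_; _≤?_)
open import Data.Product using (Σ-syntax; _×_)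
open import Data.Rational using (_/_)
open import Relation.Binary.PropositionalEquality using (_≡_)
open import Relation.Nullary using (¬_)
open import Relation.Nullary.Decidable using (from-yes)

open import Data.Bool using (Bool; true; false; T)
import Data.Bool.Properties as Bool
open import Data.Empty using (⊥; ⊥-elim-irr)
open import Data.Fin as Fin using (Fin; zero; suc; #_)
import Data.Fin.Properties as Fin
open import Data.Fin.Subset as Subset using ()
open import Data.Integer as ℤ using (ℤ)
open import Data.List as List using (List; []; _∷_; allFin)
open import Data.List.Relation.Unary.All as All using (All; []; _∷_)
import Data.List.Relation.Unary.All.Properties as All
open import Data.Nat as ℕ using (ℕ; zero; suc; s≤s)
import Data.Nat.Properties as ℕ
open import Data.Product using (∃; ∃!; _,_; proj₁; proj₂)
open import Data.Rational as ℚ using (ℚ; 0ℚ; 1ℚ)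
import Data.Rational.Properties as ℚ
open import Data.Rational.Solver using (module +-*-Solver)
open import Data.Sum using (inj₁; inj₂)
open import Data.Unit using (⊤; tt)
open import Data.Vec as Vec using (Vec; []; _∷_; lookup)
open import Relation.Binary.PropositionalEquality using (refl; sym; trans; cong; cong₂; subst)
open import Relation.Nullary using (contradiction)
open import Relation.Nullary.Decidable using (_→-dec_; _×-dec_)
open Graph using (adj)
open Flag using (underlying; roots)
open Representatives using (size; rep)
open ℝ using (seq)
open Sums
open Tuples using (_∉?_)
open Isomorphism
open Tables using (gram; terms₁; termsν; termsσ; termsμ; index₃; terms₃; slack; denominator; _!_)
open Evaluation using (0≤slack)
open Representation
open FiveVertices
open Identity
open Forms
open Bounds

private variable
  k m n q s : ℕ

-- Real numbers from their rational approximations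

≤-pointwise : ∀ {x y} → (∀ n → seq x n ℚ.≤ seq y n) → x ≤ y
≤-pointwise {x} {y} p = ≤-intro λ ε 0<ε → 0 , λ n _ → ℚ.≤-trans (p n)
  (ℚ.≤-trans (ℚ.≤-reflexive (sym (ℚ.+-identityʳ (seq y n)))) (ℚ.+-monoʳ-≤ (seq y n) (ℚ.<⇒≤ 0<ε)))

≈-pointwise : ∀ {x y} → (∀ n → seq x n ≡ seq y n) → x ≈ y
≈-pointwise {x} {y} p = ≤-pointwise {x} {y} (λ n → ℚ.≤-reflexive (p n)) , ≤-pointwise {y} {x} (λ n → ℚ.≤-reflexive (sym (p n)))

≈⇒null : ∀ {x} → x ≈ 0ℝ → Null (seq x)
≈⇒null {x} (x≤0 , 0≤x) ε 0<ε =
  let (M , below) = _≤_.≤-elim x≤0 ε 0<ε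
      (N , above) = _≤_.≤-elim 0≤x ε 0<ε
  in M ℕ.⊔ N , λ n ≤n → bounded (seq x n)
       (ℚ.≤-trans (below n (ℕ.m⊔n≤o⇒m≤o M N ≤n)) (ℚ.≤-reflexive (ℚ.+-identityˡ ε))) (above n (ℕ.m⊔n≤o⇒n≤o M N ≤n))
  where
  open +-*-Solver using (solve; _:=_; _:+_; :-_; _:-_)
  bounded : ∀ {ε} a → a ℚ.≤ ε → 0ℚ ℚ.≤ a ℚ.+ ε → ℚ.∣ a ∣ ℚ.≤ ε
  bounded {ε} a a≤ε 0≤a+ε with ℚ.∣p∣≡p∨∣p∣≡-p a
  ... | inj₁ e = subst (ℚ._≤ ε) (sym e) a≤ε
  ... | inj₂ e = subst (ℚ._≤ ε) (sym e) (ℚ.≤-trans (ℚ.≤-reflexive (sym (ℚ.+-identityʳ (ℚ.- a))))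
    (ℚ.≤-trans (ℚ.+-monoʳ-≤ (ℚ.- a) 0≤a+ε) (ℚ.≤-reflexive (solve 2 (λ a e → (:- a) :+ (a :+ e) := e) refl a ε))))

null⇒≈ : ∀ {x y} → Null (λ n → seq x n ℚ.- seq y n) → x ≈ y
null⇒≈ {x} {y} null = (≤-intro λ ε 0<ε → let (N , small) = null ε 0<ε in N , λ n N≤n → close (seq x n) (seq y n) (small n N≤n))
                    , (≤-intro λ ε 0<ε → let (N , small) = null ε 0<ε in N , λ n N≤n → close (seq y n) (seq x n)
                        (subst (ℚ._≤ ε) (trans (sym (ℚ.∣-p∣≡∣p∣ (seq x n ℚ.- seq y n))) (cong ℚ.∣_∣ (flip (seq x n) (seq y n)))) (small n N≤n)))
  where
  open +-*-Solver using (solve; _:=_; _:+_; :-_; _:-_)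
  flip : ∀ a b → ℚ.- (a ℚ.- b) ≡ b ℚ.- a
  flip = solve 2 (λ a b → :- (a :- b) := b :- a) refl
  close : ∀ {ε} a b → ℚ.∣ a ℚ.- b ∣ ℚ.≤ ε → a ℚ.≤ b ℚ.+ ε
  close {ε} a b p = ℚ.≤-trans (ℚ.≤-reflexive (solve 2 (λ a b → a := b :+ (a :- b)) refl a b))
    (ℚ.+-monoʳ-≤ b (ℚ.≤-trans (a≤∣a∣ (a ℚ.- b)) p))

seq-sumOver : {A : Set} (xs : List A) (f : A → ℝ) → ∀ n → seq (sumOver xs f) n ≡ ∑ xs λ x → seq (f x) n
seq-sumOver []       f n = refl
seq-sumOver (x ∷ xs) f n = cong (seq (f x) n ℚ.+_) (seq-sumOver xs f n)

seq-· : (v w : Vector k) → ∀ n → seq (v · w) n ≡ ∑ (allFin k) λ i → seq (v i) n ℚ.* seq (w i) n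
seq-· {k} v w = seq-sumOver (allFin k) λ i → Defs._*_ (v i) (w i)

seq-·⊡ : (v : Vector k) (X : Matrix k) → ∀ n →
  seq (v · (X ⊡ v)) n ≡ ∑ (allFin k) λ i → seq (v i) n ℚ.* ∑ (allFin k) λ j → seq (X i j) n ℚ.* seq (v j) n
seq-·⊡ {k} v X n = trans (seq-· v (X ⊡ v) n) (∑-cong (allFin k) λ i → cong (seq (v i) n ℚ.*_) (seq-· (X i) v n))

-- Matrices from the certificate data

gramMatrix : List (ℕ × Vec ℤ k) → Matrix k
gramMatrix ts i j = fromℚ (ι (gram ts i j) ℚ.* ρ)

gramMatrix-psd : ∀ (ts : List (ℕ × Vec ℤ k)) → PositiveSemidefinite (gramMatrix ts)
gramMatrix-psd ts =
  (λ i j → ≈-pointwise {gramMatrix ts i j} {gramMatrix ts j i} λ n → cong (λ z → ι z ℚ.* ρ) (gram-sym ts i j)) ,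
  (λ v → ≤-pointwise {0ℝ} {v · (gramMatrix ts ⊡ v)} λ n → subst (0ℚ ℚ.≤_) (sym (seq-·⊡ v (gramMatrix ts) n)) (gram-positive ρ 0≤ρ (λ i → seq (v i) n) ts))

entries : Vector k → ℕ → Fin k → ℚ
entries v n i = seq (v i) n

seq-row : ∀ (ts : List (ℕ × Vec ℤ k)) v i n → seq ((gramMatrix ts ⊡ v) i) n ≡ ρ ℚ.* dot (Vec.tabulate (gram ts i)) (entries v n)
seq-row {k} ts v i n = trans (seq-· (gramMatrix ts i) v n) (trans
  (∑-cong (allFin k) λ j → solve 3 (λ a r x → (a :* r) :* x := r :* (a :* x)) refl (ι (gram ts i j)) ρ (seq (v j) n))
  (trans (∑-*ˡ (allFin k) ρ _) (cong (ρ ℚ.*_) (sym (dot-tabulate (gram ts i) (entries v n))))))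
  where open +-*-Solver using (solve; _:=_; _:*_)

kernel⇒null : ∀ (ts : List (ℕ × Vec ℤ k)) {v} → Kernel (gramMatrix ts) v → All (NullForm (entries v)) (rows ts)
kernel⇒null {k} ts {v} ker = All.map⁺ (All.universal row (allFin k))
  where
  row : ∀ i → NullForm (entries v) (Vec.tabulate (gram ts i))
  -- Multiplication by `denominator` cancels `ρ` and leaves the integer row.
  row i = null-cong (λ n → trans (cong (ιℕ denominator ℚ.*_) (seq-row ts v i n))
      (trans (sym (ℚ.*-assoc (ιℕ denominator) ρ (dot (Vec.tabulate (gram ts i)) (entries v n))))
        (trans (cong (ℚ._* dot (Vec.tabulate (gram ts i)) (entries v n)) denominator*ρ) (ℚ.*-identityˡ (dot (Vec.tabulate (gram ts i)) (entries v n))))))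
    (null-ιℕ denominator (≈⇒null {(gramMatrix ts ⊡ v) i} (ker i)))

-- A linear form that vanishes at b and expresses the coordinate suc i through the first one.
relation : ℕ → Vec ℤ m → Fin m → Vec ℤ (suc m)
relation c b i = + suc c *ᵛ unit (suc i) +ᵛ (ℤ.- lookup b i) *ᵛ unit zero

-- The relations express every coordinate of a kernel vector through the first one, where the
-- integer vector `(c + 1 , b)` has a non-zero entry; so that vector spans the kernel.
kernel-dimension : ∀ (ts : List (ℕ × Vec ℤ (suc m))) c b →
  (∀ i → dotℤ (Vec.tabulate (gram ts i)) (+ suc c ∷ b) ≡ + 0) →
  (∀ {x} → All (NullForm x) (rows ts) → ∀ i → NullForm x (relation c b i)) →
  HasDimension (Kernel (gramMatrix ts)) 1
kernel-dimension {m} ts c b b-zero relations = basis , (λ { zero → basis-kernel }) , independent , spanning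
  where
  open +-*-Solver using (solve; con; _:=_; _:*_; _:+_; _:-_)
  b′ = + suc c ∷ b
  basis : Fin 1 → Vector (suc m)
  basis _ i = fromℚ (ι (lookup b′ i))
  basis-kernel : Kernel (gramMatrix ts) (basis zero)
  basis-kernel i = ≈-pointwise {(gramMatrix ts ⊡ basis zero) i} {0ℝ} λ n → trans (seq-row ts (basis zero) i n)
    (trans (cong (ρ ℚ.*_) (trans (dot-ι (Vec.tabulate (gram ts i)) b′) (trans (cong ι (b-zero i)) ι-0))) (ℚ.*-zeroʳ ρ))
  independent : ∀ a → combination a basis ≋ 𝟎ᵛ → a ≋ 𝟎ᵛ
  independent a e zero = null⇒≈ {a zero} {0ℝ} (null-÷ c (null-cong
    (λ n → solve 2 (λ a b → a :* b :+ con 0ℚ := b :* (a :- con 0ℚ)) refl (seq (a zero) n) (ιℕ (suc c)))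
    (≈⇒null {combination a basis zero} (e zero))))
  r : ℚ
  r = + 1 / suc c
  r-inverse : ιℕ (suc c) ℚ.* r ≡ 1ℚ
  r-inverse = trans (cong (ℚ._* r) (ι-def (+ suc c))) (trans (ℚ.*-comm (+ suc c / 1) r) (trans (sym (cong (r ℚ.*_) (ι-def (+ suc c)))) (trans (quotient 1 (suc c)) ι-1)))
  spanning : ∀ v → Kernel (gramMatrix ts) v → ∃ λ a → v ≋ combination a basis
  spanning v ker = a , λ i → null⇒≈ {v i} {combination a basis i} (null-÷ c (null-cong (rearrange i) (form i)))
    where
    a : Vector 1
    -- Forced by the first coordinate, in which the basis vector has the entry `c + 1`.
    a _ = Defs._*_ (v zero) (fromℚ r)
    v₀ = λ n → seq (v zero) n
    form : ∀ i → Null λ n → ιℕ (suc c) ℚ.* seq (v i) n ℚ.- ι (lookup b′ i) ℚ.* seq (v zero) n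
    form zero = null-cong (λ n → solve 2 (λ c v → con 0ℚ := c :* v :- c :* v) refl (ιℕ (suc c)) (v₀ n)) null-0
    form (suc i) = null-cong
      (λ n → trans (dot-+ᵛ (+ suc c *ᵛ unit (suc i)) ((ℤ.- lookup b i) *ᵛ unit zero) (entries v n))
        (trans (cong₂ ℚ._+_ (trans (dot-*ᵛ (+ suc c) (unit (suc i)) (entries v n)) (cong (ιℕ (suc c) ℚ.*_) (dot-unit (suc i) (entries v n))))
          (trans (dot-*ᵛ (ℤ.- lookup b i) (unit zero) (entries v n)) (cong₂ ℚ._*_ (ι-neg (lookup b i)) (dot-unit zero (entries v n)))))
        (cong (ιℕ (suc c) ℚ.* seq (v (suc i)) n ℚ.+_) (sym (ℚ.neg-distribˡ-* (ι (lookup b i)) (v₀ n))))))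
      (relations (kernel⇒null ts {v} ker) i)
    rearrange : ∀ i n → ιℕ (suc c) ℚ.* seq (v i) n ℚ.- ι (lookup b′ i) ℚ.* v₀ n ≡
                        ιℕ (suc c) ℚ.* (seq (v i) n ℚ.- seq (combination a basis i) n)
    rearrange i n = trans (cong (λ z → ιℕ (suc c) ℚ.* seq (v i) n ℚ.- ι (lookup b′ i) ℚ.* z)
        (trans (sym (ℚ.*-identityʳ (v₀ n))) (cong (v₀ n ℚ.*_) (sym r-inverse))))
      (solve 5 (λ c x y v r → c :* x :- y :* (v :* (c :* r)) := c :* (x :- ((v :* r) :* y :+ con 0ℚ))) refl
        (ιℕ (suc c)) (seq (v i) n) (ι (lookup b′ i)) (v₀ n) r)

-- Two rounds of deduction: from the rows to the squared forms, and from these to the relations.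
relations-of : ∀ {x} (ts : List (ℕ × Vec ℤ (suc m))) c b (ds rs : List (Rule (suc m))) →
  All (Valid (rows ts)) ds → All (Valid (List.map conclusion ds)) rs →
  List.map conclusion rs ≡ List.map (relation c b) (allFin m) →
  All (NullForm x) (rows ts) → ∀ i → NullForm x (relation c b i)
relations-of {m} {x} ts c b ds rs ds-valid rs-valid e nulls i =
  All.lookup (All.map⁻ (subst (All (NullForm x)) e (deduce x (deduce x nulls ds-valid) rs-valid))) (Data.List.Membership.Propositional.Properties.∈-allFin i)
  where import Data.List.Membership.Propositional.Properties

-- The multipliers

private
  ¬admissible-0 : Admissible 5 0 → ⊥
  ¬admissible-0 (() , _)

  ¬admissible-2 : Admissible 5 2 → ⊥
  ¬admissible-2 (_ , _ , ())

  ¬admissible-4+ : Admissible 5 (suc (suc (suc (suc q)))) → ⊥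
  ¬admissible-4+ (_ , s≤s (s≤s (s≤s ())) , _)

family : .(Admissible 5 q) → (τ : Graph q) → Representatives τ ((5 ℕ.+ q) ℕ./ 2)
family {0} a τ = ⊥-elim-irr (¬admissible-0 a)
family {1} a τ = 𝓕₁ τ
family {2} a τ = ⊥-elim-irr (¬admissible-2 a)
family {3} a τ = 𝓕₃ τ
family {suc (suc (suc (suc q)))} a τ = ⊥-elim-irr (¬admissible-4+ a)

matrix : .(a : Admissible 5 q) (τ : Graph q) → Matrix (size (family a τ))
matrix {0} a τ = ⊥-elim-irr (¬admissible-0 a)
matrix {1} a τ = gramMatrix terms₁
matrix {2} a τ = ⊥-elim-irr (¬admissible-2 a)
matrix {3} a τ = gramMatrix (typeTerms τ)
matrix {suc (suc (suc (suc q)))} a τ = ⊥-elim-irr (¬admissible-4+ a)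

matrix-psd : .(a : Admissible 5 q) (τ : Graph q) → PositiveSemidefinite (matrix a τ)
matrix-psd {0} a τ = ⊥-elim-irr (¬admissible-0 a)
matrix-psd {1} a τ = gramMatrix-psd terms₁
matrix-psd {2} a τ = ⊥-elim-irr (¬admissible-2 a)
matrix-psd {3} a τ = gramMatrix-psd (typeTerms τ)
matrix-psd {suc (suc (suc (suc q)))} a τ = ⊥-elim-irr (¬admissible-4+ a)

-- The arguments are the adjacencies 01, 02 and 12 of the type.
isListed : Bool → Bool → Bool → Bool
isListed true  true  false = true
isListed false false false = true
isListed true  false false = true
isListed true  true  true  = true
isListed _     _     _     = false

listed₃ : Graph 3 → Bool
listed₃ τ = isListed (adj τ (# 0) (# 1)) (adj τ (# 0) (# 2)) (adj τ (# 1) (# 2))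

-- A single vertex carries only one graph, so size 1 needs no selection. On three vertices the
-- triangle is listed as well, with the zero matrix, because every class must have a listed member.
IsListed : Graph q → Set
IsListed {3} τ = T (listed₃ τ)
IsListed     τ = ⊤

-- All labelled graphs on three vertices, so that existence and uniqueness of listed types become
-- finite searches.
type₃ : Fin 8 → Graph 3
type₃ i = graph₃ (lookup (bits₃ i) (# 0)) (lookup (bits₃ i) (# 1)) (lookup (bits₃ i) (# 2))

type₃-surjective : ∀ τ → ∃ λ i → type₃ i ≡ τ
type₃-surjective τ = index₃ a b c , trans
  (cong (λ v → graph₃ (lookup v (# 0)) (lookup v (# 1)) (lookup v (# 2))) (bits₃-index₃ a b c))
  (graph-extensional λ i j → trans (sym (adj-graph₃ τ (# 0) (# 1) (# 2) i j)) (cong₂ (adj τ) (at i) (at j)))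
  where
  a = adj τ (# 0) (# 1)
  b = adj τ (# 0) (# 2)
  c = adj τ (# 1) (# 2)
  at : ∀ i → lookup (# 0 ∷ # 1 ∷ # 2 ∷ []) i ≡ i
  at zero             = refl
  at (suc zero)       = refl
  at (suc (suc zero)) = refl

opaque

  listed-exists : ∀ i → ∃ λ j → T (listed₃ (type₃ j)) × unlabelled (type₃ i) ≅ unlabelled (type₃ j)
  listed-exists = from-yes (Fin.all? λ i → Fin.any? λ j → Bool.T? (listed₃ (type₃ j)) ×-dec (unlabelled (type₃ i) ≅ unlabelled (type₃ j) [ Subset.⊤ ]?))

  listed-separate : ∀ i j → T (listed₃ (type₃ i)) → T (listed₃ (type₃ j)) → unlabelled (type₃ i) ≅ unlabelled (type₃ j) → i ≡ j
  listed-separate = from-yes (Fin.all? λ i → Fin.all? λ j → Bool.T? (listed₃ (type₃ i)) →-dec (Bool.T? (listed₃ (type₃ j)) →-dec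
    ((unlabelled (type₃ i) ≅ unlabelled (type₃ j) [ Subset.⊤ ]?) →-dec (i Fin.≟ j))))

IsListed-unique : .(Admissible 5 q) → (τ : Graph q) → ∃! _≡_ λ τ′ → IsListed τ′ × unlabelled τ ≅ unlabelled τ′
IsListed-unique {0} a τ = ⊥-elim-irr (¬admissible-0 a)
IsListed-unique {1} a τ = τ , (tt , ≅-refl (unlabelled τ)) , λ {τ′} _ → graph-extensional λ { zero zero → trans (adj-irrefl τ zero) (sym (adj-irrefl τ′ zero)) }
IsListed-unique {2} a τ = ⊥-elim-irr (¬admissible-2 a)
IsListed-unique {3} a τ with type₃-surjective τ
... | i , refl = let (j , listed , iso) = listed-exists i in
  type₃ j , (listed , iso) , λ {τ′} (listed′ , iso′) → unique (listed-exists i) τ′ listed′ iso′ (type₃-surjective τ′)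
  where
  unique : ∀ ((j , _) : ∃ λ j → T (listed₃ (type₃ j)) × unlabelled (type₃ i) ≅ unlabelled (type₃ j)) τ′ →
           T (listed₃ τ′) → unlabelled (type₃ i) ≅ unlabelled τ′ → (∃ λ k → type₃ k ≡ τ′) → type₃ j ≡ τ′
  unique (j , listed , iso) _ listed′ iso′ (k , refl) = cong type₃ (listed-separate j k listed listed′
    (≅-trans (unlabelled (type₃ j)) (unlabelled (type₃ i)) (unlabelled (type₃ k)) (≅-sym (unlabelled (type₃ i)) (unlabelled (type₃ j)) iso) iso′))
IsListed-unique {suc (suc (suc (suc q)))} a τ = ⊥-elim-irr (¬admissible-4+ a)

unlisted-terms : ∀ a b c → ¬ T (isListed a b c) → terms₃ a b c ≡ []
unlisted-terms true  true  true  ¬l = refl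
unlisted-terms true  true  false ¬l = contradiction tt ¬l
unlisted-terms true  false true  ¬l = refl
unlisted-terms true  false false ¬l = contradiction tt ¬l
unlisted-terms false true  true  ¬l = refl
unlisted-terms false true  false ¬l = refl
unlisted-terms false false true  ¬l = refl
unlisted-terms false false false ¬l = contradiction tt ¬l

matrix-unlisted : .(a : Admissible 5 q) (τ : Graph q) → ¬ IsListed τ → ∀ i j → matrix a τ i j ≈ 0ℝ
matrix-unlisted {0} a τ = ⊥-elim-irr (¬admissible-0 a)
matrix-unlisted {1} a τ ¬listed = contradiction tt ¬listed
matrix-unlisted {2} a τ = ⊥-elim-irr (¬admissible-2 a)
matrix-unlisted {3} a τ ¬listed i j = ≈-pointwise {gramMatrix (typeTerms τ) i j} {0ℝ} λ n →
  trans (cong (λ ts → ι (gram ts i j) ℚ.* ρ) (unlisted-terms _ _ _ ¬listed)) (trans (cong (ℚ._* ρ) (trans (cong ι (Tables.gram-[] i j)) ι-0)) (ℚ.*-zeroˡ ρ))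
matrix-unlisted {suc (suc (suc (suc q)))} a τ = ⊥-elim-irr (¬admissible-4+ a)

multipliers : Multipliers 5
multipliers = record
  { 𝓕⁰            = 𝓕₀
  ; 𝓕             = family
  ; X             = matrix
  ; X-psd         = matrix-psd
  ; Listed        = IsListed
  ; listed-unique = IsListed-unique
  ; X-unlisted    = matrix-unlisted
  ; c             = λ i → fromℚ (ι (slack ! bitsOf (underlying (rep 𝓕₀ i))) ℚ.* (ρ ℚ.* (+ 1 / 240)))
  ; c-nonNegative = λ i → ≤-pointwise {0ℝ} {fromℚ (ι (slack ! bitsOf (underlying (rep 𝓕₀ i))) ℚ.* (ρ ℚ.* (+ 1 / 240)))} λ _ →
      0≤* (subst (ℚ._≤ ι (slack ! bitsOf (underlying (rep 𝓕₀ i)))) ι-0 (ι-mono (0≤slack (bitsOf (underlying (rep 𝓕₀ i))))))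
          (0≤* 0≤ρ (ℚ.nonNegative⁻¹ (+ 1 / 240)))
  }

-- The certificate

module _ (G : Graph n) where

  private
    a₁ = from-yes (admissible? 5 1)
    a₃ = from-yes (admissible? 5 3)

  seq-counts : ∀ {τ : Graph q} (R : Representatives τ s) (K : Flag τ n) i m → seq (counts R K i) m ≡ ιℕ (P (rep R i) K)
  seq-counts R K i m = sym (ι-def (+ P (rep R i) K))

  -- Opaque, so that the vector of a quadratic term is found by unification, without comparing counts.
  opaque

    realForm : Vector k → Matrix k → ℕ → ℚ
    realForm V Y m = seq (V · (Y ⊡ V)) m

    realForm-def : (V : Vector k) (Y : Matrix k) → ∀ m → seq (V · (Y ⊡ V)) m ≡ realForm V Y m
    realForm-def V Y m = refl

    realForm-counts : ∀ {τ : Graph q} (R : Representatives τ s) (K : Flag τ n) (V : Vector (size R)) (Y : Matrix (size R)) m →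
      (∀ i → seq (V i) m ≡ ιℕ (P (rep R i) K)) → realForm V Y m ≡ quadraticForm R K (λ i j → seq (Y i j) m)
    realForm-counts R K V Y m e = trans (seq-·⊡ V Y m) (trans
      (∑-cong (allFin (size R)) λ i → cong₂ ℚ._*_ (e i) (∑-cong (allFin (size R)) λ j → cong (seq (Y i j) m ℚ.*_) (e j)))
      (sym (quadraticForm-def R K (λ i j → seq (Y i j) m))))

  seq-lhs-general : ∀ {κ N} (F : Graph κ) (κ≤N : κ ℕ.≤ N) (v : ℚ) (M : Multipliers N) → ∀ m →
    seq (lhs F κ≤N (fromℚ v) M G) m ≡ weightedDeficit F κ≤N v (Multipliers.𝓕⁰ M) G
  seq-lhs-general F κ≤N v M m = trans (seq-sumOver (allFin (size R)) _ m)
    (trans (∑-cong (allFin (size R)) λ i → cong ((v ℚ.- density F (underlying (rep R i)) κ≤N) ℚ.*_) (seq-counts R (unlabelled G) i m))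
           (sym (weightedDeficit-def F κ≤N v R G)))
    where R = Multipliers.𝓕⁰ M

  seq-lhs : ∀ m → seq (lhs C₄-pendant (from-yes (5 ≤? 5)) (fromℚ u) multipliers G) m ≡ deficit G
  seq-lhs = seq-lhs-general C₄-pendant (from-yes (5 ≤? 5)) u multipliers

  module _ {N} (M : Multipliers N) (m : ℕ) where

    open Multipliers M

    value : ∃ (Admissible N) → ℚ
    value (q , a) = ∑ (injections q n) λ f → quadraticForm (𝓕 a (inducedType G f)) (rooted G f) (λ i j → seq (X a (inducedType G f) i j) m)

    private
      recognised : .(a : Admissible N q) (f : Injection q n) → ∃ λ (V : Vector (size (𝓕 a (inducedType G f)))) →
        seq (quadraticTerm a G f) m ≡ realForm V (X a (inducedType G f)) m ×
        (∀ i → seq (V i) m ≡ ιℕ (P (rep (𝓕 a (inducedType G f)) i) (rooted G f)))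
      recognised a f = _ , realForm-def _ _ m , λ i → seq-counts (𝓕 a (inducedType G f)) (rooted G f) i m

    seq-quadraticTerm : .(a : Admissible N q) (f : Injection q n) → seq (quadraticTerm a G f) m ≡
      quadraticForm (𝓕 a (inducedType G f)) (rooted G f) (λ i j → seq (X a (inducedType G f) i j) m)
    seq-quadraticTerm a f = let (V , e , counted) = recognised a f in
      trans e (realForm-counts (𝓕 a (inducedType G f)) (rooted G f) V (X a (inducedType G f)) m counted)

    summand : ∃ (Admissible N) → ℝ
    summand (q , a) = sumOver (injections q n) (quadraticTerm a G)

    seq-summand : ∀ x → seq (summand x) m ≡ value x
    seq-summand (q , a) = trans (seq-sumOver (injections q n) (quadraticTerm a G) m)
      (∑-cong (injections q n) λ f → seq-quadraticTerm a f)

    first second : ℝ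
    first  = sumOver (typeSizes N) summand
    second = sumOver (allFin (size 𝓕⁰)) λ i → Defs._*_ (c i) (copies G i)

    seq-first : seq first m ≡ ∑ (typeSizes N) value
    seq-first = trans (seq-sumOver (typeSizes N) summand m) (∑-cong (typeSizes N) seq-summand)

    seq-second : seq second m ≡ weightedSum 𝓕⁰ (λ i → seq (c i) m) G
    seq-second = trans (seq-sumOver (allFin (size 𝓕⁰)) (λ i → Defs._*_ (c i) (copies G i)) m)
      (trans (∑-cong (allFin (size 𝓕⁰)) λ i → cong (seq (c i) m ℚ.*_) (seq-counts 𝓕⁰ (unlabelled G) i m))
             (sym (weightedSum-def 𝓕⁰ (λ i → seq (c i) m) G)))

    seq-rhs-general : ∀ {κ} (F : Graph κ) (κ≤N : κ ℕ.≤ N) (v : ℝ) → seq (rhs F κ≤N v M G) m ≡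
      ∑ (typeSizes N) value ℚ.+ weightedSum 𝓕⁰ (λ i → seq (c i) m) G
    seq-rhs-general F κ≤N v = cong₂ ℚ._+_ seq-first seq-second

  typeSizes-5 : typeSizes 5 ≡ (1 , a₁) ∷ (3 , a₃) ∷ []
  typeSizes-5 = refl

  seq-rhs : ∀ m → seq (rhs C₄-pendant (from-yes (5 ≤? 5)) (fromℚ u) multipliers G) m ≡ (sum₁ G ℚ.+ sum₃ G) ℚ.+ slacks G
  seq-rhs m = trans (seq-rhs-general multipliers m C₄-pendant (from-yes (5 ≤? 5)) (fromℚ u)) (cong (ℚ._+ slacks G)
    (trans (cong (λ ts → ∑ ts (value multipliers m)) typeSizes-5)
      (cong (sum₁ G ℚ.+_) (ℚ.+-identityʳ (sum₃ G)))))

certificate : IsCertificate C₄-pendant (from-yes (5 ≤? 5)) (fromℚ u) multipliers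
-- The error bound holds for every `n`, hence the threshold 0. Both sides have constant
-- approximating sequences, so the inequality is checked index by index.
certificate = fromℚ errorBound , 0 , λ {n} G _ →
  ≤-pointwise {∣ lhs′ G - rhs′ G ∣} {Defs._*_ (fromℚ errorBound) (fromℕ (n ℕ.^ 4))} λ m →
    ℚ.≤-trans (ℚ.≤-reflexive (cong₂ (λ x y → ℚ.∣ x ℚ.- y ∣) (seq-lhs G m) (seq-rhs G m)))
      (ℚ.≤-trans (certificate-error G) (ℚ.≤-reflexive (cong (errorBound ℚ.*_) (ι-def (+ (n ℕ.^ 4))))))
  where
  lhs′ rhs′ : Graph n → ℝ
  lhs′ = lhs C₄-pendant (from-yes (5 ≤? 5)) (fromℚ u) multipliers
  rhs′ = rhs C₄-pendant (from-yes (5 ≤? 5)) (fromℚ u) multipliers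

inducibility : HasInducibility C₄-pendant (fromℚ u)
inducibility ε 0<ε = n₀ , λ n 5≤n n₀≤n →
  ≤-pointwise {∣ fromℚ (maxDensity C₄-pendant n 5≤n) - fromℚ u ∣} {fromℚ ε} λ _ →
    between (maxDensity C₄-pendant n 5≤n) (u≤max 5≤n) (bounded n 5≤n n₀≤n)
  where
  open +-*-Solver using (solve; _:=_; _:+_; :-_; _:-_)
  n₀ = proj₁ (max≤u+ε ε 0<ε)
  bounded = proj₂ (max≤u+ε ε 0<ε)
  between : ∀ d → u ℚ.≤ d → d ℚ.≤ u ℚ.+ ε → ℚ.∣ d ℚ.- u ∣ ℚ.≤ ε
  between d u≤d d≤u+ε = ℚ.≤-trans
    (ℚ.≤-reflexive (ℚ.0≤p⇒∣p∣≡p (ℚ.≤-trans (ℚ.≤-reflexive (sym (ℚ.+-inverseʳ u))) (ℚ.+-monoˡ-≤ (ℚ.- u) u≤d))))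
    (ℚ.≤-trans (ℚ.+-monoˡ-≤ (ℚ.- u) d≤u+ε) (ℚ.≤-reflexive (solve 2 (λ u e → u :+ e :- u := e) refl u ε)))

-- The adjacencies of the unlabelled vertex depend on the index alone, so the count taken for `σ` is
-- valid for every type.
edges : Fin 8 → ℕ
edges i = List.length (List.filter (λ r → adj (underlying (rep₃ σ i)) zero r Bool.≟ true) (# 1 ∷ # 2 ∷ # 3 ∷ []))

many-edges : ∀ (τ : Graph 3) i → SendsAtMostOneEdge (rep₃ τ i) → edges i ℕ.≤ 1
many-edges τ i few = few zero (from-yes (zero ∉? image (# 1 ∷ # 2 ∷ # 3 ∷ [])))

-- Membership in the kernel makes the squared forms vanish, and the support condition makes the
-- coordinates 3, 5, 6, 7 vanish; the rules `rs` combine the two into the vanishing of the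
-- coordinates 0, 1, 2, 4.
trivial-intersection : ∀ (τ : Graph 3) (ts : List (ℕ × Vec ℤ 8)) (ds rs : List (Rule 8)) →
  All (Valid (rows ts)) ds → All (Valid (List.map conclusion ds List.++ units multiEdge)) rs →
  List.map conclusion rs ≡ units (# 0 ∷ # 1 ∷ # 2 ∷ # 4 ∷ []) →
  ∀ v → CombinationOf (𝓕₃ τ) SendsAtMostOneEdge v → ¬ (v ≋ 𝟎ᵛ) → ¬ Kernel (gramMatrix ts) v
trivial-intersection τ ts ds rs ds-valid rs-valid e v comb v≢0 ker = v≢0 v≋0
  where
  x = entries v
  multi : All (NullForm x) (units multiEdge)
  multi = coordinate (# 3) (comb (# 3) (λ few → contradiction (many-edges τ (# 3) few) λ { (s≤s ()) }))
        ∷ coordinate (# 5) (comb (# 5) (λ few → contradiction (many-edges τ (# 5) few) λ { (s≤s ()) }))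
        ∷ coordinate (# 6) (comb (# 6) (λ few → contradiction (many-edges τ (# 6) few) λ { (s≤s ()) }))
        ∷ coordinate (# 7) (comb (# 7) (λ few → contradiction (many-edges τ (# 7) few) λ { (s≤s ()) }))
        ∷ []
    where
    coordinate : ∀ i → v i ≈ 0ℝ → NullForm x (unit i)
    coordinate i vᵢ≈0 = null-cong (λ n → sym (dot-unit i (x n))) (≈⇒null {v i} vᵢ≈0)
  single : All (NullForm x) (units (# 0 ∷ # 1 ∷ # 2 ∷ # 4 ∷ []))
  single = subst (All (NullForm x)) e (deduce x (All.++⁺ (deduce x (kernel⇒null ts {v} ker) ds-valid) multi) rs-valid)
  zero-at : ∀ {i} → NullForm x (unit i) → v i ≈ 0ℝ
  zero-at {i} null = null⇒≈ {v i} {0ℝ} (null-cong (λ n → trans (dot-unit i (x n)) (sym (ℚ.+-identityʳ (x n i)))) null)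
  cover : All (NullForm x) (units (# 0 ∷ # 1 ∷ # 2 ∷ # 4 ∷ [])) → All (NullForm x) (units multiEdge) → v ≋ 𝟎ᵛ
  cover (p ∷ _)             _                    zero                                                  = zero-at p
  cover (_ ∷ p ∷ _)         _                    (suc zero)                                            = zero-at p
  cover (_ ∷ _ ∷ p ∷ _)     _                    (suc (suc zero))                                      = zero-at p
  cover _                   (p ∷ _)              (suc (suc (suc zero)))                                = zero-at p
  cover (_ ∷ _ ∷ _ ∷ p ∷ _) _                    (suc (suc (suc (suc zero))))                          = zero-at p
  cover _                   (_ ∷ p ∷ _)          (suc (suc (suc (suc (suc zero)))))                    = zero-at p
  cover _                   (_ ∷ _ ∷ p ∷ _)      (suc (suc (suc (suc (suc (suc zero))))))              = zero-at p
  cover _                   (_ ∷ _ ∷ _ ∷ p ∷ _)  (suc (suc (suc (suc (suc (suc (suc zero)))))))        = zero-at p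
  v≋0 : v ≋ 𝟎ᵛ
  v≋0 = cover single multi

theorem3p15 :
  let u  = (+ (5 ^ 6)) / (2 ^ 8 * 3 ^ 5)
      a₁ = from-yes (admissible? 5 1)
      a₃ = from-yes (admissible? 5 3)
  in
  HasInducibility C₄-pendant (fromℚ u)
  × u ≡ + 15625 / 62208
  × (Σ[ M ∈ Multipliers 5 ] let open Multipliers M in
      IsCertificate C₄-pendant (from-yes (5 ≤? 5)) (fromℚ u) M
      × (Listed point × Listed ν × Listed σ × Listed μ)
      × HasDimension (Kernel (X a₁ point)) 1
      × HasDimension (Kernel (X a₃ ν)) 1
      × (∀ v → CombinationOf (𝓕 a₃ σ) SendsAtMostOneEdge v → ¬ (v ≋ 𝟎ᵛ) → ¬ Kernel (X a₃ σ) v)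
      × (∀ v → CombinationOf (𝓕 a₃ μ) SendsAtMostOneEdge v → ¬ (v ≋ 𝟎ᵛ) → ¬ Kernel (X a₃ μ) v))
theorem3p15 =
  inducibility , refl , multipliers , certificate , (tt , tt , tt , tt) ,
  -- Here 38, and below 6, are one less than the leading entries 39 and 7 of the kernel vectors.
  kernel-dimension terms₁ 38 (Vec.tail kernel₁) kernel₁-zero
    (λ {x} → relations-of {x = x} terms₁ 38 (Vec.tail kernel₁) duals₁ relations₁ duals₁-valid relations₁-valid refl) ,
  kernel-dimension termsν 6 (Vec.tail kernelν) kernelν-zero
    (λ {x} → relations-of {x = x} termsν 6 (Vec.tail kernelν) dualsν relationsν dualsν-valid relationsν-valid refl) ,
  trivial-intersection σ termsσ dualsσ relationsσ dualsσ-valid relationsσ-valid refl ,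
  trivial-intersection μ termsμ dualsμ relationsμ dualsμ-valid relationsμ-valid refl
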